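{- Let $C_i$ be a sequence of self-dual codes over $\mathbb{Z}_4$ with length $n(C_i)\to\infty$. Then \[ \limsup_{i\to\infty}\frac{d_H(C_i)}{n(C_i)}\le\frac{1-5^{ -1/4}}{2},\qquad \limsup_{i\to\infty}\frac{d_L(C_i)}{n(C_i)}\le 1-5^{ -1/4}, \] where $d_H(C)$ and $d_L(C)$ are the minimum Hamming and Lee weights of nonzero codewords of $C$.
   Context: A code over $\mathbb{Z}_4$ of length $n$ is a $\mathbb{Z}_4$-submodule of $\mathbb{Z}_4^n$; it is self-dual if it equals its dual with respect to the standard inner product $\sum x_iy_i \bmod 4$. The Lee weights of $0,1,2,3\in\mathbb{Z}_4$ are $0,1,2,1$, and the Lee weight of a vector is the sum of Lee weights of its coordinates. -}

module Defs where

open import Data.Nat as ℕ using (ℕ; zero; suc; _%_)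
open import Data.Nat.DivMod using (m%n<n)
open import Data.Fin using (Fin; toℕ; fromℕ<)
open import Data.Vec using (Vec; zipWith; replicate; toList)
open import Data.List using (map)
open import Data.Nat.ListAction using (sum)
open import Data.Integer using (+_)
open import Data.Rational using (ℚ; _/_; _≤_; _<_; _+_; _-_; _*_; 0ℚ; 1ℚ)
open import Data.Product using (Σ; _×_)
open import Relation.Binary.PropositionalEquality using (_≡_; _≢_)
open import Relation.Nullary using (¬_)

Z4 : Set
Z4 = Fin 4

z4 : ℕ → Z4
z4 m = fromℕ< (m%n<n m 4)

_+₄_ : Z4 → Z4 → Z4
a +₄ b = z4 (toℕ a ℕ.+ toℕ b)

_*₄_ : Z4 → Z4 → Z4
a *₄ b = z4 (toℕ a ℕ.* toℕ b)

zeroVec : (n : ℕ) → Vec Z4 n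
zeroVec n = replicate n (z4 0)

_⊕_ : {n : ℕ} → Vec Z4 n → Vec Z4 n → Vec Z4 n
_⊕_ = zipWith _+₄_

scale : {n : ℕ} → Z4 → Vec Z4 n → Vec Z4 n
scale {n} c x = zipWith _*₄_ (replicate n c) x

dot : {n : ℕ} → Vec Z4 n → Vec Z4 n → Z4
dot x y = z4 (sum (toList (zipWith (λ a b → toℕ a ℕ.* toℕ b) x y)))

hamming₁ : Z4 → ℕ
hamming₁ a with toℕ a
... | zero = 0
... | suc _ = 1

lee₁ : Z4 → ℕ
lee₁ a with toℕ a
... | 0 = 0
... | 1 = 1
... | 2 = 2
... | _ = 1

wtH : {n : ℕ} → Vec Z4 n → ℕ
wtH x = sum (map hamming₁ (toList x))

wtL : {n : ℕ} → Vec Z4 n → ℕ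
wtL x = sum (map lee₁ (toList x))

record IsCode {n : ℕ} (C : Vec Z4 n → Set) : Set where
  field
    has-zero : C (zeroVec n)
    add-closed : ∀ x y → C x → C y → C (x ⊕ y)
    scale-closed : ∀ c x → C x → C (scale c x)

IsSelfDual : {n : ℕ} → (Vec Z4 n → Set) → Set
IsSelfDual {n} C = ∀ (y : Vec Z4 n) →
  (C y → ∀ x → C x → dot x y ≡ z4 0) × ((∀ x → C x → dot x y ≡ z4 0) → C y)

IsMinWeight : {n : ℕ} → (Vec Z4 n → ℕ) → (Vec Z4 n → Set) → ℕ → Set
IsMinWeight {n} wt C d =
  Σ (Vec Z4 n) (λ x → C x × x ≢ zeroVec n × wt x ≡ d)
  × (∀ x → C x → x ≢ zeroVec n → d ℕ.≤ wt x)

-- the rational d / n (convention: 0 when n = 0; only used eventually, when n ≥ 1)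
ratio : ℕ → ℕ → ℚ
ratio d zero = 0ℚ
ratio d (suc m) = (+ d) / suc m

TendsToInfinity : (ℕ → ℕ) → Set
TendsToInfinity n = ∀ M → Σ ℕ (λ N → ∀ i → N ℕ.≤ i → M ℕ.≤ n i)

-- x ≤ 1 - 5^(-1/4), for rational x.  Equivalently 5^(-1/4) ≤ q := 1 - x, i.e.
-- 0 ≤ q and 1 ≤ 5 q⁴ (since t ↦ t⁴ is increasing on t ≥ 0).
LeOneMinusFifthRoot : ℚ → Set
LeOneMinusFifthRoot x = (0ℚ ≤ q) × (1ℚ ≤ (+ 5 / 1) * (q * q * q * q))
  where q = 1ℚ - x

-- limsup_{i→∞} a i ≤ L  where the bound "y ≤ L" is given by a predicate Le (closed upward-monotone):
-- for every rational ε > 0, eventually a i - ε ≤ L.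
LimsupLe : (ℕ → ℚ) → (ℚ → Set) → Set
LimsupLe a Le = ∀ (ε : ℚ) → 0ℚ < ε → Σ ℕ (λ N → ∀ i → N ℕ.≤ i → Le (a i - ε))

LeHalfOneMinusFifthRoot : ℚ → Set
LeHalfOneMinusFifthRoot y = LeOneMinusFifthRoot ((+ 2 / 1) * y)

{-# OPTIONS --safe #-}
-- For a self-dual C the binary code T = {c : 2c ∈ C} is the dual of the residue code R = C mod 2, which is doubly
-- even, and T contains R and 1 + R.  Since 2c has Hamming weight wt c and Lee weight 2 wt c, it is enough to bound
-- the minimum weight of T.  After padding with zero coordinates, consider the differential
--   W(w) p(w⁴) (w (1 − w⁴))⁻⁴ˡ⁻¹ dw
-- with W the weight enumerator of R and p an anti-invariant of the octahedral group.  Its poles are the six vertices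
-- of the octahedron; two of them see the weights of R, four of them (through MacWilliams) the weights of T, and the
-- sum of the residues is a linear relation between the two weight distributions.  The contribution of weight 4q
-- behaves like p(Y) at the saddle point Y = (l − q)/(5l − q).  With h = 1 − 33Y − 33Y² + Y³, f = 1 + 14Y + Y²,
-- g = Y(1 − Y)⁴ and p = h (H (5f³ − 3456g) − g), the polynomial p is positive near the saddle point Y = 1/5 of the
-- zero word and below the octahedral image of 1/5 near Y = 0, which is the saddle point of q = (1 − 5^(−1/4)) n / 8.
-- If the minimum weight exceeded the bound, all terms of the relation would have the same sign.
module Submission where

open import Defs
open import Data.Nat using (ℕ; _≤_)
open import Data.Vec using (Vec)
open import Data.Product using (_×_)
open import Algebra.Bundles using (CommutativeRing)
open import Algebra.Solver.Ring.AlmostCommutativeRing using (fromCommutativeRing; _-Raw-AlmostCommutative⟶_)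
open import Data.Empty using (⊥; ⊥-elim)
open import Data.Fin as Fin using (Fin; zero; suc; toℕ)
open import Data.Fin.Patterns using (0F; 1F; 2F; 3F)
import Data.Fin.Properties as Fin
open import Data.Integer as ℤ using (ℤ; +_; -[1+_]; 0ℤ; 1ℤ; _+_; _*_; -_; _-_; +≤+; +<+) renaming (∣_∣ to abs)
import Data.Integer.Properties as ℤ
open import Data.Integer.Tactic.RingSolver using (solve-∀)
open import Data.Maybe using (Maybe; just; nothing)
open import Data.Nat as ℕ using (zero; suc; z≤n; s≤s; _%_; _!)
import Data.Nat.Properties as ℕ
open import Data.Nat.DivMod using (_divMod_; result; m%n<n; [m+kn]%n≡m%n; m≡m%n+[m/n]*n)
open import Data.Nat.ListAction using (sum)
open import Data.Nat.Tactic.RingSolver using () renaming (solve-∀ to solve-ℕ)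
open import Data.Product using (_,_; ∃; proj₁; proj₂)
open import Data.Rational as ℚ using (ℚ; mkℚ; 0ℚ; 1ℚ; _/_; toℚᵘ; *≤*; *<*; Positive)
import Data.Rational.Properties as ℚ
open import Data.Rational.Solver using (module +-*-Solver)
open import Data.Rational.Unnormalised as ℚᵘ using (mkℚᵘ; *≡*; *≤*)
import Data.Rational.Unnormalised.Properties as ℚᵘ
open import Data.Sum using (_⊎_; inj₁; inj₂)
open import Data.Vec as Vec using ([]; _∷_; map; zipWith; replicate; toList)
open import Function using (_∘_)
open import Level using (0ℓ)
open import Relation.Binary.PropositionalEquality as ≡ using (_≡_; _≢_; refl; cong; cong₂; subst; module ≡-Reasoning)
open import Relation.Nullary using (Dec; yes; no; ¬_)
open import Algebra.Properties.Semiring.Sum (CommutativeRing.semiring ℤ.+-*-commutativeRing) using () renaming (sum to ∑; sum-cong-≗ to ∑-cong; *-distribˡ-sum to *-∑; ∑-comm to ∑-swap)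

-- Rational reformulation of the bound

-- The factor 5f³ - 3456g vanishes on the whole octahedral orbit of Y = 1/5, so alone it gives no
-- sign at the saddle point of the zero word. Subtracting g repairs this, since h < 0 < g at 1/5;
-- the price is that the zero near Y = 0 moves by an amount of order 1/H. This is where ε is spent:
-- H is an integer e with ε·e ≥ 1, and the bound is phrased through Q = n·e + n - D·e, that is
-- Q/(n·e) = 1 - D/n + 1/e. The saddle-point heuristic becomes an exact estimate: quotients of
-- residues are quotients of falling factorials, which deviate from powers of Y by O(1/n), while p
-- is at least 1/96 on the relevant ranges of Y. The residue theorem is replaced by a recursion for
-- coefficients of formal power series. A code is a bare predicate, and summing over it needs
-- decidable membership, which is available only under a double negation. Hence the bound comes from
-- a refutation followed by deciding an inequality between natural numbers.

_⁴ : ℕ → ℕ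
a ⁴ = a ℕ.* a ℕ.* (a ℕ.* a)

ι : ℕ → ℚ
ι k = + k / 1

private
  toℚᵘ-/ : ∀ k d → toℚᵘ (+ k / suc d) ℚᵘ.≃ mkℚᵘ (+ k) d
  toℚᵘ-/ k d = ℚ.toℚᵘ-fromℚᵘ (mkℚᵘ (+ k) d)

ι-+ : ∀ a b → ι (a ℕ.+ b) ≡ ι a ℚ.+ ι b
ι-+ a b = ℚ.toℚᵘ-injective (begin
  toℚᵘ (ι (a ℕ.+ b))              ≈⟨ toℚᵘ-/ (a ℕ.+ b) 0 ⟩
  mkℚᵘ (+ (a ℕ.+ b)) 0            ≈⟨ *≡* (≡.trans (cong (ℤ._* + 1) (ℤ.pos-+ a b)) (arith (+ a) (+ b))) ⟩
  mkℚᵘ (+ a) 0 ℚᵘ.+ mkℚᵘ (+ b) 0  ≈⟨ ℚᵘ.+-cong (toℚᵘ-/ a 0) (toℚᵘ-/ b 0) ⟨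
  toℚᵘ (ι a) ℚᵘ.+ toℚᵘ (ι b)      ≈⟨ ℚ.toℚᵘ-homo-+ (ι a) (ι b) ⟨
  toℚᵘ (ι a ℚ.+ ι b) ∎)
  where
  open ℚᵘ.≃-Reasoning
  arith : ∀ x y → (x ℤ.+ y) ℤ.* + 1 ≡ (x ℤ.* + 1 ℤ.+ y ℤ.* + 1) ℤ.* + 1
  arith = solve-∀

ι-* : ∀ a b → ι (a ℕ.* b) ≡ ι a ℚ.* ι b
ι-* a b = ℚ.toℚᵘ-injective (begin
  toℚᵘ (ι (a ℕ.* b))              ≈⟨ toℚᵘ-/ (a ℕ.* b) 0 ⟩
  mkℚᵘ (+ (a ℕ.* b)) 0            ≈⟨ *≡* (cong (ℤ._* + 1) (ℤ.pos-* a b)) ⟩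
  mkℚᵘ (+ a) 0 ℚᵘ.* mkℚᵘ (+ b) 0  ≈⟨ ℚᵘ.*-cong (toℚᵘ-/ a 0) (toℚᵘ-/ b 0) ⟨
  toℚᵘ (ι a) ℚᵘ.* toℚᵘ (ι b)      ≈⟨ ℚ.toℚᵘ-homo-* (ι a) (ι b) ⟨
  toℚᵘ (ι a ℚ.* ι b) ∎)
  where open ℚᵘ.≃-Reasoning

ι-mono : ∀ {a b} → a ℕ.≤ b → ι a ℚ.≤ ι b
ι-mono {a} {b} a≤b = ℚ.toℚᵘ-cancel-≤ (ℚᵘ.≤-respˡ-≃ (ℚᵘ.≃-sym (toℚᵘ-/ a 0)) (ℚᵘ.≤-respʳ-≃ (ℚᵘ.≃-sym (toℚᵘ-/ b 0))
  (*≤* (ℤ.*-monoʳ-≤-nonNeg (+ 1) (ℤ.+≤+ a≤b)))))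

ι-positive : ∀ k → Positive (ι (suc k))
ι-positive k = ℚ.positive (ℚ.<-≤-trans (*<* (ℤ.+<+ (s≤s z≤n))) (ι-mono {1} {suc k} (s≤s z≤n)))

ratio-* : ∀ d n → ratio d (suc n) ℚ.* ι (suc n) ≡ ι d
ratio-* d n = ℚ.toℚᵘ-injective (begin
  toℚᵘ (+ d / suc n ℚ.* ι (suc n))           ≈⟨ ℚ.toℚᵘ-homo-* (+ d / suc n) (ι (suc n)) ⟩
  toℚᵘ (+ d / suc n) ℚᵘ.* toℚᵘ (ι (suc n))   ≈⟨ ℚᵘ.*-cong (toℚᵘ-/ d n) (toℚᵘ-/ (suc n) 0) ⟩
  mkℚᵘ (+ d) n ℚᵘ.* mkℚᵘ (+ suc n) 0         ≈⟨ *≡* (≡.trans (arith (+ d) (+ suc n)) (cong (λ z → + d ℤ.* + z) (≡.sym (ℕ.*-identityʳ (suc n))))) ⟩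
  mkℚᵘ (+ d) 0                               ≈⟨ toℚᵘ-/ d 0 ⟨
  toℚᵘ (ι d) ∎)
  where
  open ℚᵘ.≃-Reasoning
  arith : ∀ x y → x ℤ.* y ℤ.* + 1 ≡ x ℤ.* y
  arith = solve-∀

-- ε·e ≥ 1 for e the denominator of ε.
reciprocal : ∀ ε → 0ℚ ℚ.< ε → ∃ λ k → 1ℚ ℚ.≤ ε ℚ.* ι (suc k)
reciprocal ε@(mkℚ (+ zero) d _) (*<* (ℤ.+<+ ()))
reciprocal ε@(mkℚ (+ suc a) d _) ε>0 = d , ℚ.toℚᵘ-cancel-≤ (ℚᵘ.≤-respʳ-≃
    (ℚᵘ.≃-sym (ℚᵘ.≃-trans (ℚ.toℚᵘ-homo-* ε (ι (suc d))) (ℚᵘ.*-congˡ {mkℚᵘ (+ suc a) d} (toℚᵘ-/ (suc d) 0))))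
    (*≤* (ℤ.+≤+ (begin
      1 ℕ.* (suc d ℕ.* 1)         ≡⟨ arith (suc d) ⟩
      1 ℕ.* suc d ℕ.* 1           ≤⟨ ℕ.*-monoˡ-≤ 1 (ℕ.*-monoˡ-≤ (suc d) (s≤s (z≤n {a}))) ⟩
      suc a ℕ.* suc d ℕ.* 1 ∎))))
  where
  open ℕ.≤-Reasoning
  arith : ∀ x → 1 ℕ.* (x ℕ.* 1) ≡ 1 ℕ.* x ℕ.* 1
  arith = solve-ℕ
reciprocal ε@(mkℚ (ℤ.-[1+ _ ]) d _) (*<* ())

⁴-ι : ∀ a → ι (a ⁴) ≡ ι a ℚ.* ι a ℚ.* (ι a ℚ.* ι a)
⁴-ι a = ≡.trans (ι-* (a ℕ.* a) (a ℕ.* a)) (cong₂ ℚ._*_ (ι-* a a) (ι-* a a))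

*-mono-≤ : ∀ {a b c d} → 0ℚ ℚ.≤ a → 0ℚ ℚ.≤ d → a ℚ.≤ b → c ℚ.≤ d → a ℚ.* c ℚ.≤ b ℚ.* d
*-mono-≤ {a} {b} {c} {d} a≥0 d≥0 a≤b c≤d = ℚ.≤-trans (ℚ.*-monoˡ-≤-nonNeg a {{ℚ.nonNegative a≥0}} c≤d) (ℚ.*-monoʳ-≤-nonNeg d {{ℚ.nonNegative d≥0}} a≤b)

-- `Q / K` is a lower bound for 1 - x whose fourth power is at least 1/5. Clearing the denominator
-- `K` leaves a condition that can be proved over the naturals.
fifthRoot-bound : ∀ x K Q → Positive K → 0ℚ ℚ.≤ Q → Q ℚ.≤ (1ℚ ℚ.- x) ℚ.* K → K ℚ.* K ℚ.* (K ℚ.* K) ℚ.≤ ι 5 ℚ.* (Q ℚ.* Q ℚ.* (Q ℚ.* Q)) →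
  LeOneMinusFifthRoot x
fifthRoot-bound x K Q K>0 Q≥0 Q≤ K⁴≤ = q≥0 , ℚ.*-cancelʳ-≤-pos K⁴ {{K⁴>0}} (begin
    1ℚ ℚ.* K⁴                                       ≡⟨ ℚ.*-identityˡ K⁴ ⟩
    K⁴                                              ≤⟨ K⁴≤ ⟩
    ι 5 ℚ.* (Q ℚ.* Q ℚ.* (Q ℚ.* Q))                 ≤⟨ ℚ.*-monoˡ-≤-nonNeg (ι 5) (*-mono-≤ Q²≥0 P²≥0 Q²≤P² Q²≤P²) ⟩
    ι 5 ℚ.* (q ℚ.* K ℚ.* (q ℚ.* K) ℚ.* (q ℚ.* K ℚ.* (q ℚ.* K))) ≡⟨ arith (ι 5) q K ⟩
    ι 5 ℚ.* (q ℚ.* q ℚ.* q ℚ.* q) ℚ.* K⁴ ∎)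
  where
  open ℚ.≤-Reasoning
  open +-*-Solver
  q = 1ℚ ℚ.- x
  K⁴ = K ℚ.* K ℚ.* (K ℚ.* K)
  P≥0 : 0ℚ ℚ.≤ q ℚ.* K
  P≥0 = ℚ.≤-trans Q≥0 Q≤
  q≥0 : 0ℚ ℚ.≤ q
  q≥0 = ℚ.*-cancelʳ-≤-pos K {{K>0}} (subst (ℚ._≤ q ℚ.* K) (≡.sym (ℚ.*-zeroˡ K)) P≥0)
  square≥0 : ∀ {y} → 0ℚ ℚ.≤ y → 0ℚ ℚ.≤ y ℚ.* y
  square≥0 {y} y≥0 = *-mono-≤ ℚ.≤-refl y≥0 y≥0 y≥0
  Q²≥0 : 0ℚ ℚ.≤ Q ℚ.* Q
  Q²≥0 = square≥0 Q≥0
  P²≥0 : 0ℚ ℚ.≤ q ℚ.* K ℚ.* (q ℚ.* K)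
  P²≥0 = square≥0 P≥0
  Q²≤P² : Q ℚ.* Q ℚ.≤ q ℚ.* K ℚ.* (q ℚ.* K)
  Q²≤P² = *-mono-≤ Q≥0 P≥0 Q≤ Q≤
  K²>0 : Positive (K ℚ.* K)
  K²>0 = ℚ.pos*pos⇒pos K {{K>0}} K {{K>0}}
  K⁴>0 : Positive K⁴
  K⁴>0 = ℚ.pos*pos⇒pos (K ℚ.* K) {{K²>0}} (K ℚ.* K) {{K²>0}}
  arith : ∀ f q K → f ℚ.* (q ℚ.* K ℚ.* (q ℚ.* K) ℚ.* (q ℚ.* K ℚ.* (q ℚ.* K))) ≡ f ℚ.* (q ℚ.* q ℚ.* q ℚ.* q) ℚ.* (K ℚ.* K ℚ.* (K ℚ.* K))
  arith = solve 3 (λ f q K → f :* (q :* K :* (q :* K) :* (q :* K :* (q :* K))) := f :* (q :* q :* q :* q) :* (K :* K :* (K :* K))) refl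

-- c is 1 for the Lee weight and 2 for the Hamming weight.
rational-bound : ∀ n k c d ε Q → 1 ℕ.≤ c → 1ℚ ℚ.≤ ε ℚ.* ι (suc k) →
  Q ℕ.+ c ℕ.* d ℕ.* suc k ≡ suc n ℕ.* suc k ℕ.+ suc n → (suc n ℕ.* suc k) ⁴ ℕ.≤ 5 ℕ.* Q ⁴ →
  LeOneMinusFifthRoot (ι c ℚ.* (ratio d (suc n) ℚ.- ε))
rational-bound n k c d ε Q c≥1 εe≥1 Q-eq Q-large = fifthRoot-bound (ι c ℚ.* (r ℚ.- ε)) (N ℚ.* E) (ι Q)
    (ℚ.pos*pos⇒pos N {{ι-positive n}} E {{ι-positive k}}) (ι-mono {0} {Q} z≤n)
    (begin
      ι Q                                               ≡⟨ cancel (ι Q) (ι c ℚ.* ι d ℚ.* E) ⟩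
      ι Q ℚ.+ ι c ℚ.* ι d ℚ.* E ℚ.- ι c ℚ.* ι d ℚ.* E   ≡⟨ cong (ℚ._- ι c ℚ.* ι d ℚ.* E) Q-eqℚ ⟩
      -- The extra summand n in the equation for `Q` is paid for by ε, because c·ε·e ≥ 1.
      N ℚ.* E ℚ.+ N ℚ.- ι c ℚ.* ι d ℚ.* E               ≤⟨ ℚ.+-monoˡ-≤ (ℚ.- (ι c ℚ.* ι d ℚ.* E)) (ℚ.+-monoʳ-≤ (N ℚ.* E) N≤) ⟩
      N ℚ.* E ℚ.+ ι c ℚ.* (ε ℚ.* E) ℚ.* N ℚ.- ι c ℚ.* ι d ℚ.* E ≡⟨ cong (λ z → N ℚ.* E ℚ.+ ι c ℚ.* (ε ℚ.* E) ℚ.* N ℚ.- ι c ℚ.* z ℚ.* E) (ratio-* d n) ⟨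
      N ℚ.* E ℚ.+ ι c ℚ.* (ε ℚ.* E) ℚ.* N ℚ.- ι c ℚ.* (r ℚ.* N) ℚ.* E ≡⟨ collect (ι c) r ε N E ⟩
      (1ℚ ℚ.- ι c ℚ.* (r ℚ.- ε)) ℚ.* (N ℚ.* E) ∎)
    (begin
      N ℚ.* E ℚ.* (N ℚ.* E) ℚ.* (N ℚ.* E ℚ.* (N ℚ.* E)) ≡⟨ cong (λ z → z ℚ.* z ℚ.* (z ℚ.* z)) (ι-* (suc n) (suc k)) ⟨
      ι K ℚ.* ι K ℚ.* (ι K ℚ.* ι K)                     ≡⟨ ⁴-ι K ⟨
      ι (K ⁴)                                           ≤⟨ ι-mono Q-large ⟩
      ι (5 ℕ.* Q ⁴)                                     ≡⟨ ι-* 5 (Q ⁴) ⟩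
      ι 5 ℚ.* ι (Q ⁴)                                   ≡⟨ cong (ι 5 ℚ.*_) (⁴-ι Q) ⟩
      ι 5 ℚ.* (ι Q ℚ.* ι Q ℚ.* (ι Q ℚ.* ι Q)) ∎)
  where
  open ℚ.≤-Reasoning
  open +-*-Solver
  K = suc n ℕ.* suc k
  N E r : ℚ
  N = ι (suc n)
  E = ι (suc k)
  r = ratio d (suc n)
  Q-eqℚ : ι Q ℚ.+ ι c ℚ.* ι d ℚ.* E ≡ N ℚ.* E ℚ.+ N
  Q-eqℚ = ≡.trans (≡.sym (≡.trans (ι-+ Q (c ℕ.* d ℕ.* suc k)) (cong (ι Q ℚ.+_) (≡.trans (ι-* (c ℕ.* d) (suc k)) (cong (ℚ._* E) (ι-* c d))))))
    (≡.trans (cong ι Q-eq) (≡.trans (ι-+ K (suc n)) (cong (ℚ._+ N) (ι-* (suc n) (suc k)))))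
  1≤ : 1ℚ ℚ.≤ ι c ℚ.* (ε ℚ.* E)
  1≤ = ℚ.≤-trans εe≥1 (ℚ.≤-trans (ℚ.≤-reflexive (≡.sym (ℚ.*-identityˡ (ε ℚ.* E))))
    (ℚ.*-monoʳ-≤-nonNeg (ε ℚ.* E) {{ℚ.nonNegative (ℚ.≤-trans (*≤* (ℤ.+≤+ z≤n)) εe≥1)}} (ι-mono {1} {c} c≥1)))
  N≤ : N ℚ.≤ ι c ℚ.* (ε ℚ.* E) ℚ.* N
  N≤ = subst (ℚ._≤ ι c ℚ.* (ε ℚ.* E) ℚ.* N) (ℚ.*-identityˡ N) (ℚ.*-monoʳ-≤-nonNeg N {{ℚ.pos⇒nonNeg N {{ι-positive n}}}} 1≤)
  cancel : ∀ x y → x ≡ x ℚ.+ y ℚ.- y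
  cancel = solve 2 (λ x y → x := x :+ y :- y) refl
  collect : ∀ c r ε N E → N ℚ.* E ℚ.+ c ℚ.* (ε ℚ.* E) ℚ.* N ℚ.- c ℚ.* (r ℚ.* N) ℚ.* E ≡ (1ℚ ℚ.- c ℚ.* (r ℚ.- ε)) ℚ.* (N ℚ.* E)
  collect = solve 5 (λ c r ε N E → N :* E :+ c :* (ε :* E) :* N :- c :* (r :* N) :* E := (con 1ℚ :- c :* (r :- ε)) :* (N :* E)) refl

-- Formal power series over ℤ

Series : Set
Series = ℕ → ℤ

infix 4 _≈_
record _≈_ (a b : Series) : Set where
  constructor pointwise
  field coeff : ∀ n → a n ≡ b n
open _≈_

tail : Series → Series
tail a n = a (suc n)

infixl 6 _⊹_
infixl 7 _⊛_
_⊹_ _⊛_ : Series → Series → Series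
(a ⊹ b) n = a n + b n
(a ⊛ b) zero    = a 0 * b 0
(a ⊛ b) (suc n) = a 0 * b (suc n) + (tail a ⊛ b) n

neg : Series → Series
neg a n = - a n

const : ℤ → Series
const c zero    = c
const c (suc n) = 0ℤ

𝟘 𝟙 : Series
𝟘 = const 0ℤ
𝟙 = const 1ℤ

+-right : ∀ x {y z} → y ≡ z → x + y ≡ x + z
+-right x = cong (λ y → x + y)

+-left : ∀ x {y z} → y ≡ z → y + x ≡ z + x
+-left x = cong (λ y → y + x)

private
  +-interchange : ∀ a b c d → (a + b) + (c + d) ≡ (a + c) + (b + d)
  +-interchange = solve-∀

⊛-cong : ∀ {a b c d} → a ≈ b → c ≈ d → a ⊛ c ≈ b ⊛ d
⊛-cong {c = c} {d} p q = pointwise (go p)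
  where
  go : ∀ {a b} → a ≈ b → ∀ n → (a ⊛ c) n ≡ (b ⊛ d) n
  go p zero    = cong₂ _*_ (coeff p 0) (coeff q 0)
  go p (suc n) = cong₂ _+_ (cong₂ _*_ (coeff p 0) (coeff q (suc n)))
                           (go (pointwise λ k → coeff p (suc k)) n)

𝟘-coeff : ∀ n → 𝟘 n ≡ 0ℤ
𝟘-coeff zero    = refl
𝟘-coeff (suc n) = refl

private
  zeroˡ : ∀ a b → (∀ n → a n ≡ 0ℤ) → ∀ n → (a ⊛ b) n ≡ 0ℤ
  zeroˡ a b z zero    rewrite z 0 = ℤ.*-zeroˡ (b 0)
  zeroˡ a b z (suc n) rewrite z 0 | ℤ.*-zeroˡ (b (suc n)) | zeroˡ (tail a) b (λ k → z (suc k)) n = refl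

const-⊛ : ∀ c a n → (const c ⊛ a) n ≡ c * a n
const-⊛ c a zero    = refl
const-⊛ c a (suc n) rewrite zeroˡ (tail (const c)) a (λ _ → refl) n = ℤ.+-identityʳ _

⊛-distribʳ : ∀ a b c n → ((a ⊹ b) ⊛ c) n ≡ (a ⊛ c) n + (b ⊛ c) n
⊛-distribʳ a b c zero    = ℤ.*-distribʳ-+ (c 0) (a 0) (b 0)
⊛-distribʳ a b c (suc n) = ≡.trans
  (cong₂ _+_ (ℤ.*-distribʳ-+ (c (suc n)) (a 0) (b 0)) (⊛-distribʳ (tail a) (tail b) c n))
  (+-interchange (a 0 * c (suc n)) (b 0 * c (suc n)) _ _)

⊛-distribˡ : ∀ a b c n → (a ⊛ (b ⊹ c)) n ≡ (a ⊛ b) n + (a ⊛ c) n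
⊛-distribˡ a b c zero    = ℤ.*-distribˡ-+ (a 0) (b 0) (c 0)
⊛-distribˡ a b c (suc n) = ≡.trans
  (cong₂ _+_ (ℤ.*-distribˡ-+ (a 0) (b (suc n)) (c (suc n))) (⊛-distribˡ (tail a) b c n))
  (+-interchange (a 0 * b (suc n)) (a 0 * c (suc n)) _ _)

private
  scaleˡ : ∀ k b c n → ((λ i → k * b i) ⊛ c) n ≡ k * (b ⊛ c) n
  scaleˡ k b c zero    = ℤ.*-assoc k (b 0) (c 0)
  scaleˡ k b c (suc n) rewrite scaleˡ k (tail b) c n = lem k (b 0) (c (suc n)) _
    where
    lem : ∀ k x y z → k * x * y + k * z ≡ k * (x * y + z)
    lem = solve-∀

⊛-assoc : ∀ a b c n → ((a ⊛ b) ⊛ c) n ≡ (a ⊛ (b ⊛ c)) n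
⊛-assoc a b c zero    = ℤ.*-assoc (a 0) (b 0) (c 0)
⊛-assoc a b c (suc n) = begin
  a 0 * b 0 * c (suc n) + ((λ i → (a 0 * b (suc i)) + (tail a ⊛ b) i) ⊛ c) n
    ≡⟨ +-right (a 0 * b 0 * c (suc n)) (⊛-distribʳ (λ i → a 0 * b (suc i)) (tail a ⊛ b) c n) ⟩
  a 0 * b 0 * c (suc n) + (((λ i → a 0 * b (suc i)) ⊛ c) n + ((tail a ⊛ b) ⊛ c) n)
    ≡⟨ +-right (a 0 * b 0 * c (suc n)) (cong₂ _+_ (scaleˡ (a 0) (tail b) c n) (⊛-assoc (tail a) b c n)) ⟩
  a 0 * b 0 * c (suc n) + (a 0 * (tail b ⊛ c) n + (tail a ⊛ (b ⊛ c)) n)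
    ≡⟨ lem (a 0) (b 0) (c (suc n)) _ _ ⟩
  a 0 * (b 0 * c (suc n) + (tail b ⊛ c) n) + (tail a ⊛ (b ⊛ c)) n ∎
  where
  open ≡-Reasoning
  lem : ∀ k x y z w → k * x * y + (k * z + w) ≡ k * (x * y + z) + w
  lem = solve-∀

private
  ⊛-suc : ∀ a b n → (a ⊛ b) (suc n) ≡ (a ⊛ tail b) n + a (suc n) * b 0
  ⊛-suc a b zero    = refl
  ⊛-suc a b (suc n) = ≡.trans (+-right (a 0 * b (suc (suc n))) (⊛-suc (tail a) b n))
                              (≡.sym (ℤ.+-assoc (a 0 * b (suc (suc n))) ((tail a ⊛ tail b) n) (a (suc (suc n)) * b 0)))

⊛-comm : ∀ a b n → (a ⊛ b) n ≡ (b ⊛ a) n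
⊛-comm a b zero    = ℤ.*-comm (a 0) (b 0)
⊛-comm a b (suc n) = begin
  a 0 * b (suc n) + (tail a ⊛ b) n  ≡⟨ cong₂ _+_ (ℤ.*-comm (a 0) _) (⊛-comm (tail a) b n) ⟩
  b (suc n) * a 0 + (b ⊛ tail a) n  ≡⟨ ℤ.+-comm (b (suc n) * a 0) _ ⟩
  (b ⊛ tail a) n + b (suc n) * a 0  ≡⟨ ⊛-suc b a n ⟨
  (b ⊛ a) (suc n) ∎
  where open ≡-Reasoning

seriesRing : CommutativeRing 0ℓ 0ℓ
seriesRing = record
  { Carrier = Series ; _≈_ = _≈_ ; _+_ = _⊹_ ; _*_ = _⊛_ ; -_ = neg ; 0# = 𝟘 ; 1# = 𝟙
  ; isCommutativeRing = record
    { isRing = record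
      { +-isAbelianGroup = record
        { isGroup = record
          { isMonoid = record
            { isSemigroup = record
              { isMagma = record
                { isEquivalence = record
                  { refl  = pointwise λ _ → refl
                  ; sym   = λ p → pointwise λ n → ≡.sym (coeff p n)
                  ; trans = λ p q → pointwise λ n → ≡.trans (coeff p n) (coeff q n) }
                ; ∙-cong = λ p q → pointwise λ n → cong₂ _+_ (coeff p n) (coeff q n) }
              ; assoc = λ a b c → pointwise λ n → ℤ.+-assoc (a n) (b n) (c n) }
            ; identity = (λ a → pointwise λ n → ≡.trans (+-left (a n) (𝟘-coeff n)) (ℤ.+-identityˡ (a n)))
                       , (λ a → pointwise λ n → ≡.trans (+-right (a n) (𝟘-coeff n)) (ℤ.+-identityʳ (a n))) }
          ; inverse = (λ a → pointwise λ n → ≡.trans (ℤ.+-inverseˡ (a n)) (≡.sym (𝟘-coeff n)))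
                    , (λ a → pointwise λ n → ≡.trans (ℤ.+-inverseʳ (a n)) (≡.sym (𝟘-coeff n)))
          ; ⁻¹-cong = λ p → pointwise λ n → cong -_ (coeff p n) }
        ; comm = λ a b → pointwise λ n → ℤ.+-comm (a n) (b n) }
      ; *-cong = ⊛-cong
      ; *-assoc = λ a b c → pointwise (⊛-assoc a b c)
      ; *-identity = (λ a → pointwise λ n → ≡.trans (const-⊛ 1ℤ a n) (ℤ.*-identityˡ (a n)))
                   , (λ a → pointwise λ n → ≡.trans (⊛-comm a 𝟙 n) (≡.trans (const-⊛ 1ℤ a n) (ℤ.*-identityˡ (a n))))
      ; distrib = (λ a b c → pointwise (⊛-distribˡ a b c)) , (λ a b c → pointwise (⊛-distribʳ b c a)) }
    ; *-comm = λ a b → pointwise (⊛-comm a b) } }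

open CommutativeRing seriesRing using (semiring)
  renaming (refl to ≈-refl; sym to ≈-sym; trans to ≈-trans; setoid to seriesSetoid;
            +-cong to ⊹-cong; *-congˡ to ⊛-congˡ; *-congʳ to ⊛-congʳ)
open import Algebra.Properties.CommutativeSemiring.Exp (CommutativeRing.commutativeSemiring seriesRing) using (^-distrib-*)
open import Algebra.Properties.Semiring.Exp semiring using (_^_; ^-homo-*; ^-congˡ; ^-congʳ; ^-assocʳ)

const-⊛-const : ∀ c d → const (c * d) ≈ const c ⊛ const d
const-⊛-const c d = pointwise λ n → ≡.sym (≡.trans (const-⊛ c (const d) n) (lem n))
  where
  lem : ∀ n → c * const d n ≡ const (c * d) n
  lem zero    = refl
  lem (suc n) = ℤ.*-zeroʳ c

const-+ : ∀ c d → const (c + d) ≈ const c ⊹ const d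
const-+ c d = pointwise λ { zero → refl ; (suc n) → refl }

const-neg : ∀ c → const (- c) ≈ neg (const c)
const-neg c = pointwise λ { zero → refl ; (suc n) → refl }

private
  constMorphism : CommutativeRing.rawRing ℤ.+-*-commutativeRing -Raw-AlmostCommutative⟶ fromCommutativeRing seriesRing
  constMorphism = record
    { ⟦_⟧ = const ; +-homo = const-+ ; *-homo = const-⊛-const ; -‿homo = const-neg
    ; 0-homo = ≈-refl ; 1-homo = ≈-refl }

  const-≟ : ∀ c d → Maybe (const c ≈ const d)
  const-≟ c d with c ℤ.≟ d
  ... | yes refl = just ≈-refl
  ... | no _     = nothing

module SeriesSolver where
  open import Algebra.Solver.Ring (CommutativeRing.rawRing ℤ.+-*-commutativeRing) (fromCommutativeRing seriesRing) constMorphism const-≟ public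

import Relation.Binary.Reasoning.Setoid seriesSetoid as ≈-Reasoning

open SeriesSolver using (Polynomial; solve; _:=_; _:+_; _:*_; :-_; _:^_; con)

-- The Euler derivation and logarithmic derivatives

θ : Series → Series
θ a n = + n * a n

θ-⊛ : ∀ a b → θ (a ⊛ b) ≈ θ a ⊛ b ⊹ a ⊛ θ b
θ-⊛ a b = pointwise (go a)
  where
  open ≡-Reasoning
  suc-* : ∀ n x → + suc n * x ≡ x + + n * x
  suc-* n x = ≡.trans (ℤ.*-distribʳ-+ x 1ℤ (+ n)) (+-left (+ n * x) (ℤ.*-identityˡ x))
  tail-θ : ∀ a → tail (θ a) ≈ tail a ⊹ θ (tail a)
  tail-θ a = pointwise λ n → suc-* n (a (suc n))
  lem : ∀ x y c z p q → c * (x * y) + (z + (p + q)) ≡ (+ 0 * x * y + (z + p)) + (x * (c * y) + q)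
  lem = solve-∀
  go : ∀ a n → θ (a ⊛ b) n ≡ (θ a ⊛ b) n + (a ⊛ θ b) n
  go a zero = lem₀ (a 0) (b 0)
    where
    lem₀ : ∀ x y → + 0 * (x * y) ≡ + 0 * x * y + x * (+ 0 * y)
    lem₀ = solve-∀
  go a (suc n) = begin
    + suc n * (a 0 * b (suc n) + (tail a ⊛ b) n)
      ≡⟨ ℤ.*-distribˡ-+ (+ suc n) (a 0 * b (suc n)) _ ⟩
    + suc n * (a 0 * b (suc n)) + + suc n * (tail a ⊛ b) n
      ≡⟨ +-right (+ suc n * (a 0 * b (suc n))) (≡.trans (suc-* n ((tail a ⊛ b) n)) (+-right ((tail a ⊛ b) n) (go (tail a) n))) ⟩
    + suc n * (a 0 * b (suc n)) + ((tail a ⊛ b) n + ((θ (tail a) ⊛ b) n + (tail a ⊛ θ b) n))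
      ≡⟨ lem (a 0) (b (suc n)) (+ suc n) ((tail a ⊛ b) n) ((θ (tail a) ⊛ b) n) ((tail a ⊛ θ b) n) ⟩
    (+ 0 * a 0 * b (suc n) + ((tail a ⊛ b) n + (θ (tail a) ⊛ b) n)) + (a 0 * (+ suc n * b (suc n)) + (tail a ⊛ θ b) n)
      ≡⟨ cong (λ z → (+ 0 * a 0 * b (suc n) + z) + (a 0 * (+ suc n * b (suc n)) + (tail a ⊛ θ b) n))
           (≡.sym (≡.trans (coeff (⊛-congʳ {b} (tail-θ a)) n) (⊛-distribʳ (tail a) (θ (tail a)) b n))) ⟩
    (θ a ⊛ b) (suc n) + (a ⊛ θ b) (suc n) ∎

θ-cong : ∀ {a b} → a ≈ b → θ a ≈ θ b
θ-cong p = pointwise λ n → cong (+ n *_) (coeff p n)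

θ-const : ∀ c → θ (const c) ≈ 𝟘
θ-const c = pointwise λ { zero → ℤ.*-zeroˡ c ; (suc n) → ℤ.*-zeroʳ (+ suc n) }

w u v s : Series
w zero    = 0ℤ
w (suc n) = 𝟙 n
u = 𝟙 ⊹ neg w
v = 𝟙 ⊹ w
s = 𝟙 ⊹ w ⊛ w

w-⊛-suc : ∀ a n → (w ⊛ a) (suc n) ≡ a n
w-⊛-suc a n = ≡.trans (+-left ((𝟙 ⊛ a) n) (ℤ.*-zeroˡ (a (suc n))))
  (≡.trans (ℤ.+-identityˡ ((𝟙 ⊛ a) n)) (≡.trans (const-⊛ 1ℤ a n) (ℤ.*-identityˡ (a n))))

w-⊛-zero : ∀ a → (w ⊛ a) 0 ≡ 0ℤ
w-⊛-zero a = ℤ.*-zeroˡ (a 0)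

ū v̄ s̄ : Series
ū n = 1ℤ
v̄ zero    = 1ℤ
v̄ (suc n) = - v̄ n
s̄ zero          = 1ℤ
s̄ (suc zero)    = 0ℤ
s̄ (suc (suc n)) = - s̄ n

u-inverse : u ⊛ ū ≈ 𝟙
u-inverse = ≈-trans (solve 2 (λ W X → (con 1ℤ :+ (:- W)) :* X := X :+ (:- (W :* X))) ≈-refl w ū)
  (pointwise λ { zero → refl ; (suc n) → cong (λ z → 1ℤ + - z) (w-⊛-suc ū n) })

v-inverse : v ⊛ v̄ ≈ 𝟙
v-inverse = ≈-trans (solve 2 (λ W X → (con 1ℤ :+ W) :* X := X :+ W :* X) ≈-refl w v̄)
  (pointwise λ { zero → refl ; (suc n) → ≡.trans (+-right (- v̄ n) (w-⊛-suc v̄ n)) (ℤ.+-inverseˡ (v̄ n)) })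

s-inverse : s ⊛ s̄ ≈ 𝟙
s-inverse = ≈-trans (solve 2 (λ W X → (con 1ℤ :+ W :* W) :* X := X :+ W :* (W :* X)) ≈-refl w s̄)
  (pointwise λ { zero → refl
               ; (suc zero) → ≡.trans (+-right 0ℤ (≡.trans (w-⊛-suc (w ⊛ s̄) 0) (w-⊛-zero s̄))) refl
               ; (suc (suc n)) → ≡.trans (+-right (- s̄ n) (≡.trans (w-⊛-suc (w ⊛ s̄) (suc n)) (w-⊛-suc s̄ n)))
                                         (ℤ.+-inverseˡ (s̄ n)) })

const-suc : ∀ n → const (+ suc n) ≈ const (+ n) ⊹ 𝟙
const-suc n = ≈-trans (const-+ 1ℤ (+ n)) (solve 1 (λ N → con 1ℤ :+ N := N :+ con 1ℤ) ≈-refl (const (+ n)))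

module _ {x x̄ y : Series} (inv : x ⊛ x̄ ≈ 𝟙) (θx : θ x ≈ y) where

  θ-^ : ∀ a → θ (x ^ a) ≈ const (+ a) ⊛ (y ⊛ (x ^ a ⊛ x̄))
  θ-^ zero = ≈-trans (θ-const 1ℤ) (solve 2 (λ Y X̄ → con 0ℤ := con 0ℤ :* (Y :* (con 1ℤ :* X̄))) ≈-refl y x̄)
  θ-^ (suc a) = begin
    θ (x ⊛ x ^ a)
      ≈⟨ θ-⊛ x (x ^ a) ⟩
    θ x ⊛ x ^ a ⊹ x ⊛ θ (x ^ a)
      ≈⟨ ⊹-cong (⊛-cong θx ≈-refl) (⊛-cong ≈-refl (θ-^ a)) ⟩
    y ⊛ x ^ a ⊹ x ⊛ (const (+ a) ⊛ (y ⊛ (x ^ a ⊛ x̄)))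
      ≈⟨ solve 5 (λ X X̄ Y P A → Y :* P :+ X :* (A :* (Y :* (P :* X̄))) := con 1ℤ :* (Y :* P) :+ A :* (Y :* (X :* P :* X̄))) ≈-refl x x̄ y (x ^ a) (const (+ a)) ⟩
    𝟙 ⊛ (y ⊛ x ^ a) ⊹ const (+ a) ⊛ (y ⊛ (x ⊛ x ^ a ⊛ x̄))
      ≈⟨ ⊹-cong (⊛-cong (≈-sym inv) ≈-refl) ≈-refl ⟩
    x ⊛ x̄ ⊛ (y ⊛ x ^ a) ⊹ const (+ a) ⊛ (y ⊛ (x ⊛ x ^ a ⊛ x̄))
      ≈⟨ solve 5 (λ X X̄ Y P A → X :* X̄ :* (Y :* P) :+ A :* (Y :* (X :* P :* X̄)) := (A :+ con 1ℤ) :* (Y :* (X :* P :* X̄))) ≈-refl x x̄ y (x ^ a) (const (+ a)) ⟩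
    (const (+ a) ⊹ 𝟙) ⊛ (y ⊛ (x ⊛ x ^ a ⊛ x̄))
      ≈⟨ ⊛-cong (≈-sym (const-suc a)) ≈-refl ⟩
    const (+ suc a) ⊛ (y ⊛ (x ⊛ x ^ a ⊛ x̄)) ∎
    where open ≈-Reasoning

  θ-inverse : θ x̄ ≈ neg (y ⊛ (x̄ ⊛ x̄))
  θ-inverse = begin
    θ x̄
      ≈⟨ solve 2 (λ D Z → D := con 1ℤ :* D) ≈-refl (θ x̄) 𝟘 ⟩
    𝟙 ⊛ θ x̄
      ≈⟨ ⊛-cong (≈-sym inv) ≈-refl ⟩
    x ⊛ x̄ ⊛ θ x̄
      ≈⟨ solve 4 (λ X X̄ Y D → X :* X̄ :* D := X̄ :* (Y :* X̄ :+ X :* D) :+ :- (Y :* (X̄ :* X̄))) ≈-refl x x̄ y (θ x̄) ⟩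
    x̄ ⊛ (y ⊛ x̄ ⊹ x ⊛ θ x̄) ⊹ neg (y ⊛ (x̄ ⊛ x̄))
      ≈⟨ ⊹-cong (⊛-cong ≈-refl vanish) ≈-refl ⟩
    x̄ ⊛ 𝟘 ⊹ neg (y ⊛ (x̄ ⊛ x̄))
      ≈⟨ solve 2 (λ X̄ Y → X̄ :* con 0ℤ :+ :- (Y :* (X̄ :* X̄)) := :- (Y :* (X̄ :* X̄))) ≈-refl x̄ y ⟩
    neg (y ⊛ (x̄ ⊛ x̄)) ∎
    where
    open ≈-Reasoning
    vanish : y ⊛ x̄ ⊹ x ⊛ θ x̄ ≈ 𝟘
    vanish = ≈-trans (⊹-cong (⊛-cong (≈-sym θx) ≈-refl) ≈-refl)
      (≈-trans (≈-sym (θ-⊛ x x̄)) (≈-trans (θ-cong inv) (θ-const 1ℤ)))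

inverse-sym : ∀ {x x̄} → x ⊛ x̄ ≈ 𝟙 → x̄ ⊛ x ≈ 𝟙
inverse-sym {x} {x̄} inv = ≈-trans (pointwise (⊛-comm x̄ x)) inv

-- A possibly negative exponent a - c is carried as the pair `x ^ a`, `x̄ ^ c`; the additional `x̄`
-- on the right is the 1/x of the logarithmic derivative.
θ-power : ∀ {x x̄ y} → x ⊛ x̄ ≈ 𝟙 → θ x ≈ y →
  ∀ a c → θ (x ^ a ⊛ x̄ ^ c) ≈ const (+ a - + c) ⊛ (y ⊛ (x ^ a ⊛ x̄ ^ suc c))
θ-power {x} {x̄} {y} inv θx a c = begin
  θ (x ^ a ⊛ x̄ ^ c)
    ≈⟨ θ-⊛ (x ^ a) (x̄ ^ c) ⟩
  θ (x ^ a) ⊛ x̄ ^ c ⊹ x ^ a ⊛ θ (x̄ ^ c)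
    ≈⟨ ⊹-cong (⊛-cong (θ-^ inv θx a) ≈-refl)
              (⊛-cong ≈-refl (θ-^ {x̄} {x} (inverse-sym inv) (θ-inverse inv θx) c)) ⟩
  const (+ a) ⊛ (y ⊛ (x ^ a ⊛ x̄)) ⊛ x̄ ^ c ⊹ x ^ a ⊛ (const (+ c) ⊛ (neg (y ⊛ (x̄ ⊛ x̄)) ⊛ (x̄ ^ c ⊛ x)))
    ≈⟨ solve 7 (λ X X̄ Y P Q A C → A :* (Y :* (P :* X̄)) :* Q :+ P :* (C :* (:- (Y :* (X̄ :* X̄)) :* (Q :* X)))
                 := A :* (Y :* (P :* (X̄ :* Q))) :+ (X :* X̄) :* (:- C :* (Y :* (P :* (X̄ :* Q)))))
         ≈-refl x x̄ y (x ^ a) (x̄ ^ c) (const (+ a)) (const (+ c)) ⟩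
  const (+ a) ⊛ Q ⊹ (x ⊛ x̄) ⊛ (neg (const (+ c)) ⊛ Q)
    ≈⟨ ⊹-cong (≈-refl {const (+ a) ⊛ Q}) (⊛-cong inv (≈-refl {neg (const (+ c)) ⊛ Q})) ⟩
  const (+ a) ⊛ Q ⊹ 𝟙 ⊛ (neg (const (+ c)) ⊛ Q)
    ≈⟨ solve 3 (λ A C Q → A :* Q :+ con 1ℤ :* (:- C :* Q) := (A :+ :- C) :* Q) ≈-refl (const (+ a)) (const (+ c)) Q ⟩
  (const (+ a) ⊹ neg (const (+ c))) ⊛ Q
    ≈⟨ ⊛-cong (≈-sym (≈-trans (const-+ (+ a) (- + c)) (⊹-cong (≈-refl {const (+ a)}) (const-neg (+ c))))) ≈-refl ⟩
  const (+ a - + c) ⊛ Q ∎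
  where
  open ≈-Reasoning
  Q = y ⊛ (x ^ a ⊛ x̄ ^ suc c)

θ-w : θ w ≈ w
θ-w = pointwise λ { zero → refl ; (suc zero) → refl ; (suc (suc n)) → ℤ.*-zeroʳ (+ suc (suc n)) }

θ-⊹ : ∀ a b → θ (a ⊹ b) ≈ θ a ⊹ θ b
θ-⊹ a b = pointwise λ n → ℤ.*-distribˡ-+ (+ n) (a n) (b n)

θ-neg : ∀ a → θ (neg a) ≈ neg (θ a)
θ-neg a = pointwise λ n → ≡.sym (ℤ.neg-distribʳ-* (+ n) (a n))

θ-u : θ u ≈ neg w
θ-u = ≈-trans (θ-⊹ 𝟙 (neg w)) (≈-trans (⊹-cong (θ-const 1ℤ) (≈-trans (θ-neg w) (pointwise λ n → cong -_ (coeff θ-w n))))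
  (solve 1 (λ W → con 0ℤ :+ :- W := :- W) ≈-refl w))

θ-v : θ v ≈ w
θ-v = ≈-trans (θ-⊹ 𝟙 w) (≈-trans (⊹-cong (θ-const 1ℤ) θ-w) (solve 1 (λ W → con 0ℤ :+ W := W) ≈-refl w))

θ-s : θ s ≈ const (+ 2) ⊛ (w ⊛ w)
θ-s = ≈-trans (θ-⊹ 𝟙 (w ⊛ w)) (≈-trans (⊹-cong (θ-const 1ℤ) (≈-trans (θ-⊛ w w) (⊹-cong (⊛-cong θ-w ≈-refl) (⊛-cong ≈-refl θ-w))))
  (solve 1 (λ W → con 0ℤ :+ (W :* W :+ W :* W) := con (+ 2) :* (W :* W)) ≈-refl w))

-- Since θG − mG has no coefficient at wᵐ, the logarithmic derivative of G = uᵗ v⁴ᵐ⁻ᵗ s⁻ᵐ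
-- yields a first-order recursion in m.
exactness : ∀ (t : ℤ) m X Y Z →
  θ (u ⊛ X) ≈ const t ⊛ (neg w ⊛ X) →
  θ (v ⊛ Y) ≈ const (+ 4 * + suc m - t) ⊛ (w ⊛ Y) →
  θ (s ⊛ Z) ≈ const (- + suc m) ⊛ (const (+ 2) ⊛ (w ⊛ w) ⊛ Z) →
  + suc m * (u ⊛ (u ⊛ (u ⊛ (u ⊛ (X ⊛ Y ⊛ Z))))) (suc m) ≡ - + 2 * t * (s ⊛ (X ⊛ Y ⊛ Z)) m
exactness t m X Y Z hX hY hZ = cancel (+ suc m) (G (suc m)) (F (suc m)) (- + 2 * t) ((s ⊛ Q) m)
  (≡.trans (coeff main (suc m)) (≡.trans (+-left _ (const-⊛ (+ suc m) G (suc m))) split))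
  where
  Q = X ⊛ Y ⊛ Z
  G = (u ⊛ X) ⊛ (v ⊛ Y) ⊛ (s ⊛ Z)
  F = u ⊛ (u ⊛ (u ⊛ (u ⊛ Q)))
  M = const (+ suc m)
  T = const t
  open ≈-Reasoning
  const-4m-t : const (+ 4 * + suc m - t) ≈ const (+ 4) ⊛ M ⊹ neg T
  const-4m-t = ≈-trans (const-+ (+ 4 * + suc m) (- t)) (⊹-cong (const-⊛-const (+ 4) (+ suc m)) (const-neg t))
  main : θ G ≈ M ⊛ G ⊹ (neg M ⊛ F ⊹ const (- + 2) ⊛ T ⊛ (w ⊛ (s ⊛ Q)))
  main = begin
    θ G
      ≈⟨ θ-⊛ (u ⊛ X ⊛ (v ⊛ Y)) (s ⊛ Z) ⟩
    θ (u ⊛ X ⊛ (v ⊛ Y)) ⊛ (s ⊛ Z) ⊹ u ⊛ X ⊛ (v ⊛ Y) ⊛ θ (s ⊛ Z)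
      ≈⟨ ⊹-cong (⊛-cong (≈-trans (θ-⊛ (u ⊛ X) (v ⊛ Y))
           (⊹-cong (⊛-cong hX ≈-refl) (⊛-cong ≈-refl (≈-trans hY (⊛-cong const-4m-t ≈-refl))))) ≈-refl)
           (⊛-cong ≈-refl (≈-trans hZ (⊛-cong (const-neg (+ suc m)) ≈-refl))) ⟩
    (T ⊛ (neg w ⊛ X) ⊛ (v ⊛ Y) ⊹ u ⊛ X ⊛ ((const (+ 4) ⊛ M ⊹ neg T) ⊛ (w ⊛ Y))) ⊛ (s ⊛ Z)
      ⊹ u ⊛ X ⊛ (v ⊛ Y) ⊛ (neg M ⊛ (const (+ 2) ⊛ (w ⊛ w) ⊛ Z))
      ≈⟨ solve 6 (λ X Y Z M T W →
           let U = con 1ℤ :+ :- W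
               V = con 1ℤ :+ W
               S = con 1ℤ :+ W :* W
               Q = X :* Y :* Z
           in (T :* (:- W :* X) :* (V :* Y) :+ U :* X :* ((con (+ 4) :* M :+ :- T) :* (W :* Y))) :* (S :* Z)
                :+ U :* X :* (V :* Y) :* (:- M :* (con (+ 2) :* (W :* W) :* Z))
              := M :* (U :* X :* (V :* Y) :* (S :* Z))
                 :+ (:- M :* (U :* (U :* (U :* (U :* Q)))) :+ con (- + 2) :* T :* (W :* (S :* Q))))
         ≈-refl X Y Z M T w ⟩
    M ⊛ G ⊹ (neg M ⊛ F ⊹ const (- + 2) ⊛ T ⊛ (w ⊛ (s ⊛ Q))) ∎
  split : + suc m * G (suc m) + ((neg M ⊛ F) (suc m) + (const (- + 2) ⊛ T ⊛ (w ⊛ (s ⊛ Q))) (suc m))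
        ≡ + suc m * G (suc m) + (- + suc m * F (suc m) + - + 2 * t * (s ⊛ Q) m)
  split = +-right (+ suc m * G (suc m)) (cong₂ _+_
    (≡.trans (coeff (⊛-congʳ {F} (≈-sym (const-neg (+ suc m)))) (suc m)) (const-⊛ (- + suc m) F (suc m)))
    (≡.trans (coeff (⊛-congʳ {w ⊛ (s ⊛ Q)} (≈-sym (const-⊛-const (- + 2) t))) (suc m))
      (≡.trans (const-⊛ (- + 2 * t) (w ⊛ (s ⊛ Q)) (suc m)) (cong (- + 2 * t *_) (w-⊛-suc (s ⊛ Q) m)))))
  cancel : ∀ k g f c q → k * g ≡ k * g + (- k * f + c * q) → k * f ≡ c * q
  cancel k g f c q eq = ≡.trans (lem k g f) (≡.trans (cong (λ z → z - k * g + k * f) eq) (lem₂ k g f c q))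
    where
    lem : ∀ k g f → k * f ≡ k * g - k * g + k * f
    lem = solve-∀
    lem₂ : ∀ k g f c q → k * g + (- k * f + c * q) - k * g + k * f ≡ c * q
    lem₂ = solve-∀

-- Coefficients of uᵃ vᵇ / (1 − w⁴)ᵐ⁺¹

-- The product of -2(t - 4j) over j < m, which iterating `exactness` down to m = 0 produces.
Ψ : ℕ → ℤ → ℤ
Ψ zero    t = 1ℤ
Ψ (suc m) t = - + 2 * t * Ψ m (t - + 4)

^-coeff₀ : ∀ {x} → x 0 ≡ 1ℤ → ∀ a → (x ^ a) 0 ≡ 1ℤ
^-coeff₀ p zero    = refl
^-coeff₀ p (suc a) = cong₂ _*_ p (^-coeff₀ p a)

^-cancel : ∀ {x x̄} → x ⊛ x̄ ≈ 𝟙 → ∀ a c → x ⊛ (x ^ a ⊛ x̄ ^ suc c) ≈ x ^ a ⊛ x̄ ^ c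
^-cancel {x} {x̄} inv a c = begin
  x ⊛ (x ^ a ⊛ (x̄ ⊛ x̄ ^ c))
    ≈⟨ solve 4 (λ X X̄ P Q → X :* (P :* (X̄ :* Q)) := X :* X̄ :* (P :* Q)) ≈-refl x x̄ (x ^ a) (x̄ ^ c) ⟩
  x ⊛ x̄ ⊛ (x ^ a ⊛ x̄ ^ c)  ≈⟨ ⊛-cong inv ≈-refl ⟩
  𝟙 ⊛ (x ^ a ⊛ x̄ ^ c)      ≈⟨ solve 1 (λ P → con 1ℤ :* P := P) ≈-refl (x ^ a ⊛ x̄ ^ c) ⟩
  x ^ a ⊛ x̄ ^ c ∎
  where open ≈-Reasoning

-- The hypotheses fix the exponents of u and v as t + 3 and 4m - 1 - t. Passing from m + 1 to m
-- while lowering t by 4 keeps the exponent of v and takes four factors off u, exactly as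
-- `exactness` demands.
coeff-uvs : ∀ a b b′ m c t → t ≡ + a - + c - + 3 → + b - + b′ ≡ + 4 * + m - 1ℤ - t →
  + (m !) * (u ^ a ⊛ ū ^ c ⊛ (v ^ b ⊛ v̄ ^ b′) ⊛ (s ^ 0 ⊛ s̄ ^ suc m)) m ≡ Ψ m t
coeff-uvs a b b′ zero c t _ _
  rewrite ^-coeff₀ {u} refl a | ^-coeff₀ {ū} refl c | ^-coeff₀ {v} refl b | ^-coeff₀ {v̄} refl b′ = refl
coeff-uvs a b b′ (suc m) c t teq beq = begin
  + (suc m !) * F (suc m)
    ≡⟨ cong (_* F (suc m)) (ℤ.pos-* (suc m) (m !)) ⟩
  + suc m * + (m !) * F (suc m)
    ≡⟨ lem (+ suc m) (+ (m !)) (F (suc m)) ⟩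
  + (m !) * (+ suc m * F (suc m))
    ≡⟨ cong (λ z → + (m !) * (+ suc m * z)) (coeff F≈ (suc m)) ⟩
  + (m !) * (+ suc m * (u ⊛ (u ⊛ (u ⊛ (u ⊛ (X ⊛ Y ⊛ Z))))) (suc m))
    ≡⟨ cong (+ (m !) *_) (exactness t m X Y Z hX hY hZ) ⟩
  + (m !) * (- + 2 * t * (s ⊛ (X ⊛ Y ⊛ Z)) m)
    ≡⟨ cong (λ z → + (m !) * (- + 2 * t * z)) (coeff Q≈ m) ⟩
  + (m !) * (- + 2 * t * (X ⊛ Y ⊛ Z′) m)
    ≡⟨ lem₂ (+ (m !)) (- + 2 * t) ((X ⊛ Y ⊛ Z′) m) ⟩
  - + 2 * t * (+ (m !) * (X ⊛ Y ⊛ Z′) m)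
    ≡⟨ cong (- + 2 * t *_) (coeff-uvs a b b′ m (4 ℕ.+ c) (t - + 4) teq′ beq′) ⟩
  - + 2 * t * Ψ m (t - + 4) ∎
  where
  open ≡-Reasoning
  X = u ^ a ⊛ ū ^ (4 ℕ.+ c)
  Y = v ^ b ⊛ v̄ ^ b′
  Z = s ^ 0 ⊛ s̄ ^ suc (suc m)
  Z′ = s ^ 0 ⊛ s̄ ^ suc m
  F = u ^ a ⊛ ū ^ c ⊛ Y ⊛ Z
  lem : ∀ x y z → x * y * z ≡ y * (x * z)
  lem = solve-∀
  lem₂ : ∀ x y z → x * (y * z) ≡ y * (x * z)
  lem₂ = solve-∀
  cancel-u : ∀ c → u ⊛ (u ^ a ⊛ ū ^ suc c) ≈ u ^ a ⊛ ū ^ c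
  cancel-u = ^-cancel u-inverse a
  F≈ : F ≈ u ⊛ (u ⊛ (u ⊛ (u ⊛ (X ⊛ Y ⊛ Z))))
  F≈ = ≈-sym (≈-trans (solve 4 (λ U X Y Z → U :* (U :* (U :* (U :* (X :* Y :* Z)))) := U :* (U :* (U :* (U :* X))) :* Y :* Z) ≈-refl u X Y Z)
    (⊛-cong (⊛-cong (≈-trans (⊛-congˡ {u} (≈-trans (⊛-congˡ {u} (≈-trans (⊛-congˡ {u} (cancel-u (3 ℕ.+ c)))
      (cancel-u (2 ℕ.+ c)))) (cancel-u (1 ℕ.+ c)))) (cancel-u c)) ≈-refl) ≈-refl))
  Q≈ : s ⊛ (X ⊛ Y ⊛ Z) ≈ X ⊛ Y ⊛ Z′
  Q≈ = ≈-trans (solve 4 (λ S X Y Z → S :* (X :* Y :* Z) := X :* Y :* (S :* Z)) ≈-refl s X Y Z)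
    (⊛-congˡ {X ⊛ Y} (^-cancel s-inverse 0 (suc m)))
  hX : θ (u ⊛ X) ≈ const t ⊛ (neg w ⊛ X)
  hX = ≈-trans (θ-cong (cancel-u (3 ℕ.+ c))) (subst (λ z → θ (u ^ a ⊛ ū ^ (3 ℕ.+ c)) ≈ const z ⊛ (neg w ⊛ X))
    (≡.trans (≡.trans (cong (λ z → + a - z) (ℤ.pos-+ 3 c)) (arith (+ a) (+ c))) (≡.sym teq)) (θ-power u-inverse θ-u a (3 ℕ.+ c)))
    where
    arith : ∀ x y → x - (+ 3 + y) ≡ x - y - + 3
    arith = solve-∀
  hY : θ (v ⊛ Y) ≈ const (+ 4 * + suc m - t) ⊛ (w ⊛ Y)
  hY = ≈-trans (θ-cong (solve 3 (λ V P Q → V :* (P :* Q) := V :* P :* Q) ≈-refl v (v ^ b) (v̄ ^ b′)))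
    (≈-trans (θ-power v-inverse θ-v (suc b) b′)
      (subst (λ z → const (+ suc b - + b′) ⊛ (w ⊛ (v ^ suc b ⊛ v̄ ^ suc b′)) ≈ const z ⊛ (w ⊛ Y))
        (≡.trans (arith₁ (+ b) (+ b′)) (≡.trans (+-right 1ℤ beq) (arith₂ (+ 4 * + suc m) t)))
        (⊛-congˡ {const (+ suc b - + b′)} (⊛-congˡ {w} (≈-trans (solve 3 (λ V P Q → V :* P :* Q := V :* (P :* Q)) ≈-refl v (v ^ b) (v̄ ^ suc b′))
          (^-cancel v-inverse b b′))))))
    where
    arith₁ : ∀ x y → (1ℤ + x) - y ≡ 1ℤ + (x - y)
    arith₁ = solve-∀
    arith₂ : ∀ x y → 1ℤ + (x - 1ℤ - y) ≡ x - y
    arith₂ = solve-∀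
  hZ : θ (s ⊛ Z) ≈ const (- + suc m) ⊛ (const (+ 2) ⊛ (w ⊛ w) ⊛ Z)
  hZ = ≈-trans (θ-cong (^-cancel s-inverse 0 (suc m))) (θ-power s-inverse θ-s 0 (suc m))
  teq′ : t - + 4 ≡ + a - + (4 ℕ.+ c) - + 3
  teq′ = ≡.trans (cong (_- + 4) teq) (≡.trans (arith (+ a) (+ c)) (cong (λ z → + a - z - + 3) (≡.sym (ℤ.pos-+ 4 c))))
    where
    arith : ∀ x y → x - y - + 3 - + 4 ≡ x - (+ 4 + y) - + 3
    arith = solve-∀
  beq′ : + b - + b′ ≡ + 4 * + m - 1ℤ - (t - + 4)
  beq′ = ≡.trans beq (arith (+ m) t)
    where
    arith : ∀ x y → + 4 * (1ℤ + x) - 1ℤ - y ≡ + 4 * x - 1ℤ - (y - + 4)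
    arith = solve-∀

U 1-w⁴ : Series
U = ū ⊛ (v̄ ⊛ s̄)
1-w⁴ = u ⊛ (v ⊛ s)

U^-split : ∀ k → U ^ k ≈ ū ^ k ⊛ (v̄ ^ k ⊛ s̄ ^ k)
U^-split k = ≈-trans (^-distrib-* ū (v̄ ⊛ s̄) k) (⊛-congˡ {ū ^ k} (^-distrib-* v̄ s̄ k))

-- The degree 6m + 4 is two less than that of the sextic form xy(x⁴ - y⁴) to the power m + 1, so the
-- coefficient is the residue at 0 of a differential on the projective line.
coeff-uvU : ∀ m a b → a ℕ.+ b ≡ 6 ℕ.* m ℕ.+ 4 →
  + (m !) * (u ^ a ⊛ v ^ b ⊛ U ^ suc m) m ≡ Ψ m (+ a - + m - + 4)
coeff-uvU m a b eq = ≡.trans (cong (+ (m !) *_) (coeff split m))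
  (coeff-uvs a b (suc m) m (suc m) (+ a - + m - + 4) (arith₁ (+ a) (+ m)) beq)
  where
  split : u ^ a ⊛ v ^ b ⊛ U ^ suc m ≈ u ^ a ⊛ ū ^ suc m ⊛ (v ^ b ⊛ v̄ ^ suc m) ⊛ (s ^ 0 ⊛ s̄ ^ suc m)
  split = ≈-trans (⊛-congˡ {u ^ a ⊛ v ^ b} (U^-split (suc m)))
    (solve 5 (λ A B C D E → A :* B :* (C :* (D :* E)) := A :* C :* (B :* D) :* (con 1ℤ :* E)) ≈-refl
      (u ^ a) (v ^ b) (ū ^ suc m) (v̄ ^ suc m) (s̄ ^ suc m))
  arith₁ : ∀ x y → x - y - + 4 ≡ x - (1ℤ + y) - + 3
  arith₁ = solve-∀
  eqℤ : + a + + b ≡ + 6 * + m + + 4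
  eqℤ = ≡.trans (≡.sym (ℤ.pos-+ a b)) (≡.trans (cong +_ eq) (≡.trans (ℤ.pos-+ (6 ℕ.* m) 4) (+-left (+ 4) (ℤ.pos-* 6 m))))
  arith₂ : ∀ x y z → y - (1ℤ + z) ≡ (x + y) - x - 1ℤ - z
  arith₂ = solve-∀
  arith₃ : ∀ x z → (+ 6 * z + + 4) - x - 1ℤ - z ≡ + 4 * z - 1ℤ - (x - z - + 4)
  arith₃ = solve-∀
  beq : + b - + suc m ≡ + 4 * + m - 1ℤ - (+ a - + m - + 4)
  beq = ≡.trans (arith₂ (+ a) (+ b) (+ m)) (≡.trans (cong (λ z → z - + a - 1ℤ - + m) eqℤ) (arith₃ (+ a) (+ m)))

-- Rising factorials

rising : ℕ → ℤ → ℤ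
rising zero    x = 1ℤ
rising (suc m) x = x * rising m (x + 1ℤ)

Ψ-rising : ∀ m x → Ψ m (- + 4 * x) ≡ + (8 ℕ.^ m) * rising m x
Ψ-rising zero    x = refl
Ψ-rising (suc m) x = begin
  - + 2 * (- + 4 * x) * Ψ m (- + 4 * x - + 4)        ≡⟨ cong (λ z → - + 2 * (- + 4 * x) * Ψ m z) (arith x) ⟩
  - + 2 * (- + 4 * x) * Ψ m (- + 4 * (x + 1ℤ))       ≡⟨ cong (- + 2 * (- + 4 * x) *_) (Ψ-rising m (x + 1ℤ)) ⟩
  - + 2 * (- + 4 * x) * (+ (8 ℕ.^ m) * rising m (x + 1ℤ)) ≡⟨ arith₂ x (+ (8 ℕ.^ m)) _ ⟩
  + 8 * + (8 ℕ.^ m) * (x * rising m (x + 1ℤ))        ≡⟨ cong (_* (x * rising m (x + 1ℤ))) (ℤ.pos-* 8 (8 ℕ.^ m)) ⟨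
  + (8 ℕ.^ suc m) * (x * rising m (x + 1ℤ)) ∎
  where
  open ≡-Reasoning
  arith : ∀ x → - + 4 * x - + 4 ≡ - + 4 * (x + 1ℤ)
  arith = solve-∀
  arith₂ : ∀ x e r → - + 2 * (- + 4 * x) * (e * r) ≡ + 8 * e * (x * r)
  arith₂ = solve-∀

rising-last : ∀ m x → rising (suc m) x ≡ rising m x * (x + + m)
rising-last zero    x = arith x
  where
  arith : ∀ x → x * 1ℤ ≡ 1ℤ * (x + 0ℤ)
  arith = solve-∀
rising-last (suc m) x = begin
  x * rising (suc m) (x + 1ℤ)                ≡⟨ cong (x *_) (rising-last m (x + 1ℤ)) ⟩
  x * (rising m (x + 1ℤ) * (x + 1ℤ + + m))   ≡⟨ arith x (rising m (x + 1ℤ)) (+ m) ⟩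
  x * rising m (x + 1ℤ) * (x + (1ℤ + + m)) ∎
  where
  open ≡-Reasoning
  arith : ∀ x r m → x * (r * (x + 1ℤ + m)) ≡ x * r * (x + (1ℤ + m))
  arith = solve-∀

rising-1 : ∀ m → rising m 1ℤ ≡ + (m !)
rising-1 zero    = refl
rising-1 (suc m) = ≡.trans (rising-last m 1ℤ) (≡.trans (cong (_* + suc m) (rising-1 m))
  (≡.trans (ℤ.*-comm (+ (m !)) (+ suc m)) (≡.sym (ℤ.pos-* (suc m) (m !)))))

rising-vanish : ∀ m y → y ℕ.< m → rising m (- + y) ≡ 0ℤ
rising-vanish (suc m) zero    _         = ℤ.*-zeroˡ (rising m 1ℤ)
rising-vanish (suc m) (suc y) (s≤s y<m) = ≡.trans (cong (λ z → - + suc y * rising m z) (arith (+ y)))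
  (≡.trans (cong (- + suc y *_) (rising-vanish m y y<m)) (ℤ.*-zeroʳ (- + suc y)))
  where
  arith : ∀ y → - (1ℤ + y) + 1ℤ ≡ - y
  arith = solve-∀

rising-reflect : ∀ m x → rising m (1ℤ - + m - x) ≡ v̄ m * rising m x
rising-reflect zero    x = refl
rising-reflect (suc m) x = begin
  (1ℤ - + suc m - x) * rising m (1ℤ - + suc m - x + 1ℤ)
    ≡⟨ cong (λ z → (1ℤ - + suc m - x) * rising m z) (arith (+ m) x) ⟩
  (1ℤ - + suc m - x) * rising m (1ℤ - + m - x)
    ≡⟨ cong ((1ℤ - + suc m - x) *_) (rising-reflect m x) ⟩
  (1ℤ - + suc m - x) * (v̄ m * rising m x)
    ≡⟨ arith₂ (+ m) x (v̄ m) (rising m x) ⟩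
  - v̄ m * (rising m x * (x + + m))
    ≡⟨ cong (- v̄ m *_) (rising-last m x) ⟨
  - v̄ m * rising (suc m) x ∎
  where
  open ≡-Reasoning
  arith : ∀ m x → 1ℤ - (1ℤ + m) - x + 1ℤ ≡ 1ℤ - m - x
  arith = solve-∀
  arith₂ : ∀ m x e r → (1ℤ - (1ℤ + m) - x) * (e * r) ≡ - e * (r * (x + m))
  arith₂ = solve-∀

v̄-4* : ∀ l → v̄ (l ℕ.* 4) ≡ 1ℤ
v̄-4* zero    = refl
v̄-4* (suc l) rewrite v̄-4* l = refl

-- Powers of 1/(1 - w⁴)

1-w⁴-inverse : 1-w⁴ ⊛ U ≈ 𝟙
1-w⁴-inverse = ≈-trans (solve 6 (λ a b c d e f → (a :* (b :* c)) :* (d :* (e :* f)) := (a :* d) :* ((b :* e) :* (c :* f))) ≈-refl u v s ū v̄ s̄)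
  (≈-trans (⊛-cong u-inverse (⊛-cong v-inverse s-inverse)) (solve 1 (λ Z → con 1ℤ :* (con 1ℤ :* con 1ℤ) := con 1ℤ) ≈-refl 𝟘))

w⁴ : Series → Series
w⁴ a = w ⊛ (w ⊛ (w ⊛ (w ⊛ a)))

1-w⁴≈ : 1-w⁴ ≈ 𝟙 ⊹ neg (w⁴ 𝟙)
1-w⁴≈ = solve 1 (λ W → (con 1ℤ :+ :- W) :* ((con 1ℤ :+ W) :* (con 1ℤ :+ W :* W)) := con 1ℤ :+ :- (W :* (W :* (W :* (W :* con 1ℤ))))) ≈-refl w

θ-1-w⁴ : θ 1-w⁴ ≈ const (- + 4) ⊛ w⁴ 𝟙
θ-1-w⁴ = ≈-trans (θ-cong 1-w⁴≈) (≈-trans (θ-⊹ 𝟙 (neg (w⁴ 𝟙))) (≈-trans (⊹-cong (θ-const 1ℤ) (θ-neg (w⁴ 𝟙)))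
  (≈-trans (pointwise λ n → cong (λ z → 𝟘 n + - z) (coeff θ-w⁴ n))
    (solve 1 (λ W → con 0ℤ :+ :- (con (+ 4) :* W) := con (- + 4) :* W) ≈-refl (w⁴ 𝟙)))))
  where
  step : ∀ c a → θ a ≈ const c ⊛ a → θ (w ⊛ a) ≈ const (1ℤ + c) ⊛ (w ⊛ a)
  step c a h = ≈-trans (θ-⊛ w a) (≈-trans (⊹-cong (⊛-cong θ-w ≈-refl) (⊛-congˡ {w} h))
    (≈-trans (solve 3 (λ W A C → W :* A :+ W :* (C :* A) := (con 1ℤ :+ C) :* (W :* A)) ≈-refl w a (const c))
      (⊛-congʳ {w ⊛ a} (≈-sym (const-+ 1ℤ c)))))
  θ-w⁴ : θ (w⁴ 𝟙) ≈ const (+ 4) ⊛ w⁴ 𝟙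
  θ-w⁴ = step (+ 3) _ (step (+ 2) _ (step (+ 1) _ (step (+ 0) 𝟙 (≈-trans (θ-const 1ℤ) (solve 1 (λ Z → con 0ℤ := con 0ℤ :* con 1ℤ) ≈-refl 𝟘)))))

-- For P = (1 - w⁴)⁻ᵏ this is (1 - w⁴) θP = 4k w⁴ P, arranged so that the right side starts four
-- places later. Comparing coefficients gives both the recursion and the vanishing off the multiples
-- of 4.
U^-ode : ∀ k → θ (U ^ k) ≈ w⁴ (θ (U ^ k) ⊹ const (+ 4 * + k) ⊛ U ^ k)
U^-ode k = begin
  θ P
    ≈⟨ solve 2 (λ W X → X := W :* (W :* (W :* (W :* X))) :+ (con 1ℤ :+ :- (W :* (W :* (W :* (W :* con 1ℤ))))) :* X) ≈-refl w (θ P) ⟩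
  w⁴ (θ P) ⊹ (𝟙 ⊹ neg (w⁴ 𝟙)) ⊛ θ P
    ≈⟨ ⊹-cong (≈-refl {w⁴ (θ P)}) (⊛-cong (≈-sym 1-w⁴≈) θP) ⟩
  w⁴ (θ P) ⊹ 1-w⁴ ⊛ (const (0ℤ - + k) ⊛ (const (- + 4) ⊛ w⁴ 𝟙 ⊛ (1-w⁴ ^ 0 ⊛ U ^ suc k)))
    ≈⟨ ⊹-cong (≈-refl {w⁴ (θ P)}) (⊛-congˡ {1-w⁴} (⊛-congʳ {const (- + 4) ⊛ w⁴ 𝟙 ⊛ (1-w⁴ ^ 0 ⊛ U ^ suc k)} (≈-trans (const-+ 0ℤ (- + k)) (⊹-cong (≈-refl {𝟘}) (const-neg (+ k)))))) ⟩
  w⁴ (θ P) ⊹ 1-w⁴ ⊛ ((𝟘 ⊹ neg K) ⊛ (const (- + 4) ⊛ w⁴ 𝟙 ⊛ (1-w⁴ ^ 0 ⊛ U ^ suc k)))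
    ≈⟨ solve 5 (λ W X D K Q → W :* (W :* (W :* (W :* X))) :+ D :* ((con 0ℤ :+ :- K) :* (con (- + 4) :* (W :* (W :* (W :* (W :* con 1ℤ)))) :* Q))
         := W :* (W :* (W :* (W :* (X :+ con (+ 4) :* K :* (D :* Q)))))) ≈-refl w (θ P) 1-w⁴ K (1-w⁴ ^ 0 ⊛ U ^ suc k) ⟩
  w⁴ (θ P ⊹ const (+ 4) ⊛ K ⊛ (1-w⁴ ⊛ (1-w⁴ ^ 0 ⊛ U ^ suc k)))
    ≈⟨ w⁴-cong (⊹-cong (≈-refl {θ P}) (⊛-cong (≈-sym (const-⊛-const (+ 4) (+ k)))
         (≈-trans (^-cancel 1-w⁴-inverse 0 k) (solve 1 (λ X → con 1ℤ :* X := X) ≈-refl P)))) ⟩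
  w⁴ (θ P ⊹ const (+ 4 * + k) ⊛ P) ∎
  where
  open ≈-Reasoning
  P = U ^ k
  K = const (+ k)
  θP : θ P ≈ const (0ℤ - + k) ⊛ (const (- + 4) ⊛ w⁴ 𝟙 ⊛ (1-w⁴ ^ 0 ⊛ U ^ suc k))
  θP = ≈-trans (θ-cong (solve 1 (λ X → X := con 1ℤ :* X) ≈-refl P)) (θ-power 1-w⁴-inverse θ-1-w⁴ 0 k)
  w⁴-cong : ∀ {a b} → a ≈ b → w⁴ a ≈ w⁴ b
  w⁴-cong p = ⊛-congˡ {w} (⊛-congˡ {w} (⊛-congˡ {w} (⊛-congˡ {w} p)))

w^-shift : ∀ i a n → (w ^ i ⊛ a) (i ℕ.+ n) ≡ a n
w^-shift zero    a n = ≡.trans (const-⊛ 1ℤ a n) (ℤ.*-identityˡ (a n))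
w^-shift (suc i) a n = ≡.trans (⊛-assoc w (w ^ i) a (suc i ℕ.+ n))
  (≡.trans (w-⊛-suc (w ^ i ⊛ a) (i ℕ.+ n)) (w^-shift i a n))

w^-low : ∀ i a n → n ℕ.< i → (w ^ i ⊛ a) n ≡ 0ℤ
w^-low (suc i) a zero    _         = ≡.trans (⊛-assoc w (w ^ i) a 0) (w-⊛-zero (w ^ i ⊛ a))
w^-low (suc i) a (suc n) (s≤s n<i) = ≡.trans (⊛-assoc w (w ^ i) a (suc n))
  (≡.trans (w-⊛-suc (w ^ i ⊛ a) n) (w^-low i a n n<i))

∃-diff : ∀ {i n} → i ℕ.≤ n → ∃ λ k → n ≡ i ℕ.+ k
∃-diff {i} {n} i≤n = n ℕ.∸ i , ≡.sym (ℕ.m+[n∸m]≡n i≤n)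

module PowerCoefficients (k : ℕ) where

  private
    c : Series
    c = U ^ k

    X X₁ X₂ X₃ : Series
    X  = θ c ⊹ const (+ 4 * + k) ⊛ c
    X₁ = w ⊛ X
    X₂ = w ⊛ X₁
    X₃ = w ⊛ X₂

  recursion : ∀ n → + (4 ℕ.+ n) * c (4 ℕ.+ n) ≡ (+ n + + 4 * + k) * c n
  recursion n = begin
    + (4 ℕ.+ n) * c (4 ℕ.+ n)            ≡⟨ coeff (U^-ode k) (4 ℕ.+ n) ⟩
    w⁴ X (4 ℕ.+ n)                       ≡⟨ w-⊛-suc X₃ (3 ℕ.+ n) ⟩
    (w ⊛ (w ⊛ (w ⊛ X))) (3 ℕ.+ n)        ≡⟨ w-⊛-suc X₂ (2 ℕ.+ n) ⟩
    (w ⊛ (w ⊛ X)) (2 ℕ.+ n)              ≡⟨ w-⊛-suc X₁ (1 ℕ.+ n) ⟩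
    (w ⊛ X) (1 ℕ.+ n)                    ≡⟨ w-⊛-suc X n ⟩
    + n * c n + (const (+ 4 * + k) ⊛ c) n ≡⟨ +-right (+ n * c n) (const-⊛ (+ 4 * + k) c n) ⟩
    + n * c n + + 4 * + k * c n          ≡⟨ ℤ.*-distribʳ-+ (c n) (+ n) (+ 4 * + k) ⟨
    (+ n + + 4 * + k) * c n ∎
    where open ≡-Reasoning

  private
    initial : ∀ n → + suc n * c (suc n) ≡ 0ℤ → c (suc n) ≡ 0ℤ
    initial n eq = ℤ.*-cancelˡ-≡ (+ suc n) (c (suc n)) 0ℤ (≡.trans eq (≡.sym (ℤ.*-zeroʳ (+ suc n))))

  vanish : ∀ j r → r ℕ.< 3 → c (j ℕ.* 4 ℕ.+ suc r) ≡ 0ℤ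
  vanish zero zero _ = initial 0 (≡.trans (coeff (U^-ode k) 1)
    (≡.trans (w-⊛-suc X₃ 0) (w-⊛-zero X₂)))
  vanish zero (suc zero) _ = initial 1 (≡.trans (coeff (U^-ode k) 2)
    (≡.trans (w-⊛-suc X₃ 1) (≡.trans (w-⊛-suc X₂ 0) (w-⊛-zero X₁))))
  vanish zero (suc (suc zero)) _ = initial 2 (≡.trans (coeff (U^-ode k) 3)
    (≡.trans (w-⊛-suc X₃ 2) (≡.trans (w-⊛-suc X₂ 1) (≡.trans (w-⊛-suc X₁ 0) (w-⊛-zero X)))))
  vanish zero (suc (suc (suc r))) (s≤s (s≤s (s≤s ())))
  vanish (suc j) r r<3 = initial (3 ℕ.+ (j ℕ.* 4 ℕ.+ suc r)) (≡.trans (recursion (j ℕ.* 4 ℕ.+ suc r))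
    (≡.trans (cong (λ z → (+ (j ℕ.* 4 ℕ.+ suc r) + + 4 * + k) * z) (vanish j r r<3)) (ℤ.*-zeroʳ (+ (j ℕ.* 4 ℕ.+ suc r) + + 4 * + k))))

  -- For k ≥ 1 the binomial coefficient of M + k - 1 over M, used only through `g-zero`, `g-suc` and
  -- their consequences.
  g : ℕ → ℤ
  g M = c (M ℕ.* 4)

  g-zero : g 0 ≡ 1ℤ
  g-zero = ^-coeff₀ {U} refl k

  g-suc : ∀ M → + suc M * g (suc M) ≡ (+ M + + k) * g M
  g-suc M = ℤ.*-cancelˡ-≡ (+ 4) _ _ (begin
    + 4 * (+ suc M * g (suc M))           ≡⟨ ℤ.*-assoc (+ 4) (+ suc M) (g (suc M)) ⟨
    + 4 * + suc M * g (suc M)             ≡⟨ cong (_* g (suc M)) (≡.trans (ℤ.*-comm (+ 4) (+ suc M)) (≡.sym (ℤ.pos-* (suc M) 4))) ⟩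
    + (suc M ℕ.* 4) * g (suc M)           ≡⟨ recursion (M ℕ.* 4) ⟩
    (+ (M ℕ.* 4) + + 4 * + k) * g M       ≡⟨ cong (λ z → (z + + 4 * + k) * g M) (ℤ.pos-* M 4) ⟩
    (+ M * + 4 + + 4 * + k) * g M         ≡⟨ arith (+ M) (+ k) (g M) ⟩
    + 4 * ((+ M + + k) * g M) ∎)
    where
    open ≡-Reasoning
    arith : ∀ x y z → (x * + 4 + + 4 * y) * z ≡ + 4 * ((x + y) * z)
    arith = solve-∀

g-positive : ∀ k M → 0ℤ ℤ.< PowerCoefficients.g (suc k) M
g-positive k zero    rewrite PowerCoefficients.g-zero (suc k) = +<+ (s≤s z≤n)
g-positive k (suc M) = ℤ.*-cancelˡ-<-nonNeg (+ suc M) (subst (ℤ._< + suc M * g (suc M)) (≡.sym (ℤ.*-zeroʳ (+ suc M)))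
  (subst (0ℤ ℤ.<_) (≡.sym (g-suc M)) (subst (ℤ._< (+ M + + suc k) * g M) (ℤ.*-zeroʳ (+ M + + suc k))
    (subst (λ z → z * 0ℤ ℤ.< z * g M) (≡.trans (cong +_ (≡.sym (ℕ.+-suc M k))) (ℤ.pos-+ M (suc k))) (ℤ.*-monoˡ-<-pos (+ suc (M ℕ.+ k)) (g-positive k M))))))
  where open PowerCoefficients (suc k)

-- Residues at 0 and the residue theorem

module Gamma (l : ℕ) where

  m : ℕ
  m = l ℕ.* 4

  open PowerCoefficients (suc m) using (g; g-zero; g-suc; vanish)

  wU : ℕ → ℤ
  wU i = (w ^ i ⊛ U ^ suc m) m

  -- The residue at 0 of w⁴ⁱ dw / (w(1 - w⁴))ᵐ⁺¹: the binomial coefficient of 5l - i over 4l for i ≤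
  -- l, and 0 beyond.
  γ : ℕ → ℤ
  γ i = wU (i ℕ.* 4)

  wU-vanish : ∀ q r → r ℕ.< 3 → wU (q ℕ.* 4 ℕ.+ suc r) ≡ 0ℤ
  wU-vanish q r r<3 with q ℕ.<? l
  ... | no q≮l = w^-low (q ℕ.* 4 ℕ.+ suc r) (U ^ suc m) m
    (ℕ.≤-<-trans (ℕ.*-monoˡ-≤ 4 (ℕ.≮⇒≥ q≮l)) (subst (q ℕ.* 4 ℕ.<_) (≡.sym (ℕ.+-suc (q ℕ.* 4) r)) (s≤s (ℕ.m≤m+n (q ℕ.* 4) r))))
  ... | yes q<l with ∃-diff q<l
  ... | M , refl = ≡.trans (cong (w ^ (q ℕ.* 4 ℕ.+ suc r) ⊛ U ^ suc m) (split r r<3))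
    (≡.trans (w^-shift (q ℕ.* 4 ℕ.+ suc r) (U ^ suc m) (M ℕ.* 4 ℕ.+ suc (2 ℕ.∸ r))) (vanish M (2 ℕ.∸ r) (s≤s (ℕ.m∸n≤m 2 r))))
    where
    arith₀ : ∀ q M → (1 ℕ.+ q ℕ.+ M) ℕ.* 4 ≡ q ℕ.* 4 ℕ.+ 1 ℕ.+ (M ℕ.* 4 ℕ.+ 3)
    arith₀ = solve-ℕ
    arith₁ : ∀ q M → (1 ℕ.+ q ℕ.+ M) ℕ.* 4 ≡ q ℕ.* 4 ℕ.+ 2 ℕ.+ (M ℕ.* 4 ℕ.+ 2)
    arith₁ = solve-ℕ
    arith₂ : ∀ q M → (1 ℕ.+ q ℕ.+ M) ℕ.* 4 ≡ q ℕ.* 4 ℕ.+ 3 ℕ.+ (M ℕ.* 4 ℕ.+ 1)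
    arith₂ = solve-ℕ
    split : ∀ r → r ℕ.< 3 → (suc q ℕ.+ M) ℕ.* 4 ≡ q ℕ.* 4 ℕ.+ suc r ℕ.+ (M ℕ.* 4 ℕ.+ suc (2 ℕ.∸ r))
    split 0 _ = arith₀ q M
    split 1 _ = arith₁ q M
    split 2 _ = arith₂ q M
    split (suc (suc (suc r))) (s≤s (s≤s (s≤s ())))

  γ-high : ∀ i → l ℕ.< i → γ i ≡ 0ℤ
  γ-high i l<i = w^-low (i ℕ.* 4) (U ^ suc m) m (ℕ.*-monoˡ-< 4 l<i)

  γ-low : ∀ i M → l ≡ i ℕ.+ M → γ i ≡ g M
  γ-low i M eq = ≡.trans (cong (w ^ (i ℕ.* 4) ⊛ U ^ suc m) (≡.trans (cong (ℕ._* 4) eq) (ℕ.*-distribʳ-+ 4 i M)))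
    (w^-shift (i ℕ.* 4) (U ^ suc m) (M ℕ.* 4))

  γ-positive : ∀ i → i ℕ.≤ l → 0ℤ ℤ.< γ i
  γ-positive i i≤l with ∃-diff i≤l
  ... | M , eq = subst (0ℤ ℤ.<_) (≡.sym (γ-low i M eq)) (g-positive m M)

  γ-nonNeg : ∀ i → 0ℤ ℤ.≤ γ i
  γ-nonNeg i with i ℕ.≤? l
  ... | yes i≤l = ℤ.<⇒≤ (γ-positive i i≤l)
  ... | no i≰l  = ℤ.≤-reflexive (≡.sym (γ-high i (ℕ.≰⇒> i≰l)))

  γ-recursion : ∀ i M → l ≡ i ℕ.+ M → + M * γ i ≡ (+ M + + m) * γ (suc i)
  γ-recursion i zero eq = ≡.trans (ℤ.*-zeroˡ (γ i)) (≡.sym (≡.trans (cong ((0ℤ + + m) *_) (γ-high (suc i) (s≤s (ℕ.≤-reflexive (≡.trans eq (ℕ.+-identityʳ i)))))) (ℤ.*-zeroʳ (0ℤ + + m))))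
  γ-recursion i (suc M) eq = ≡.trans (cong (+ suc M *_) (γ-low i (suc M) eq)) (≡.trans (g-suc M)
    (cong₂ _*_ (arith (+ M) (+ m)) (≡.sym (γ-low (suc i) M (≡.trans eq (ℕ.+-suc i M))))))
    where
    arith : ∀ x y → x + (1ℤ + y) ≡ 1ℤ + x + y
    arith = solve-∀

  g-rising : ∀ M → + (m !) * g M ≡ rising m (+ suc M)
  g-rising zero    = ≡.trans (cong (+ (m !) *_) g-zero) (≡.trans (ℤ.*-identityʳ (+ (m !))) (≡.sym (rising-1 m)))
  g-rising (suc M) = ℤ.*-cancelˡ-≡ (+ suc M) _ _ (begin
    + suc M * (+ (m !) * g (suc M))          ≡⟨ arith (+ suc M) (+ (m !)) (g (suc M)) ⟩
    + (m !) * (+ suc M * g (suc M))          ≡⟨ cong (+ (m !) *_) (g-suc M) ⟩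
    + (m !) * ((+ M + + suc m) * g M)        ≡⟨ arith₂ (+ M) (+ m) (+ (m !)) (g M) ⟩
    + (m !) * g M * (+ suc M + + m)          ≡⟨ cong (_* (+ suc M + + m)) (g-rising M) ⟩
    rising m (+ suc M) * (+ suc M + + m)     ≡⟨ rising-last m (+ suc M) ⟨
    + suc M * rising m (+ suc M + 1ℤ)        ≡⟨ cong (λ z → + suc M * rising m z) (ℤ.+-comm (+ suc M) 1ℤ) ⟩
    + suc M * rising m (+ suc (suc M)) ∎)
    where
    open ≡-Reasoning
    arith : ∀ x y z → x * (y * z) ≡ y * (x * z)
    arith = solve-∀
    arith₂ : ∀ x m f g → f * ((x + (1ℤ + m)) * g) ≡ f * g * (1ℤ + x + m)
    arith₂ = solve-∀

  private
    rising-left : ∀ σ → σ ℕ.≤ l → rising m (+ suc l - + σ) ≡ + (m !) * γ σ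
    rising-left σ σ≤l with ∃-diff σ≤l
    ... | M , eq = ≡.trans (cong (rising m) (≡.trans (cong (λ z → 1ℤ + + z - + σ) eq) (≡.trans (cong (λ z → 1ℤ + z - + σ) (ℤ.pos-+ σ M)) (arith (+ σ) (+ M)))))
        (≡.trans (≡.sym (g-rising M)) (cong (+ (m !) *_) (≡.sym (γ-low σ M eq))))
      where
      arith : ∀ x y → 1ℤ + (x + y) - x ≡ 1ℤ + y
      arith = solve-∀

  -- The factors are the 4l consecutive integers from l + 1 - σ to 5l - σ. They are positive for σ ≤
  -- l, negative for τ ≤ l, where their even number removes the sign, and include 0 otherwise.
  rising-γ : ∀ σ τ → σ ℕ.+ τ ≡ 6 ℕ.* l ℕ.+ 1 → rising m (+ suc l - + σ) ≡ + (m !) * (γ σ + γ τ)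
  rising-γ σ τ eq with σ ℕ.≤? l | τ ℕ.≤? l
  ... | yes σ≤l | yes τ≤l = ⊥-elim (ℕ.<-irrefl refl (ℕ.≤-trans (s≤s (ℕ.+-mono-≤ σ≤l τ≤l))
        (ℕ.≤-trans (ℕ.≤-trans (ℕ.m≤m+n _ (4 ℕ.* l)) (ℕ.≤-reflexive (arith l))) (ℕ.≤-reflexive (≡.sym eq)))))
    where
    arith : ∀ l → suc (l ℕ.+ l) ℕ.+ 4 ℕ.* l ≡ 6 ℕ.* l ℕ.+ 1
    arith = solve-ℕ
  ... | yes σ≤l | no τ≰l = ≡.trans (rising-left σ σ≤l) (cong (+ (m !) *_)
        (≡.sym (≡.trans (+-right (γ σ) (γ-high τ (ℕ.≰⇒> τ≰l))) (ℤ.+-identityʳ (γ σ)))))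
  ... | no σ≰l | yes τ≤l = begin
        rising m (+ suc l - + σ)                ≡⟨ cong (rising m) reflect ⟩
        rising m (1ℤ - + m - (+ suc l - + τ))   ≡⟨ rising-reflect m (+ suc l - + τ) ⟩
        v̄ m * rising m (+ suc l - + τ)          ≡⟨ cong (_* rising m (+ suc l - + τ)) (v̄-4* l) ⟩
        1ℤ * rising m (+ suc l - + τ)           ≡⟨ ℤ.*-identityˡ _ ⟩
        rising m (+ suc l - + τ)                ≡⟨ rising-left τ τ≤l ⟩
        + (m !) * γ τ                           ≡⟨ cong (+ (m !) *_) (≡.sym (≡.trans (+-left (γ τ) (γ-high σ (ℕ.≰⇒> σ≰l))) (ℤ.+-identityˡ (γ τ)))) ⟩
        + (m !) * (γ σ + γ τ) ∎
    where
    open ≡-Reasoning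
    eqℤ : + σ + + τ ≡ + 6 * + l + 1ℤ
    eqℤ = ≡.trans (≡.sym (ℤ.pos-+ σ τ)) (≡.trans (cong +_ eq) (≡.trans (ℤ.pos-+ (6 ℕ.* l) 1) (+-left 1ℤ (ℤ.pos-* 6 l))))
    arith : ∀ l x y → 1ℤ + l - x ≡ 1ℤ + l + y - (x + y)
    arith = solve-∀
    arith₂ : ∀ l y → 1ℤ + l + y - (+ 6 * l + 1ℤ) ≡ 1ℤ - l * + 4 - (1ℤ + l - y)
    arith₂ = solve-∀
    reflect : + suc l - + σ ≡ 1ℤ - + m - (+ suc l - + τ)
    reflect = ≡.trans (arith (+ l) (+ σ) (+ τ)) (≡.trans (cong (λ z → 1ℤ + + l + + τ - z) eqℤ)
      (≡.trans (arith₂ (+ l) (+ τ)) (cong (λ z → 1ℤ - z - (+ suc l - + τ)) (≡.sym (ℤ.pos-* l 4)))))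
  ... | no σ≰l | no τ≰l with ∃-diff (ℕ.≰⇒> σ≰l) | ∃-diff (ℕ.≰⇒> τ≰l)
  ... | y , refl | z , refl = ≡.trans (cong (rising m) (≡.trans (cong (λ z → + suc l - z) (ℤ.pos-+ (suc l) y)) (arith (+ suc l) (+ y))))
        (≡.trans (rising-vanish m y y<m) (≡.sym (≡.trans (cong (+ (m !) *_) (cong₂ _+_ (γ-high (suc l ℕ.+ y) (ℕ.≰⇒> σ≰l)) (γ-high (suc l ℕ.+ z) (ℕ.≰⇒> τ≰l)))) (ℤ.*-zeroʳ (+ (m !))))))
    where
    arith : ∀ x y → x - (x + y) ≡ - y
    arith = solve-∀
    arith₂ : ∀ l y z → suc l ℕ.+ y ℕ.+ (suc l ℕ.+ z) ≡ (2 ℕ.* l ℕ.+ 1) ℕ.+ suc (y ℕ.+ z)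
    arith₂ = solve-ℕ
    arith₃ : ∀ l → 6 ℕ.* l ℕ.+ 1 ≡ (2 ℕ.* l ℕ.+ 1) ℕ.+ l ℕ.* 4
    arith₃ = solve-ℕ
    y<m : y ℕ.< m
    y<m = ℕ.≤-trans (s≤s (ℕ.m≤m+n y z)) (ℕ.≤-reflexive (ℕ.+-cancelˡ-≡ (2 ℕ.* l ℕ.+ 1) _ _ (≡.trans (≡.sym (arith₂ l y z)) (≡.trans eq (arith₃ l)))))

  -- This is the residue theorem for wᵃ dw / (w(1 - w⁴))ᵐ⁺¹. The poles 0 and ∞ contribute `γ σ` and
  -- `γ τ`. The residues at the four fourth roots of unity coincide because 4 divides a, and the
  -- substitution (1 - w)/(1 + w) moves the one at 1 to 0, where it becomes the coefficient on the
  -- left, up to the factor 8ᵐ.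
  coeff-uvU-γ : ∀ σ τ a b → a ≡ σ ℕ.* 4 → b ≡ τ ℕ.* 4 → σ ℕ.+ τ ≡ 6 ℕ.* l ℕ.+ 1 →
    (u ^ a ⊛ v ^ b ⊛ U ^ suc m) m ≡ + (8 ℕ.^ m) * (γ σ + γ τ)
  coeff-uvU-γ σ τ a b refl refl eq = ℤ.*-cancelˡ-≡ (+ (m !)) _ _ {{ℤ.≢-nonZero λ p → ℕ.≢-nonZero⁻¹ (m !) {{m ℕ.!≢0}} (ℤ.+-injective p)}} (begin
    + (m !) * (u ^ a ⊛ v ^ b ⊛ U ^ suc m) m
      ≡⟨ coeff-uvU m a b sum-eq ⟩
    Ψ m (+ a - + m - + 4)
      ≡⟨ cong (Ψ m) (≡.trans (cong₂ (λ x y → x - y - + 4) (ℤ.pos-* σ 4) (ℤ.pos-* l 4)) (arith (+ σ) (+ l))) ⟩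
    Ψ m (- + 4 * (+ suc l - + σ))
      ≡⟨ Ψ-rising m (+ suc l - + σ) ⟩
    + (8 ℕ.^ m) * rising m (+ suc l - + σ)
      ≡⟨ cong (+ (8 ℕ.^ m) *_) (rising-γ σ τ eq) ⟩
    + (8 ℕ.^ m) * (+ (m !) * (γ σ + γ τ))
      ≡⟨ swap (+ (8 ℕ.^ m)) (+ (m !)) (γ σ + γ τ) ⟩
    + (m !) * (+ (8 ℕ.^ m) * (γ σ + γ τ)) ∎)
    where
    open ≡-Reasoning
    arith : ∀ x y → x * + 4 - y * + 4 - + 4 ≡ - + 4 * ((1ℤ + y) - x)
    arith = solve-∀
    swap : ∀ x y z → x * (y * z) ≡ y * (x * z)
    swap = solve-∀
    arith₂ : ∀ σ τ → σ ℕ.* 4 ℕ.+ τ ℕ.* 4 ≡ (σ ℕ.+ τ) ℕ.* 4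
    arith₂ = solve-ℕ
    arith₃ : ∀ l → (6 ℕ.* l ℕ.+ 1) ℕ.* 4 ≡ 6 ℕ.* (l ℕ.* 4) ℕ.+ 4
    arith₃ = solve-ℕ
    sum-eq : σ ℕ.* 4 ℕ.+ τ ℕ.* 4 ≡ 6 ℕ.* m ℕ.+ 4
    sum-eq = ≡.trans (arith₂ σ τ) (≡.trans (cong (ℕ._* 4) eq) (arith₃ l))

-- Octahedral invariants

-- The homogeneous form of degree n - 1 whose list of coefficients is ordered by increasing powers
-- of `X`.
hom : ∀ {n} → Vec ℤ n → Series → Series → Series
hom []       V X = 𝟘
hom {suc n} (c ∷ cs) V X = const c ⊛ V ^ n ⊹ X ⊛ hom cs V X

lin : ∀ {n} → ℤ → Vec ℤ n → Vec ℤ n → Vec ℤ n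
lin H []       []       = []
lin H (a ∷ as) (b ∷ bs) = H * a - b ∷ lin H as bs

hom-lin : ∀ {n} H (as bs : Vec ℤ n) V X → hom (lin H as bs) V X ≈ const H ⊛ hom as V X ⊹ neg (hom bs V X)
hom-lin H [] [] V X = solve 1 (λ H → con 0ℤ := H :* con 0ℤ :+ :- con 0ℤ) ≈-refl (const H)
hom-lin {suc n} H (a ∷ as) (b ∷ bs) V X = ≈-trans
  (⊹-cong (⊛-congʳ {V ^ n} const-lin) (⊛-congˡ {X} (hom-lin H as bs V X)))
  (solve 7 (λ H A B V U X Y → (H :* A :+ :- B) :* V :+ U :* (H :* X :+ :- Y) := H :* (A :* V :+ U :* X) :+ :- (B :* V :+ U :* Y)) ≈-refl
    (const H) (const a) (const b) (V ^ n) X (hom as V X) (hom bs V X))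
  where
  const-lin : const (H * a - b) ≈ const H ⊛ const a ⊹ neg (const b)
  const-lin = ≈-trans (const-+ (H * a) (- b)) (⊹-cong (const-⊛-const H a) (const-neg b))

-- Coefficients of h (5f³ − 3456g) and of hg in powers of Y.
pA pG : Vec ℤ 10
pA = + 5 ∷ - + 3411 ∷ + 123732 ∷ - + 453180 ∷ - + 322506 ∷ - + 322506 ∷ - + 453180 ∷ + 123732 ∷ - + 3411 ∷ + 5 ∷ []
pG = + 0 ∷ + 1 ∷ - + 37 ∷ + 105 ∷ - + 69 ∷ - + 69 ∷ + 105 ∷ - + 37 ∷ + 1 ∷ + 0 ∷ []

p : ℤ → Vec ℤ 10
p H = lin H pA pG

-- The basic invariants of the octahedral group, of degrees 8, 24 and 12, in fourth powers of the variables.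
f̂ ĝ ĥ : Series → Series → Series
f̂ V X = V ⊛ V ⊹ (const (+ 14) ⊛ (V ⊛ X) ⊹ X ⊛ X)
ĝ V X = V ⊛ X ⊛ ((V ⊹ neg X) ^ 4)
ĥ V X = V ^ 3 ⊹ const (- + 33) ⊛ (V ⊛ X ⊛ (V ⊹ X)) ⊹ X ^ 3

private
  homTerm : ∀ {n} → Polynomial n → Polynomial n → ℕ → ℤ → Polynomial n → Polynomial n
  homTerm V X k c r = con c :* V :^ k :+ X :* r

  fP gP hP : ∀ {n} → Polynomial n → Polynomial n → Polynomial n
  fP V X = V :* V :+ (con (+ 14) :* (V :* X) :+ X :* X)
  gP V X = V :* X :* ((V :+ :- X) :^ 4)
  hP V X = V :^ 3 :+ con (- + 33) :* (V :* X :* (V :+ X)) :+ X :^ 3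

pA-factor : ∀ V X → hom pA V X ≈ ĥ V X ⊛ (const (+ 5) ⊛ f̂ V X ^ 3 ⊹ const (- + 3456) ⊛ ĝ V X)
pA-factor = solve 2 (λ V X → homTerm V X 9 (+ 5) (homTerm V X 8 (- + 3411) (homTerm V X 7 (+ 123732) (homTerm V X 6 (- + 453180) (homTerm V X 5 (- + 322506)
    (homTerm V X 4 (- + 322506) (homTerm V X 3 (- + 453180) (homTerm V X 2 (+ 123732) (homTerm V X 1 (- + 3411) (homTerm V X 0 (+ 5) (con 0ℤ))))))))))
  := hP V X :* (con (+ 5) :* fP V X :^ 3 :+ con (- + 3456) :* gP V X)) ≈-refl

pG-factor : ∀ V X → hom pG V X ≈ ĥ V X ⊛ ĝ V X
pG-factor = solve 2 (λ V X → homTerm V X 9 (+ 0) (homTerm V X 8 (+ 1) (homTerm V X 7 (- + 37) (homTerm V X 6 (+ 105) (homTerm V X 5 (- + 69)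
    (homTerm V X 4 (- + 69) (homTerm V X 3 (+ 105) (homTerm V X 2 (- + 37) (homTerm V X 1 (+ 1) (homTerm V X 0 (+ 0) (con 0ℤ))))))))))
  := hP V X :* gP V X) ≈-refl

ĥ-transform : ĥ (v ^ 4) (u ^ 4) ≈ const (- + 64) ⊛ ĥ 𝟙 (w ^ 4)
ĥ-transform = solve 1 (λ W → hP ((con 1ℤ :+ W) :^ 4) ((con 1ℤ :+ :- W) :^ 4) := con (- + 64) :* hP (con 1ℤ) (W :^ 4)) ≈-refl w

f̂-transform : f̂ (v ^ 4) (u ^ 4) ≈ const (+ 16) ⊛ f̂ 𝟙 (w ^ 4)
f̂-transform = solve 1 (λ W → fP ((con 1ℤ :+ W) :^ 4) ((con 1ℤ :+ :- W) :^ 4) := con (+ 16) :* fP (con 1ℤ) (W :^ 4)) ≈-refl w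

ĝ-transform : ĝ (v ^ 4) (u ^ 4) ≈ const (+ 4096) ⊛ ĝ 𝟙 (w ^ 4)
ĝ-transform = solve 1 (λ W → gP ((con 1ℤ :+ W) :^ 4) ((con 1ℤ :+ :- W) :^ 4) := con (+ 4096) :* gP (con 1ℤ) (W :^ 4)) ≈-refl w

-- The substitution is a multiple by √2 of an octahedral symmetry. Degree 36 therefore yields 2¹⁸ =
-- 262144, and the sign comes from `ĥ`, which is anti-invariant while `f̂` and `ĝ` are invariant.
-- This minus sign sets the two sides of the linear relation against each other.
p-transform : ∀ H → hom (p H) (v ^ 4) (u ^ 4) ≈ const (- + 262144) ⊛ hom (p H) 𝟙 (w ^ 4)
p-transform H = begin
  hom (p H) (v ^ 4) (u ^ 4)
    ≈⟨ factor (v ^ 4) (u ^ 4) ⟩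
  const H ⊛ (ĥ V X ⊛ (const (+ 5) ⊛ f̂ V X ^ 3 ⊹ const (- + 3456) ⊛ ĝ V X)) ⊹ neg (ĥ V X ⊛ ĝ V X)
    ≈⟨ ⊹-cong (⊛-congˡ {const H} (⊛-cong ĥ-transform (⊹-cong (⊛-congˡ {const (+ 5)} (^-congˡ 3 f̂-transform)) (⊛-congˡ {const (- + 3456)} ĝ-transform))))
         (pointwise λ n → cong -_ (coeff (⊛-cong ĥ-transform ĝ-transform) n)) ⟩
  const H ⊛ (const (- + 64) ⊛ h ⊛ (const (+ 5) ⊛ (const (+ 16) ⊛ f) ^ 3 ⊹ const (- + 3456) ⊛ (const (+ 4096) ⊛ g))) ⊹ neg (const (- + 64) ⊛ h ⊛ (const (+ 4096) ⊛ g))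
    ≈⟨ solve 4 (λ H h f g → H :* (con (- + 64) :* h :* (con (+ 5) :* (con (+ 16) :* f) :^ 3 :+ con (- + 3456) :* (con (+ 4096) :* g))) :+ :- (con (- + 64) :* h :* (con (+ 4096) :* g))
         := con (- + 262144) :* (H :* (h :* (con (+ 5) :* f :^ 3 :+ con (- + 3456) :* g)) :+ :- (h :* g))) ≈-refl (const H) h f g ⟩
  const (- + 262144) ⊛ (const H ⊛ (h ⊛ (const (+ 5) ⊛ f ^ 3 ⊹ const (- + 3456) ⊛ g)) ⊹ neg (h ⊛ g))
    ≈⟨ ⊛-congˡ {const (- + 262144)} (≈-sym (factor 𝟙 (w ^ 4))) ⟩
  const (- + 262144) ⊛ hom (p H) 𝟙 (w ^ 4) ∎
  where
  open ≈-Reasoning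
  V = v ^ 4
  X = u ^ 4
  h = ĥ 𝟙 (w ^ 4)
  f = f̂ 𝟙 (w ^ 4)
  g = ĝ 𝟙 (w ^ 4)
  factor : ∀ V X → hom (p H) V X ≈ const H ⊛ (ĥ V X ⊛ (const (+ 5) ⊛ f̂ V X ^ 3 ⊹ const (- + 3456) ⊛ ĝ V X)) ⊹ neg (ĥ V X ⊛ ĝ V X)
  factor V X = ≈-trans (hom-lin H pA pG V X) (⊹-cong (⊛-congˡ {const H} (pA-factor V X)) (pointwise λ n → cong -_ (coeff (pG-factor V X) n)))

-- Multiplication by the j-th power of w⁴ shifts the index of `γ` by j, so with f = `γ` this is the
-- residue at 0 of weight 4i weighted by the polynomial.
comb : ∀ {n} → Vec ℤ n → (ℕ → ℤ) → ℕ → ℤ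
comb []       f i = 0ℤ
comb (c ∷ cs) f i = c * f i + comb cs f (suc i)

𝟙^ : ∀ n → 𝟙 ^ n ≈ 𝟙
𝟙^ zero    = ≈-refl
𝟙^ (suc n) = ≈-trans (⊛-congˡ {𝟙} (𝟙^ n)) (solve 1 (λ Z → con 1ℤ :* con 1ℤ := con 1ℤ) ≈-refl 𝟘)

-- The residue functional on both sides of the MacWilliams identity

module Functional (l : ℕ) where
  open Gamma l

  ω : ∀ {n} → Vec ℤ n → ℕ → ℕ → ℤ
  ω ps t i = (w ^ i ⊛ (v ^ t ⊛ (hom ps 𝟙 (w ^ 4) ⊛ U ^ suc m))) m

  ω-suc : ∀ {n} (ps : Vec ℤ n) t i → ω ps (suc t) i ≡ ω ps t i + ω ps t (suc i)
  ω-suc ps t i = coeff (solve 4 (λ W I V X → I :* (((con 1ℤ :+ W) :* V) :* X) := I :* (V :* X) :+ (W :* I) :* (V :* X)) ≈-refl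
    w (w ^ i) (v ^ t) (hom ps 𝟙 (w ^ 4) ⊛ U ^ suc m)) m

  private
    ω₀-∷ : ∀ {n} c (cs : Vec ℤ n) i → ω (c ∷ cs) 0 i ≡ c * wU i + ω cs 0 (4 ℕ.+ i)
    ω₀-∷ {n} c cs i = ≡.trans (coeff (≈-trans
        (⊛-congˡ {w ^ i} (⊛-congˡ {𝟙} (⊛-congʳ {U ^ suc m} (⊹-cong (⊛-congˡ {const c} (𝟙^ n)) (≈-refl {w ^ 4 ⊛ hom cs 𝟙 (w ^ 4)})))))
        (solve 5 (λ C W I X Y → I :* (con 1ℤ :* ((C :* con 1ℤ :+ W :^ 4 :* X) :* Y))
          := C :* (I :* Y) :+ (W :* (W :* (W :* (W :* I)))) :* (con 1ℤ :* (X :* Y))) ≈-refl (const c) w (w ^ i) (hom cs 𝟙 (w ^ 4)) (U ^ suc m))) m)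
      (+-left (ω cs 0 (4 ℕ.+ i)) (const-⊛ c (w ^ i ⊛ U ^ suc m) m))

    ω₀-[] : ∀ i → ω [] 0 i ≡ 0ℤ
    ω₀-[] i = ≡.trans (coeff (solve 2 (λ I Y → I :* (con 1ℤ :* (con 0ℤ :* Y)) := con 0ℤ) ≈-refl (w ^ i) (U ^ suc m)) m) (𝟘-coeff m)

  ω₀-γ : ∀ {n} (ps : Vec ℤ n) q → ω ps 0 (q ℕ.* 4) ≡ comb ps γ q
  ω₀-γ []       q = ω₀-[] (q ℕ.* 4)
  ω₀-γ (c ∷ cs) q = ≡.trans (ω₀-∷ c cs (q ℕ.* 4)) (+-right (c * γ q) (ω₀-γ cs (suc q)))

  ω₀-vanish : ∀ {n} (ps : Vec ℤ n) q r → r ℕ.< 3 → ω ps 0 (q ℕ.* 4 ℕ.+ suc r) ≡ 0ℤ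
  ω₀-vanish []       q r r<3 = ω₀-[] (q ℕ.* 4 ℕ.+ suc r)
  ω₀-vanish (c ∷ cs) q r r<3 = ≡.trans (ω₀-∷ c cs (q ℕ.* 4 ℕ.+ suc r))
    (≡.trans (cong₂ _+_ (≡.trans (cong (c *_) (wU-vanish q r r<3)) (ℤ.*-zeroʳ c)) (ω₀-vanish cs (suc q) r r<3)) refl)

  ω₀-nonNeg : ∀ {n} (ps : Vec ℤ n) i → (∀ q → i ≡ q ℕ.* 4 → 0ℤ ℤ.≤ comb ps γ q) → 0ℤ ℤ.≤ ω ps 0 i
  ω₀-nonNeg ps i h with i divMod 4
  ... | result q zero eq = subst (0ℤ ℤ.≤_) (≡.sym (≡.trans (cong (ω ps 0) eq) (ω₀-γ ps q))) (h q eq)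
  ... | result q (suc r) eq = ℤ.≤-reflexive (≡.sym (≡.trans (cong (ω ps 0) (≡.trans eq (ℕ.+-comm (suc (Fin.toℕ r)) (q ℕ.* 4))))
        (ω₀-vanish ps q (Fin.toℕ r) (Fin.toℕ<n r))))

  ω-nonNeg : ∀ {n} (ps : Vec ℤ n) t i → (∀ q → i ℕ.≤ q ℕ.* 4 → q ℕ.* 4 ℕ.≤ i ℕ.+ t → 0ℤ ℤ.≤ comb ps γ q) → 0ℤ ℤ.≤ ω ps t i
  ω-nonNeg ps zero    i h = ω₀-nonNeg ps i λ q eq → h q (ℕ.≤-reflexive eq) (ℕ.≤-reflexive (≡.trans (≡.sym eq) (≡.sym (ℕ.+-identityʳ i))))
  ω-nonNeg ps (suc t) i h = subst (0ℤ ℤ.≤_) (≡.sym (ω-suc ps t i)) (ℤ.+-mono-≤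
    (ω-nonNeg ps t i λ q lo hi → h q lo (ℕ.≤-trans hi (ℕ.+-monoʳ-≤ i (ℕ.n≤1+n t))))
    (ω-nonNeg ps t (suc i) λ q lo hi → h q (ℕ.≤-trans (ℕ.n≤1+n i) lo) (ℕ.≤-trans hi (ℕ.≤-reflexive (≡.sym (ℕ.+-suc i t))))))

  ω-positive : ∀ {n} (ps : Vec ℤ n) t → 0ℤ ℤ.< comb ps γ 0 → (∀ q → q ℕ.* 4 ℕ.≤ t → 0ℤ ℤ.≤ comb ps γ q) → 0ℤ ℤ.< ω ps t 0
  ω-positive ps zero    pos h = subst (0ℤ ℤ.<_) (≡.sym (ω₀-γ ps 0)) pos
  ω-positive ps (suc t) pos h = subst (0ℤ ℤ.<_) (≡.sym (ω-suc ps t 0)) (ℤ.+-mono-<-≤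
    (ω-positive ps t pos λ q hi → h q (ℕ.≤-trans hi (ℕ.n≤1+n t)))
    (ω-nonNeg ps t 1 λ q lo hi → h q hi))

  -- The part of the differential common to all words. Times wⁱ it measures a word of T of weight i;
  -- times uᵃ vᵇ it measures a word of R with a ones and b zeros before padding.
  Ω : ℤ → ℕ → Series
  Ω H t = v ^ t ⊛ (hom (p H) (v ^ 4) (u ^ 4) ⊛ U ^ suc m)

  Ω-w : ∀ H t i → (w ^ i ⊛ Ω H t) m ≡ - + 262144 * ω (p H) t i
  Ω-w H t i = ≡.trans (coeff (≈-trans (⊛-congˡ {w ^ i} (⊛-congˡ {v ^ t} (⊛-congʳ {U ^ suc m} (p-transform H))))
      (solve 5 (λ I V K X Y → I :* (V :* (K :* X :* Y)) := K :* (I :* (V :* (X :* Y)))) ≈-refl (w ^ i) (v ^ t) (const (- + 262144)) (hom (p H) 𝟙 (w ^ 4)) (U ^ suc m))) m)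
    (const-⊛ (- + 262144) (w ^ i ⊛ (v ^ t ⊛ (hom (p H) 𝟙 (w ^ 4) ⊛ U ^ suc m))) m)

  twoSided : ∀ {n} → Vec ℤ n → ℕ → ℕ → ℤ
  twoSided [] σ τ = 0ℤ
  twoSided {suc n} (c ∷ cs) σ τ = c * (γ σ + γ (n ℕ.+ τ)) + twoSided cs (suc σ) τ

  private
    uv : ∀ {n} (ps : Vec ℤ n) a b σ τ → a ≡ σ ℕ.* 4 → b ≡ τ ℕ.* 4 → σ ℕ.+ τ ℕ.+ n ≡ 6 ℕ.* l ℕ.+ 2 →
      (u ^ a ⊛ v ^ b ⊛ (hom ps (v ^ 4) (u ^ 4) ⊛ U ^ suc m)) m ≡ + (8 ℕ.^ m) * twoSided ps σ τ
    uv [] a b σ τ _ _ _ = ≡.trans (coeff (solve 2 (λ X Y → X :* (con 0ℤ :* Y) := con 0ℤ) ≈-refl (u ^ a ⊛ v ^ b) (U ^ suc m)) m)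
      (≡.trans (𝟘-coeff m) (≡.sym (ℤ.*-zeroʳ (+ (8 ℕ.^ m)))))
    uv {suc n} (c ∷ cs) a b σ τ aeq beq eq = begin
      (u ^ a ⊛ v ^ b ⊛ ((const c ⊛ (v ^ 4) ^ n ⊹ u ^ 4 ⊛ hom cs (v ^ 4) (u ^ 4)) ⊛ U ^ suc m)) m
        ≡⟨ coeff (≈-trans (solve 7 (λ A B C V U X Y → A :* B :* ((C :* V :+ U :* X) :* Y) := C :* (A :* (V :* B) :* Y) :+ (U :* A) :* B :* (X :* Y)) ≈-refl
             (u ^ a) (v ^ b) (const c) ((v ^ 4) ^ n) (u ^ 4) (hom cs (v ^ 4) (u ^ 4)) (U ^ suc m))
             (⊹-cong (⊛-congˡ {const c} (⊛-congʳ {U ^ suc m} (⊛-congˡ {u ^ a} (≈-trans (⊛-congʳ {v ^ b} v^4n) (≈-sym (^-homo-* v (n ℕ.* 4) b))))))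
                     (⊛-congʳ {hom cs (v ^ 4) (u ^ 4) ⊛ U ^ suc m} (⊛-congʳ {v ^ b} (≈-sym (^-homo-* u 4 a)))))) m ⟩
      (const c ⊛ (u ^ a ⊛ v ^ (n ℕ.* 4 ℕ.+ b) ⊛ U ^ suc m)) m + (u ^ (4 ℕ.+ a) ⊛ v ^ b ⊛ (hom cs (v ^ 4) (u ^ 4) ⊛ U ^ suc m)) m
        ≡⟨ cong₂ _+_ (≡.trans (const-⊛ c (u ^ a ⊛ v ^ (n ℕ.* 4 ℕ.+ b) ⊛ U ^ suc m) m) (cong (c *_) (coeff-uvU-γ σ (n ℕ.+ τ) a (n ℕ.* 4 ℕ.+ b) aeq
               (≡.trans (cong (n ℕ.* 4 ℕ.+_) beq) (≡.sym (ℕ.*-distribʳ-+ 4 n τ))) eq₁)))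
             (uv cs (4 ℕ.+ a) b (suc σ) τ (cong (4 ℕ.+_) aeq) beq eq₂) ⟩
      c * (+ (8 ℕ.^ m) * (γ σ + γ (n ℕ.+ τ))) + + (8 ℕ.^ m) * twoSided cs (suc σ) τ
        ≡⟨ arith c (+ (8 ℕ.^ m)) (γ σ + γ (n ℕ.+ τ)) (twoSided cs (suc σ) τ) ⟩
      + (8 ℕ.^ m) * (c * (γ σ + γ (n ℕ.+ τ)) + twoSided cs (suc σ) τ) ∎
      where
      open ≡-Reasoning
      v^4n : (v ^ 4) ^ n ≈ v ^ (n ℕ.* 4)
      v^4n = ≈-trans (^-assocʳ v 4 n) (^-congʳ v (ℕ.*-comm 4 n))
      arith : ∀ c e x y → c * (e * x) + e * y ≡ e * (c * x + y)
      arith = solve-∀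
      eq₂ : suc σ ℕ.+ τ ℕ.+ n ≡ 6 ℕ.* l ℕ.+ 2
      eq₂ = ≡.trans (≡.sym (ℕ.+-suc (σ ℕ.+ τ) n)) eq
      arith₂ : ∀ σ τ n → σ ℕ.+ τ ℕ.+ (1 ℕ.+ n) ≡ 1 ℕ.+ (σ ℕ.+ (n ℕ.+ τ))
      arith₂ = solve-ℕ
      arith₃ : ∀ x → x ℕ.+ 2 ≡ 1 ℕ.+ (x ℕ.+ 1)
      arith₃ = solve-ℕ
      eq₁ : σ ℕ.+ (n ℕ.+ τ) ≡ 6 ℕ.* l ℕ.+ 1
      eq₁ = ℕ.suc-injective (≡.trans (≡.sym (arith₂ σ τ n)) (≡.trans eq (arith₃ (6 ℕ.* l))))

  private
    palindrome : ∀ x₀ x₁ x₂ x₃ x₄ a₀ a₁ a₂ a₃ a₄ a₅ a₆ a₇ a₈ a₉ b₀ b₁ b₂ b₃ b₄ b₅ b₆ b₇ b₈ b₉ →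
        x₀ * (a₀ + b₉) + (x₁ * (a₁ + b₈) + (x₂ * (a₂ + b₇) + (x₃ * (a₃ + b₆) + (x₄ * (a₄ + b₅)
        + (x₄ * (a₅ + b₄) + (x₃ * (a₆ + b₃) + (x₂ * (a₇ + b₂) + (x₁ * (a₈ + b₁) + (x₀ * (a₉ + b₀) + 0ℤ)))))))))
      ≡ (x₀ * a₀ + (x₁ * a₁ + (x₂ * a₂ + (x₃ * a₃ + (x₄ * a₄ + (x₄ * a₅ + (x₃ * a₆ + (x₂ * a₇ + (x₁ * a₈ + (x₀ * a₉ + 0ℤ))))))))))
        + (x₀ * b₀ + (x₁ * b₁ + (x₂ * b₂ + (x₃ * b₃ + (x₄ * b₄ + (x₄ * b₅ + (x₃ * b₆ + (x₂ * b₇ + (x₁ * b₈ + (x₀ * b₉ + 0ℤ))))))))))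
    palindrome = solve-∀

  -- The forms `f̂`, `ĝ` and `ĥ` are symmetric in their two arguments, so `p H` is palindromic and
  -- the contributions from ∞ can be reread as a combination starting at τ.
  twoSided-p : ∀ H σ τ → twoSided (p H) σ τ ≡ comb (p H) γ σ + comb (p H) γ τ
  twoSided-p H σ τ = palindrome (H * + 5 - + 0) (H * - + 3411 - + 1) (H * + 123732 - - + 37) (H * - + 453180 - + 105) (H * - + 322506 - - + 69)
    (γ σ) (γ (1 ℕ.+ σ)) (γ (2 ℕ.+ σ)) (γ (3 ℕ.+ σ)) (γ (4 ℕ.+ σ)) (γ (5 ℕ.+ σ)) (γ (6 ℕ.+ σ)) (γ (7 ℕ.+ σ)) (γ (8 ℕ.+ σ)) (γ (9 ℕ.+ σ))
    (γ τ) (γ (1 ℕ.+ τ)) (γ (2 ℕ.+ τ)) (γ (3 ℕ.+ τ)) (γ (4 ℕ.+ τ)) (γ (5 ℕ.+ τ)) (γ (6 ℕ.+ τ)) (γ (7 ℕ.+ τ)) (γ (8 ℕ.+ τ)) (γ (9 ℕ.+ τ))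

  Ω-uv : ∀ H t a b σ τ → a ≡ σ ℕ.* 4 → b ℕ.+ t ≡ τ ℕ.* 4 → σ ℕ.+ τ ℕ.+ 8 ≡ 6 ℕ.* l →
    (u ^ a ⊛ v ^ b ⊛ Ω H t) m ≡ + (8 ℕ.^ m) * (comb (p H) γ σ + comb (p H) γ τ)
  Ω-uv H t a b σ τ aeq beq eq = begin
    (u ^ a ⊛ v ^ b ⊛ (v ^ t ⊛ (hom (p H) (v ^ 4) (u ^ 4) ⊛ U ^ suc m))) m
      ≡⟨ coeff (≈-trans (solve 4 (λ A B V X → A :* B :* (V :* X) := A :* (B :* V) :* X) ≈-refl (u ^ a) (v ^ b) (v ^ t) (hom (p H) (v ^ 4) (u ^ 4) ⊛ U ^ suc m))
           (⊛-congʳ {hom (p H) (v ^ 4) (u ^ 4) ⊛ U ^ suc m} (⊛-congˡ {u ^ a} (≈-sym (^-homo-* v b t))))) m ⟩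
    (u ^ a ⊛ v ^ (b ℕ.+ t) ⊛ (hom (p H) (v ^ 4) (u ^ 4) ⊛ U ^ suc m)) m
      ≡⟨ uv (p H) a (b ℕ.+ t) σ τ aeq beq (≡.trans (≡.sym (ℕ.+-assoc (σ ℕ.+ τ) 8 2)) (cong (ℕ._+ 2) eq)) ⟩
    + (8 ℕ.^ m) * twoSided (p H) σ τ
      ≡⟨ cong (+ (8 ℕ.^ m) *_) (twoSided-p H σ τ) ⟩
    + (8 ℕ.^ m) * (comb (p H) γ σ + comb (p H) γ τ) ∎
    where open ≡-Reasoning

-- Sign of the linear programming functional

-- The value of the form at integers is taken as a constant coefficient, so that identities between
-- series such as `pA-factor` specialise to it.
hv : ∀ {n} → Vec ℤ n → ℤ → ℤ → ℤ
hv ps S M = hom ps (const S) (const M) 0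

const-^ : ∀ k n → (const (+ k) ^ n) 0 ≡ + (k ℕ.^ n)
const-^ k zero    = refl
const-^ k (suc n) = ≡.trans (cong (+ k *_) (const-^ k n)) (≡.sym (ℤ.pos-* k (k ℕ.^ n)))

-- The number e(e - 1)/2, the sum of the errors contributed by the successive steps of `δ-suc`.
tri : ℕ → ℕ
tri zero    = 0
tri (suc e) = tri e ℕ.+ e

-- The constant in the O(1/s′) error: relative to `γ i`, the term of index e is off by at most
-- `abs c` times `tri e` / s′.
mass : ∀ {n} → Vec ℤ n → ℕ → ℕ
mass []       e = 0
mass (c ∷ cs) e = abs c ℕ.* tri e ℕ.+ mass cs (suc e)

-- Residues compared with powers of the saddle point

module Deviation (l i M : ℕ) (eq : l ≡ i ℕ.+ M) where
  open Gamma l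

  -- Equal to 5l - i, so that M / s′ is the saddle point Y belonging to the weight 4i.
  s′ : ℕ
  s′ = M ℕ.+ m

  -- The differences are taken in ℤ so that the identity persists for e > M, where both sides vanish
  -- because `γ` is zero above l.
  γ-step : ∀ e → (+ s′ - + e) * γ (suc e ℕ.+ i) ≡ (+ M - + e) * γ (e ℕ.+ i)
  γ-step e with e ℕ.≤? M
  ... | yes e≤M with ∃-diff e≤M
  ...   | M′ , refl = ≡.sym (begin
      (+ (e ℕ.+ M′) - + e) * γ (e ℕ.+ i)        ≡⟨ cong (λ z → (z - + e) * γ (e ℕ.+ i)) (ℤ.pos-+ e M′) ⟩
      (+ e + + M′ - + e) * γ (e ℕ.+ i)          ≡⟨ cong (_* γ (e ℕ.+ i)) (arith (+ e) (+ M′)) ⟩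
      + M′ * γ (e ℕ.+ i)                        ≡⟨ γ-recursion (e ℕ.+ i) M′ (≡.trans eq (arith₀ i e M′)) ⟩
      (+ M′ + + m) * γ (suc e ℕ.+ i)            ≡⟨ cong (_* γ (suc e ℕ.+ i)) (arith₂ (+ e) (+ M′) (+ m)) ⟩
      (+ e + + M′ + + m - + e) * γ (suc e ℕ.+ i) ≡⟨ cong (λ z → (z - + e) * γ (suc e ℕ.+ i)) (≡.trans (ℤ.pos-+ (e ℕ.+ M′) m) (+-left (+ m) (ℤ.pos-+ e M′))) ⟨
      (+ (e ℕ.+ M′ ℕ.+ m) - + e) * γ (suc e ℕ.+ i) ∎)
    where
    open ≡-Reasoning
    arith : ∀ x y → x + y - x ≡ y
    arith = solve-∀
    arith₂ : ∀ x y z → y + z ≡ x + y + z - x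
    arith₂ = solve-∀
    arith₀ : ∀ i e m → i ℕ.+ (e ℕ.+ m) ≡ (e ℕ.+ i) ℕ.+ m
    arith₀ = solve-ℕ
  γ-step e | no e≰M = ≡.trans (cong ((+ s′ - + e) *_) (γ-high (suc e ℕ.+ i) (ℕ.m<n⇒m<1+n l<)))
    (≡.trans (ℤ.*-zeroʳ (+ s′ - + e)) (≡.sym (≡.trans (cong ((+ M - + e) *_) (γ-high (e ℕ.+ i) l<)) (ℤ.*-zeroʳ (+ M - + e)))))
    where
    l< : l ℕ.< e ℕ.+ i
    l< = subst (ℕ._< e ℕ.+ i) (≡.sym (≡.trans eq (ℕ.+-comm i M))) (ℕ.+-monoˡ-< i (ℕ.≰⇒> e≰M))

  γ-antitone : ∀ i → γ (suc i) ℤ.≤ γ i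
  γ-antitone i with i ℕ.≤? l
  ... | no i≰l = subst (ℤ._≤ γ i) (≡.sym (γ-high (suc i) (ℕ.m<n⇒m<1+n (ℕ.≰⇒> i≰l)))) (γ-nonNeg i)
  ... | yes i≤l with ∃-diff i≤l
  ...   | zero , eq = subst (ℤ._≤ γ i) (≡.sym (γ-high (suc i) (s≤s (ℕ.≤-reflexive (≡.trans eq (ℕ.+-identityʳ i)))))) (γ-nonNeg i)
  ...   | suc M , eq = ℤ.*-cancelˡ-≤-pos (γ (suc i)) (γ i) (+ suc M) (subst (+ suc M * γ (suc i) ℤ.≤_) (≡.sym (γ-recursion i (suc M) eq))
      (subst (ℤ._≤ (+ suc M + + m) * γ (suc i)) (ℤ.+-identityʳ _)
        (subst (+ suc M * γ (suc i) + 0ℤ ℤ.≤_) (≡.sym (ℤ.*-distribʳ-+ (γ (suc i)) (+ suc M) (+ m)))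
          (ℤ.+-monoʳ-≤ (+ suc M * γ (suc i)) (subst (ℤ._≤ + m * γ (suc i)) (ℤ.*-zeroʳ (+ m)) (ℤ.*-monoˡ-≤-nonNeg (+ m) (γ-nonNeg (suc i))))))))

  γ-antitone* : ∀ e → γ (e ℕ.+ i) ℤ.≤ γ i
  γ-antitone* zero    = ℤ.≤-refl
  γ-antitone* (suc e) = ℤ.≤-trans (γ-antitone (e ℕ.+ i)) (γ-antitone* e)

  private
    Γ : ℕ
    Γ = abs (γ i)

    between : ∀ {x y z} → 0ℤ ℤ.≤ x → x ℤ.≤ y → y ℤ.≤ z → abs (x - y) ℕ.≤ abs z
    between {+ x} {+ y} {+ z} _ (+≤+ x≤y) (+≤+ y≤z) = subst (ℕ._≤ z)
      (≡.sym (≡.trans (cong abs (≡.trans (ℤ.m-n≡m⊖n x y) (ℤ.⊖-≤ x≤y))) (ℤ.∣-i∣≡∣i∣ (+ (y ℕ.∸ x))))) (ℕ.≤-trans (ℕ.m∸n≤m y x) y≤z)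

    γ-difference : ∀ e → abs (γ (suc e ℕ.+ i) - γ (e ℕ.+ i)) ℕ.≤ Γ
    γ-difference e = between (γ-nonNeg (suc e ℕ.+ i)) (γ-antitone (e ℕ.+ i)) (γ-antitone* e)

  -- γ (e + i) / γ i is a quotient of falling factorials, which δ compares with (M / s′)ᵉ.
  δ : ℕ → ℤ
  δ e = + (s′ ℕ.^ e) * γ (e ℕ.+ i) - + (M ℕ.^ e) * γ i

  δ-suc : ∀ e → δ (suc e) ≡ + M * δ e + + (e ℕ.* s′ ℕ.^ e) * (γ (suc e ℕ.+ i) - γ (e ℕ.+ i))
  δ-suc e = begin
    + (s′ ℕ.* s′ ℕ.^ e) * γ′ - + (M ℕ.* M ℕ.^ e) * γ i
      ≡⟨ cong₂ (λ x y → x * γ′ - y * γ i) (ℤ.pos-* s′ (s′ ℕ.^ e)) (ℤ.pos-* M (M ℕ.^ e)) ⟩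
    + s′ * Sᵉ * γ′ - + M * Mᵉ * γ i
      ≡⟨ arith (+ s′) (+ e) Sᵉ (+ M) Mᵉ γ′ (γ i) ⟩
    Sᵉ * ((+ s′ - + e) * γ′) + + e * Sᵉ * γ′ - + M * Mᵉ * γ i
      ≡⟨ cong (λ z → Sᵉ * z + + e * Sᵉ * γ′ - + M * Mᵉ * γ i) (γ-step e) ⟩
    Sᵉ * ((+ M - + e) * γ₀) + + e * Sᵉ * γ′ - + M * Mᵉ * γ i
      ≡⟨ arith₂ (+ e) Sᵉ (+ M) Mᵉ γ′ γ₀ (γ i) ⟩
    + M * (Sᵉ * γ₀ - Mᵉ * γ i) + + e * Sᵉ * (γ′ - γ₀)
      ≡⟨ cong (λ z → + M * (Sᵉ * γ₀ - Mᵉ * γ i) + z * (γ′ - γ₀)) (ℤ.pos-* e (s′ ℕ.^ e)) ⟨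
    + M * δ e + + (e ℕ.* s′ ℕ.^ e) * (γ′ - γ₀) ∎
    where
    open ≡-Reasoning
    Sᵉ = + (s′ ℕ.^ e)
    Mᵉ = + (M ℕ.^ e)
    γ′ = γ (suc e ℕ.+ i)
    γ₀ = γ (e ℕ.+ i)
    arith : ∀ s e S M N γ′ γi → s * S * γ′ - M * N * γi ≡ S * ((s - e) * γ′) + e * S * γ′ - M * N * γi
    arith = solve-∀
    arith₂ : ∀ e S M N γ′ γ₀ γi → S * ((M - e) * γ₀) + e * S * γ′ - M * N * γi ≡ M * (S * γ₀ - N * γi) + e * S * (γ′ - γ₀)
    arith₂ = solve-∀

  -- A step multiplies the old error by M ≤ s′ and adds at most e·s′ᵉ·`γ i`: since `γ` is
  -- non-negative and antitone, its successive differences beyond i are at most `γ i`.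
  δ-bound : ∀ e → s′ ℕ.* abs (δ e) ℕ.≤ tri e ℕ.* s′ ℕ.^ e ℕ.* Γ
  δ-bound zero = ℕ.≤-reflexive (≡.trans (cong (λ z → s′ ℕ.* abs z) (arith (γ i))) (ℕ.*-zeroʳ s′))
    where
    arith : ∀ x → + 1 * x - + 1 * x ≡ 0ℤ
    arith = solve-∀
  δ-bound (suc e) = begin
    s′ ℕ.* abs (δ (suc e))
      ≡⟨ cong (λ z → s′ ℕ.* abs z) (δ-suc e) ⟩
    s′ ℕ.* abs (+ M * δ e + + (e ℕ.* s′ ℕ.^ e) * (γ (suc e ℕ.+ i) - γ (e ℕ.+ i)))
      ≤⟨ ℕ.*-monoʳ-≤ s′ (ℤ.∣i+j∣≤∣i∣+∣j∣ (+ M * δ e) _) ⟩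
    s′ ℕ.* (abs (+ M * δ e) ℕ.+ abs (+ (e ℕ.* s′ ℕ.^ e) * (γ (suc e ℕ.+ i) - γ (e ℕ.+ i))))
      ≡⟨ cong₂ (λ x y → s′ ℕ.* (x ℕ.+ y)) (ℤ.abs-* (+ M) (δ e)) (ℤ.abs-* (+ (e ℕ.* s′ ℕ.^ e)) (γ (suc e ℕ.+ i) - γ (e ℕ.+ i))) ⟩
    s′ ℕ.* (M ℕ.* abs (δ e) ℕ.+ e ℕ.* s′ ℕ.^ e ℕ.* abs (γ (suc e ℕ.+ i) - γ (e ℕ.+ i)))
      ≤⟨ ℕ.*-monoʳ-≤ s′ (ℕ.+-mono-≤ (ℕ.*-monoˡ-≤ (abs (δ e)) (ℕ.m≤m+n M m)) (ℕ.*-monoʳ-≤ (e ℕ.* s′ ℕ.^ e) (γ-difference e))) ⟩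
    s′ ℕ.* (s′ ℕ.* abs (δ e) ℕ.+ e ℕ.* s′ ℕ.^ e ℕ.* Γ)
      ≤⟨ ℕ.*-monoʳ-≤ s′ (ℕ.+-monoˡ-≤ (e ℕ.* s′ ℕ.^ e ℕ.* Γ) (δ-bound e)) ⟩
    s′ ℕ.* (tri e ℕ.* s′ ℕ.^ e ℕ.* Γ ℕ.+ e ℕ.* s′ ℕ.^ e ℕ.* Γ)
      ≡⟨ arith s′ (tri e) e (s′ ℕ.^ e) Γ ⟩
    (tri e ℕ.+ e) ℕ.* (s′ ℕ.* s′ ℕ.^ e) ℕ.* Γ ∎
    where
    open ℕ.≤-Reasoning
    arith : ∀ s t e x g → s ℕ.* (t ℕ.* x ℕ.* g ℕ.+ e ℕ.* x ℕ.* g) ≡ (t ℕ.+ e) ℕ.* (s ℕ.* x) ℕ.* g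
    arith = solve-ℕ

  -- The scaled difference between a combination and its saddle-point value. The shift e lets `ps`
  -- be a tail of the full coefficient list, which makes `err` additive along the list.
  err : ∀ {n} → Vec ℤ n → ℕ → ℤ
  err {n} ps e = + (s′ ℕ.^ (e ℕ.+ n)) * comb ps γ (e ℕ.+ i) - + s′ * hv ps (+ s′) (+ M) * (+ (M ℕ.^ e) * γ i)

  err-∷ : ∀ {n} c (cs : Vec ℤ n) e → err (c ∷ cs) e ≡ c * + (s′ ℕ.^ suc n) * δ e + err cs (suc e)
  err-∷ {n} c cs e = begin
    + (s′ ℕ.^ (e ℕ.+ suc n)) * (c * γ₀ + K) - + s′ * (c * (const (+ s′) ^ n) 0 + + M * h) * (+ (M ℕ.^ e) * γ i)
      ≡⟨ cong₂ (λ x y → x * (c * γ₀ + K) - + s′ * (c * y + + M * h) * (+ (M ℕ.^ e) * γ i))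
           (≡.trans (cong +_ (ℕ.^-distribˡ-+-* s′ e (suc n))) (≡.trans (ℤ.pos-* (s′ ℕ.^ e) (s′ ℕ.^ suc n)) (cong (+ (s′ ℕ.^ e) *_) (ℤ.pos-* s′ (s′ ℕ.^ n)))))
           (const-^ s′ n) ⟩
    Sᵉ * (+ s′ * Sⁿ) * (c * γ₀ + K) - + s′ * (c * Sⁿ + + M * h) * (Mᵉ * γ i)
      ≡⟨ arith c γ₀ (γ i) K h Sᵉ Sⁿ (+ s′) (+ M) Mᵉ ⟩
    c * (+ s′ * Sⁿ) * (Sᵉ * γ₀ - Mᵉ * γ i) + (+ s′ * (Sᵉ * Sⁿ) * K - + s′ * h * (+ M * Mᵉ * γ i))
      ≡⟨ cong₂ (λ x y → c * x * δ e + y) (≡.sym (ℤ.pos-* s′ (s′ ℕ.^ n)))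
           (cong₂ (λ x y → x * K - + s′ * h * (y * γ i))
             (≡.sym (≡.trans (ℤ.pos-* s′ (s′ ℕ.^ (e ℕ.+ n))) (cong (+ s′ *_) (≡.trans (cong +_ (ℕ.^-distribˡ-+-* s′ e n)) (ℤ.pos-* (s′ ℕ.^ e) (s′ ℕ.^ n))))))
             (≡.sym (ℤ.pos-* M (M ℕ.^ e)))) ⟩
    c * + (s′ ℕ.^ suc n) * δ e + err cs (suc e) ∎
    where
    open ≡-Reasoning
    Sᵉ = + (s′ ℕ.^ e)
    Sⁿ = + (s′ ℕ.^ n)
    Mᵉ = + (M ℕ.^ e)
    γ₀ = γ (e ℕ.+ i)
    K = comb cs γ (suc e ℕ.+ i)
    h = hv cs (+ s′) (+ M)
    arith : ∀ c γ₀ γi K h E N s M F → E * (s * N) * (c * γ₀ + K) - s * (c * N + M * h) * (F * γi)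
      ≡ c * (s * N) * (E * γ₀ - F * γi) + (s * (E * N) * K - s * h * (M * F * γi))
    arith = solve-∀

  err-bound : ∀ {n} (ps : Vec ℤ n) e → s′ ℕ.* abs (err ps e) ℕ.≤ mass ps e ℕ.* s′ ℕ.^ (e ℕ.+ n) ℕ.* Γ
  err-bound [] e = ℕ.≤-reflexive (≡.trans (cong (λ z → s′ ℕ.* abs z) (arith (+ (s′ ℕ.^ (e ℕ.+ 0))) (+ s′) (+ (M ℕ.^ e) * γ i))) (ℕ.*-zeroʳ s′))
    where
    arith : ∀ x s y → x * 0ℤ - s * 0ℤ * y ≡ 0ℤ
    arith = solve-∀
  err-bound {suc n} (c ∷ cs) e = begin
    s′ ℕ.* abs (err (c ∷ cs) e)
      ≡⟨ cong (λ z → s′ ℕ.* abs z) (err-∷ c cs e) ⟩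
    s′ ℕ.* abs (c * + (s′ ℕ.^ suc n) * δ e + err cs (suc e))
      ≤⟨ ℕ.*-monoʳ-≤ s′ (ℤ.∣i+j∣≤∣i∣+∣j∣ (c * + (s′ ℕ.^ suc n) * δ e) (err cs (suc e))) ⟩
    s′ ℕ.* (abs (c * + (s′ ℕ.^ suc n) * δ e) ℕ.+ abs (err cs (suc e)))
      ≡⟨ cong (λ z → s′ ℕ.* (z ℕ.+ abs (err cs (suc e)))) (≡.trans (ℤ.abs-* (c * + (s′ ℕ.^ suc n)) (δ e)) (cong (ℕ._* abs (δ e)) (ℤ.abs-* c (+ (s′ ℕ.^ suc n))))) ⟩
    s′ ℕ.* (abs c ℕ.* s′ ℕ.^ suc n ℕ.* abs (δ e) ℕ.+ abs (err cs (suc e)))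
      ≡⟨ arith s′ (abs c) (s′ ℕ.^ suc n) (abs (δ e)) (abs (err cs (suc e))) ⟩
    abs c ℕ.* s′ ℕ.^ suc n ℕ.* (s′ ℕ.* abs (δ e)) ℕ.+ s′ ℕ.* abs (err cs (suc e))
      ≤⟨ ℕ.+-mono-≤ (ℕ.*-monoʳ-≤ (abs c ℕ.* s′ ℕ.^ suc n) (δ-bound e)) (err-bound cs (suc e)) ⟩
    abs c ℕ.* s′ ℕ.^ suc n ℕ.* (tri e ℕ.* s′ ℕ.^ e ℕ.* Γ) ℕ.+ mass cs (suc e) ℕ.* s′ ℕ.^ (suc e ℕ.+ n) ℕ.* Γ
      ≡⟨ cong₂ ℕ._+_ (arith₂ (abs c) (s′ ℕ.^ suc n) (tri e) (s′ ℕ.^ e) Γ) (cong (λ z → mass cs (suc e) ℕ.* s′ ℕ.^ z ℕ.* Γ) (≡.sym (ℕ.+-suc e n))) ⟩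
    abs c ℕ.* tri e ℕ.* (s′ ℕ.^ e ℕ.* s′ ℕ.^ suc n) ℕ.* Γ ℕ.+ mass cs (suc e) ℕ.* s′ ℕ.^ (e ℕ.+ suc n) ℕ.* Γ
      ≡⟨ cong (λ z → abs c ℕ.* tri e ℕ.* z ℕ.* Γ ℕ.+ mass cs (suc e) ℕ.* s′ ℕ.^ (e ℕ.+ suc n) ℕ.* Γ) (ℕ.^-distribˡ-+-* s′ e (suc n)) ⟨
    abs c ℕ.* tri e ℕ.* s′ ℕ.^ (e ℕ.+ suc n) ℕ.* Γ ℕ.+ mass cs (suc e) ℕ.* s′ ℕ.^ (e ℕ.+ suc n) ℕ.* Γ
      ≡⟨ arith₃ (abs c ℕ.* tri e) (mass cs (suc e)) (s′ ℕ.^ (e ℕ.+ suc n)) Γ ⟩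
    (abs c ℕ.* tri e ℕ.+ mass cs (suc e)) ℕ.* s′ ℕ.^ (e ℕ.+ suc n) ℕ.* Γ ∎
    where
    open ℕ.≤-Reasoning
    arith : ∀ s c x d f → s ℕ.* (c ℕ.* x ℕ.* d ℕ.+ f) ≡ c ℕ.* x ℕ.* (s ℕ.* d) ℕ.+ s ℕ.* f
    arith = solve-ℕ
    arith₂ : ∀ c x t y g → c ℕ.* x ℕ.* (t ℕ.* y ℕ.* g) ≡ c ℕ.* t ℕ.* (y ℕ.* x) ℕ.* g
    arith₂ = solve-ℕ
    arith₃ : ∀ a b x g → a ℕ.* x ℕ.* g ℕ.+ b ℕ.* x ℕ.* g ≡ (a ℕ.+ b) ℕ.* x ℕ.* g
    arith₃ = solve-ℕ

  private
    neg-abs : ∀ x k → abs x ℕ.≤ k → - + k ℤ.≤ x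
    neg-abs (+ n)    k       _         = ℤ.≤-trans (ℤ.neg-mono-≤ (+≤+ (z≤n {k}))) (+≤+ z≤n)
    neg-abs -[1+ n ] (suc k) (s≤s n≤k) = ℤ.-≤- n≤k

  -- Both the main term and the bound on the error are multiples of `γ i`, which is positive for i ≤
  -- l; it cancels and leaves a comparison that involves only M and s′.
  comb-positive : ∀ {n} (ps : Vec ℤ n) → + (mass ps 0 ℕ.* s′ ℕ.^ n) ℤ.< + s′ * (+ s′ * hv ps (+ s′) (+ M)) → 0ℤ ℤ.< comb ps γ i
  comb-positive {n} ps h = ℤ.*-cancelˡ-<-nonNeg (+ (s′ ℕ.* s′ ℕ.^ n)) (subst (ℤ._< + (s′ ℕ.* s′ ℕ.^ n) * comb ps γ i) (≡.sym (ℤ.*-zeroʳ (+ (s′ ℕ.* s′ ℕ.^ n))))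
    (subst (0ℤ ℤ.<_) (≡.sym identity) positive))
    where
    X = + s′ * (+ s′ * hv ps (+ s′) (+ M))
    K = mass ps 0 ℕ.* s′ ℕ.^ n
    arith : ∀ s S C H g → s * S * C ≡ s * (s * H) * g + s * (S * C - s * H * (1ℤ * g))
    arith = solve-∀
    identity : + (s′ ℕ.* s′ ℕ.^ n) * comb ps γ i ≡ X * γ i + + s′ * err ps 0
    identity = ≡.trans (cong (_* comb ps γ i) (ℤ.pos-* s′ (s′ ℕ.^ n))) (arith (+ s′) (+ (s′ ℕ.^ n)) (comb ps γ i) (hv ps (+ s′) (+ M)) (γ i))
    γ>0 : 0ℤ ℤ.< γ i
    γ>0 = γ-positive i (subst (i ℕ.≤_) (≡.sym eq) (ℕ.m≤m+n i M))
    +Γ : + Γ ≡ γ i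
    +Γ = ℤ.0≤i⇒+∣i∣≡i (ℤ.<⇒≤ γ>0)
    lower : - (+ K * γ i) ℤ.≤ + s′ * err ps 0
    lower = subst (λ z → - z ℤ.≤ + s′ * err ps 0) (≡.trans (ℤ.pos-* K Γ) (cong (+ K *_) +Γ))
      (neg-abs (+ s′ * err ps 0) (K ℕ.* Γ) (subst (ℕ._≤ K ℕ.* Γ) (≡.sym (ℤ.abs-* (+ s′) (err ps 0))) (err-bound ps 0)))
    strict : + K * γ i ℤ.< X * γ i
    strict = ℤ.*-monoʳ-<-pos (γ i) {{ℤ.positive γ>0}} h
    positive : 0ℤ ℤ.< X * γ i + + s′ * err ps 0
    positive = subst (ℤ._< X * γ i + + s′ * err ps 0) (ℤ.+-inverseʳ (+ K * γ i)) (ℤ.+-mono-<-≤ strict lower)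

mass-lin : ∀ H {n} (as bs : Vec ℤ n) e → mass (lin (+ H) as bs) e ℕ.≤ H ℕ.* mass as e ℕ.+ mass bs e
mass-lin H [] [] e = z≤n
mass-lin H (a ∷ as) (b ∷ bs) e = begin
  abs (+ H * a - b) ℕ.* tri e ℕ.+ mass (lin (+ H) as bs) (suc e)
    ≤⟨ ℕ.+-mono-≤ (ℕ.*-monoˡ-≤ (tri e) (ℤ.∣i-j∣≤∣i∣+∣j∣ (+ H * a) b)) (mass-lin H as bs (suc e)) ⟩
  (abs (+ H * a) ℕ.+ abs b) ℕ.* tri e ℕ.+ (H ℕ.* mass as (suc e) ℕ.+ mass bs (suc e))
    ≡⟨ cong (λ z → (z ℕ.+ abs b) ℕ.* tri e ℕ.+ (H ℕ.* mass as (suc e) ℕ.+ mass bs (suc e))) (ℤ.abs-* (+ H) a) ⟩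
  (H ℕ.* abs a ℕ.+ abs b) ℕ.* tri e ℕ.+ (H ℕ.* mass as (suc e) ℕ.+ mass bs (suc e))
    ≡⟨ arith H (abs a) (abs b) (tri e) (mass as (suc e)) (mass bs (suc e)) ⟩
  H ℕ.* (abs a ℕ.* tri e ℕ.+ mass as (suc e)) ℕ.+ (abs b ℕ.* tri e ℕ.+ mass bs (suc e)) ∎
  where
  open ℕ.≤-Reasoning
  arith : ∀ H a b t x y → (H ℕ.* a ℕ.+ b) ℕ.* t ℕ.+ (H ℕ.* x ℕ.+ y) ≡ H ℕ.* (a ℕ.* t ℕ.+ x) ℕ.+ (b ℕ.* t ℕ.+ y)
  arith = solve-ℕ

-- Abstract, because unfolding these literals would produce unary numerals.
abstract
  massBound : ℕ → ℕ
  -- The numerals are the values of `mass pA 0` and `mass pG 0`.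
  massBound H = H ℕ.* 16135128 ℕ.+ 3836

  mass-p : ∀ H → mass (p (+ H)) 0 ℕ.≤ massBound H
  mass-p H = mass-lin H pA pG 0

  massBound≥2 : ∀ H → 2 ℕ.≤ massBound H
  massBound≥2 H = ℕ.≤-trans (ℕ.m≤m+n 2 3834) (ℕ.m≤n+m 3836 (H ℕ.* 16135128))

-- Values at Y = M/S of h, g and ψ = 5f³ - 3456g, homogenised; the nested products are the forms to
-- which constant coefficients compute. The factor κ = 81(S - M)⁴ - 80(S + M)⁴ carries the four
-- points of the orbit of 1/5 other than 1/5 and 5.
hZ κZ gZ ψZ : ℤ → ℤ → ℤ
hZ S M = S * (S * (S * 1ℤ)) + - + 33 * (S * M * (S + M)) + M * (M * (M * 1ℤ))
κZ S M = + 81 * ((S + - M) * ((S + - M) * ((S + - M) * ((S + - M) * 1ℤ)))) + - + 80 * ((S + M) * ((S + M) * ((S + M) * ((S + M) * 1ℤ))))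
gZ S M = S * M * ((S + - M) * ((S + - M) * ((S + - M) * ((S + - M) * 1ℤ))))
ψZ S M = (S + - + 5 * M) * (+ 5 * S + - M) * κZ S M

-- 5f³ − 3456g vanishes at Y = 1/5, hence on its octahedral orbit.
ψ-factor : ∀ V X → const (+ 5) ⊛ f̂ V X ^ 3 ⊹ const (- + 3456) ⊛ ĝ V X
  ≈ (V ⊹ const (- + 5) ⊛ X) ⊛ (const (+ 5) ⊛ V ⊹ neg X) ⊛ (const (+ 81) ⊛ (V ⊹ neg X) ^ 4 ⊹ const (- + 80) ⊛ (V ⊹ X) ^ 4)
ψ-factor = solve 2 (λ V X → con (+ 5) :* (V :* V :+ (con (+ 14) :* (V :* X) :+ X :* X)) :^ 3 :+ con (- + 3456) :* (V :* X :* ((V :+ :- X) :^ 4))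
  := (V :+ con (- + 5) :* X) :* (con (+ 5) :* V :+ :- X) :* (con (+ 81) :* (V :+ :- X) :^ 4 :+ con (- + 80) :* (V :+ X) :^ 4)) ≈-refl

hv-p : ∀ H S M → hv (p H) S M ≡ hZ S M * (H * ψZ S M - gZ S M)
hv-p H S M = ≡.trans (coeff (hom-lin H pA pG V X) 0) (≡.trans (cong₂ (λ x y → H * x + - y)
    (≡.trans (coeff (pA-factor V X) 0) (cong (hZ S M *_) (coeff (ψ-factor V X) 0))) (coeff (pG-factor V X) 0))
  (arith H (hZ S M) (ψZ S M) (gZ S M)))
  where
  V = const S
  X = const M
  arith : ∀ H h ψ g → H * (h * ψ) + - (h * g) ≡ h * (H * ψ - g)
  arith = solve-∀

-- Certificates for the sign of p

infixl 6 _⊞_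
infixl 7 _⊠_
_⊞_ : ∀ {x y} → 0ℤ ℤ.≤ x → 0ℤ ℤ.≤ y → 0ℤ ℤ.≤ x + y
_⊞_ = ℤ.+-mono-≤

_⊠_ : ∀ {x y} → 0ℤ ℤ.≤ x → 0ℤ ℤ.≤ y → 0ℤ ℤ.≤ x * y
_⊠_ {+ m} {+ n} _ _ = subst (0ℤ ℤ.≤_) (ℤ.pos-* m n) (+≤+ z≤n)

nn : ∀ n → 0ℤ ℤ.≤ + n
nn n = +≤+ z≤n

≤-by : ∀ {x y} d → 0ℤ ℤ.≤ d → y ≡ x + d → x ℤ.≤ y
≤-by {x} d d≥0 refl = subst (ℤ._≤ x + d) (ℤ.+-identityʳ x) (ℤ.+-monoʳ-≤ x d≥0)

≤-diff : ∀ {x y} → x ℤ.≤ y → 0ℤ ℤ.≤ y - x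
≤-diff = ℤ.i≤j⇒0≤j-i

-- The range of Y = M/S below the zero of H(5f³ − 3456g) − g near 1/600.
small-Y : ∀ H S M → 0ℤ ℤ.≤ H → 0ℤ ℤ.≤ M → 0ℤ ℤ.≤ S - + 100 * M → + 96 * (S * S * S * S) ℤ.≤ H * κZ S M →
  S * S * S * (S * S * S) * (S * S * S) ℤ.≤ + 96 * hv (p H) S M
small-Y H S M H≥0 M≥0 r≥0 Hκ = ≤-by (+ 47 * S⁹ + + 48 * d₆) (nn 47 ⊠ (S³≥0 ⊠ S³≥0 ⊠ S³≥0) ⊞ nn 48 ⊠ d₆≥0)
  (begin
    + 96 * hv (p H) S M
      ≡⟨ cong (+ 96 *_) (hv-p H S M) ⟩
    + 96 * (hZ S M * (H * ψZ S M - gZ S M))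
      ≡⟨ arith₁ (hZ S M) (H * ψZ S M - gZ S M) ⟩
    + 48 * (+ 2 * hZ S M * (H * ψZ S M - gZ S M))
      ≡⟨ cong₂ (λ x y → + 48 * (x * y)) (h-eq S M) E-eq ⟩
    + 48 * ((S³ + d₁) * (S⁶ + d₅))
      ≡⟨ cong (+ 48 *_) (arith₂ S³ d₁ d₅) ⟩
    + 48 * (S⁹ + d₆)
      ≡⟨ arith₅ S⁹ d₆ ⟩
    S⁹ + (+ 47 * S⁹ + + 48 * d₆) ∎)
  where
  open ≡-Reasoning
  -- Writing S = 100M + r turns the excess of 2h over S³ and of (S - 5M)(5S - M) over S² into `d₁`
  -- and `d₂`, polynomials in M and r with non-negative coefficients.
  r = S - + 100 * M
  Δ = S - M
  S³ = S * S * S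
  S⁶ = S³ * S³
  S⁹ = S³ * S³ * S³
  d₁ = + 333402 * M * M * M + + 16734 * M * M * r + + 234 * M * r * r + r * r * r
  d₂ = + 37405 * M * M + + 774 * M * r + + 4 * r * r
  -- This is S⁶ - g, found by expanding one factor S⁵ = (Δ + M)⁵ and removing M·Δ⁴.
  d₃ = S * (Δ * Δ * Δ * Δ * Δ + + 4 * M * (Δ * Δ * Δ * Δ) + + 10 * M * M * (Δ * Δ * Δ) + + 10 * M * M * M * (Δ * Δ) + + 5 * M * M * M * M * Δ + M * M * M * M * M)
  d₄ = H * κZ S M - + 96 * (S * S * S * S)
  d₅ = + 94 * S⁶ + (d₃ + S * S * d₄ + d₂ * (+ 96 * (S * S * S * S) + d₄))
  d₆ = S³ * d₅ + d₁ * (S⁶ + d₅)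
  arithS : ∀ S M → S ≡ + 100 * M + (S - + 100 * M)
  arithS = solve-∀
  arithD : ∀ S M → S - M ≡ + 99 * M + (S - + 100 * M)
  arithD = solve-∀
  S≥0 : 0ℤ ℤ.≤ S
  S≥0 = subst (0ℤ ℤ.≤_) (≡.sym (arithS S M)) (nn 100 ⊠ M≥0 ⊞ r≥0)
  Δ≥0 : 0ℤ ℤ.≤ Δ
  Δ≥0 = subst (0ℤ ℤ.≤_) (≡.sym (arithD S M)) (nn 99 ⊠ M≥0 ⊞ r≥0)
  S³≥0 : 0ℤ ℤ.≤ S³
  S³≥0 = S≥0 ⊠ S≥0 ⊠ S≥0
  d₁≥0 : 0ℤ ℤ.≤ d₁
  d₁≥0 = nn 333402 ⊠ M≥0 ⊠ M≥0 ⊠ M≥0 ⊞ nn 16734 ⊠ M≥0 ⊠ M≥0 ⊠ r≥0 ⊞ nn 234 ⊠ M≥0 ⊠ r≥0 ⊠ r≥0 ⊞ r≥0 ⊠ r≥0 ⊠ r≥0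
  d₂≥0 : 0ℤ ℤ.≤ d₂
  d₂≥0 = nn 37405 ⊠ M≥0 ⊠ M≥0 ⊞ nn 774 ⊠ M≥0 ⊠ r≥0 ⊞ nn 4 ⊠ r≥0 ⊠ r≥0
  d₃≥0 : 0ℤ ℤ.≤ d₃
  d₃≥0 = S≥0 ⊠ (Δ≥0 ⊠ Δ≥0 ⊠ Δ≥0 ⊠ Δ≥0 ⊠ Δ≥0 ⊞ nn 4 ⊠ M≥0 ⊠ (Δ≥0 ⊠ Δ≥0 ⊠ Δ≥0 ⊠ Δ≥0) ⊞ nn 10 ⊠ M≥0 ⊠ M≥0 ⊠ (Δ≥0 ⊠ Δ≥0 ⊠ Δ≥0)
    ⊞ nn 10 ⊠ M≥0 ⊠ M≥0 ⊠ M≥0 ⊠ (Δ≥0 ⊠ Δ≥0) ⊞ nn 5 ⊠ M≥0 ⊠ M≥0 ⊠ M≥0 ⊠ M≥0 ⊠ Δ≥0 ⊞ M≥0 ⊠ M≥0 ⊠ M≥0 ⊠ M≥0 ⊠ M≥0)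
  d₄≥0 : 0ℤ ℤ.≤ d₄
  d₄≥0 = ≤-diff Hκ
  d₅≥0 : 0ℤ ℤ.≤ d₅
  d₅≥0 = nn 94 ⊠ (S³≥0 ⊠ S³≥0) ⊞ (d₃≥0 ⊞ S≥0 ⊠ S≥0 ⊠ d₄≥0 ⊞ d₂≥0 ⊠ (nn 96 ⊠ (S≥0 ⊠ S≥0 ⊠ S≥0 ⊠ S≥0) ⊞ d₄≥0))
  d₆≥0 : 0ℤ ℤ.≤ d₆
  d₆≥0 = S³≥0 ⊠ d₅≥0 ⊞ d₁≥0 ⊠ (S³≥0 ⊠ S³≥0 ⊞ d₅≥0)
  arith₁ : ∀ x y → + 96 * (x * y) ≡ + 48 * (+ 2 * x * y)
  arith₁ = solve-∀
  arith₂ : ∀ x d₁ d₅ → (x + d₁) * (x * x + d₅) ≡ x * x * x + (x * d₅ + d₁ * (x * x + d₅))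
  arith₂ = solve-∀
  arith₅ : ∀ x d → + 48 * (x + d) ≡ x + (+ 47 * x + + 48 * d)
  arith₅ = solve-∀
  h-eq : ∀ S M → + 2 * (S * (S * (S * 1ℤ)) + - + 33 * (S * M * (S + M)) + M * (M * (M * 1ℤ)))
    ≡ S * S * S + (+ 333402 * M * M * M + + 16734 * M * M * (S - + 100 * M) + + 234 * M * (S - + 100 * M) * (S - + 100 * M) + (S - + 100 * M) * (S - + 100 * M) * (S - + 100 * M))
  h-eq = solve-∀
  quad : ∀ S M → (S + - + 5 * M) * (+ 5 * S + - M) ≡ S * S + (+ 37405 * M * M + + 774 * M * (S - + 100 * M) + + 4 * (S - + 100 * M) * (S - + 100 * M))
  quad = solve-∀
  g-eq : ∀ S M → S * M * ((S + - M) * ((S + - M) * ((S + - M) * ((S + - M) * 1ℤ)))) ≡ S * S * S * (S * S * S)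
    - S * ((S - M) * (S - M) * (S - M) * (S - M) * (S - M) + + 4 * M * ((S - M) * (S - M) * (S - M) * (S - M)) + + 10 * M * M * ((S - M) * (S - M) * (S - M))
       + + 10 * M * M * M * ((S - M) * (S - M)) + + 5 * M * M * M * M * (S - M) + M * M * M * M * M)
  g-eq = solve-∀
  arith₃ : ∀ H q k g → H * (q * k) - g ≡ q * (H * k) - g
  arith₃ = solve-∀
  arith₄ : ∀ S d₂ y d₃ → (S * S + d₂) * y - (S * S * S * (S * S * S) - d₃)
    ≡ S * S * S * (S * S * S) + (+ 94 * (S * S * S * (S * S * S)) + (d₃ + S * S * (y - + 96 * (S * S * S * S)) + d₂ * (+ 96 * (S * S * S * S) + (y - + 96 * (S * S * S * S)))))
  arith₄ = solve-∀
  E-eq : H * ψZ S M - gZ S M ≡ S⁶ + d₅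
  E-eq = ≡.trans (arith₃ H ((S + - + 5 * M) * (+ 5 * S + - M)) (κZ S M) (gZ S M))
    (≡.trans (cong₂ (λ x y → x * (H * κZ S M) - y) (quad S M) (g-eq S M)) (arith₄ S d₂ (H * κZ S M) d₃))

-- For 1/6 ≤ Y ≤ 1/5 the factors h and 5f³ − 3456g are both non-positive.
large-Y : ∀ H S M → 0ℤ ℤ.≤ H → 0ℤ ℤ.≤ M → 0ℤ ℤ.≤ + 6 * M - S → 0ℤ ℤ.≤ S - + 5 * M →
  S * S * S * (S * S * S) * (S * S * S) ℤ.≤ + 96 * hv (p H) S M
large-Y H S M H≥0 M≥0 a≥0 b≥0 = ≤-by (S³ * d₄ + d₁ * (S⁶ + d₄)) (S³≥0 ⊠ d₄≥0 ⊞ d₁≥0 ⊠ (S³≥0 ⊠ S³≥0 ⊞ d₄≥0))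
  (begin
    + 96 * hv (p H) S M
      ≡⟨ cong (+ 96 *_) (hv-p H S M) ⟩
    + 96 * (hZ S M * (H * ψZ S M - gZ S M))
      ≡⟨ arith₁ (+ 96) (hZ S M) H ((S + - + 5 * M) * (+ 5 * S + - M)) (κZ S M) (gZ S M) ⟩
    - hZ S M * (+ 96 * gZ S M + + 96 * (H * ((S + - + 5 * M) * (+ 5 * S + - M) * - κZ S M)))
      ≡⟨ cong₂ (λ x y → x * (+ 96 * gZ S M + y)) (h-eq S M) (cong₂ (λ x y → + 96 * (H * (x * y))) (lin-eq S M) (κ-eq S M)) ⟩
    (S³ + d₁) * (+ 96 * gZ S M + + 96 * (H * E))
      ≡⟨ cong (λ z → (S³ + d₁) * (z + + 96 * (H * E))) g-eq ⟩
    (S³ + d₁) * (S⁶ + d₃ + + 96 * (H * E))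
      ≡⟨ arith₂ S³ d₁ d₃ (+ 96 * (H * E)) ⟩
    S³ * S³ * S³ + (S³ * d₄ + d₁ * (S⁶ + d₄)) ∎)
  where
  open ≡-Reasoning
  a = + 6 * M - S
  b = S - + 5 * M
  c = S - + 2 * M
  S³ = S * S * S
  S⁶ = S³ * S³
  d₁ = S * S * (+ 21 * M + + 2 * a) + M * M * (+ 164 * M + + 33 * b)
  d₂ = + 82944 * M * M * M * M + + 48384 * M * M * M * b + + 9504 * M * M * b * b + + 623 * M * b * b * b + b * b * b * a
  q = c * (+ 4 * S * S * S + + 6 * S * S * c + + 4 * S * c * c + c * c * c)
  d₃ = S * a * (S * S * S * S) + S * (S + a) * q
  E = b * (+ 4 * S + (+ 4 * M + b)) * d₂
  d₄ = d₃ + + 96 * (H * E)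
  arithS : ∀ S M → S ≡ + 5 * M + (S - + 5 * M)
  arithS = solve-∀
  arithc : ∀ S M → S - + 2 * M ≡ + 3 * M + (S - + 5 * M)
  arithc = solve-∀
  S≥0 : 0ℤ ℤ.≤ S
  S≥0 = subst (0ℤ ℤ.≤_) (≡.sym (arithS S M)) (nn 5 ⊠ M≥0 ⊞ b≥0)
  c≥0 : 0ℤ ℤ.≤ c
  c≥0 = subst (0ℤ ℤ.≤_) (≡.sym (arithc S M)) (nn 3 ⊠ M≥0 ⊞ b≥0)
  S³≥0 : 0ℤ ℤ.≤ S³
  S³≥0 = S≥0 ⊠ S≥0 ⊠ S≥0
  d₁≥0 : 0ℤ ℤ.≤ d₁
  d₁≥0 = S≥0 ⊠ S≥0 ⊠ (nn 21 ⊠ M≥0 ⊞ nn 2 ⊠ a≥0) ⊞ M≥0 ⊠ M≥0 ⊠ (nn 164 ⊠ M≥0 ⊞ nn 33 ⊠ b≥0)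
  d₂≥0 : 0ℤ ℤ.≤ d₂
  d₂≥0 = nn 82944 ⊠ M≥0 ⊠ M≥0 ⊠ M≥0 ⊠ M≥0 ⊞ nn 48384 ⊠ M≥0 ⊠ M≥0 ⊠ M≥0 ⊠ b≥0 ⊞ nn 9504 ⊠ M≥0 ⊠ M≥0 ⊠ b≥0 ⊠ b≥0 ⊞ nn 623 ⊠ M≥0 ⊠ b≥0 ⊠ b≥0 ⊠ b≥0 ⊞ b≥0 ⊠ b≥0 ⊠ b≥0 ⊠ a≥0
  q≥0 : 0ℤ ℤ.≤ q
  q≥0 = c≥0 ⊠ (nn 4 ⊠ S≥0 ⊠ S≥0 ⊠ S≥0 ⊞ nn 6 ⊠ S≥0 ⊠ S≥0 ⊠ c≥0 ⊞ nn 4 ⊠ S≥0 ⊠ c≥0 ⊠ c≥0 ⊞ c≥0 ⊠ c≥0 ⊠ c≥0)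
  d₄≥0 : 0ℤ ℤ.≤ d₄
  d₄≥0 = S≥0 ⊠ a≥0 ⊠ (S≥0 ⊠ S≥0 ⊠ S≥0 ⊠ S≥0) ⊞ S≥0 ⊠ (S≥0 ⊞ a≥0) ⊠ q≥0
    ⊞ nn 96 ⊠ (H≥0 ⊠ (b≥0 ⊠ (nn 4 ⊠ S≥0 ⊞ (nn 4 ⊠ M≥0 ⊞ b≥0)) ⊠ d₂≥0))
  arith₁ : ∀ c h H q k g → c * (h * (H * (q * k) - g)) ≡ - h * (c * g + c * (H * (q * - k)))
  arith₁ = solve-∀
  arith₂ : ∀ x d y z → (x + d) * (x * x + y + z) ≡ x * x * x + (x * (y + z) + d * (x * x + (y + z)))
  arith₂ = solve-∀
  lin-eq : ∀ S M → (S + - + 5 * M) * (+ 5 * S + - M) ≡ (S - + 5 * M) * (+ 4 * S + (+ 4 * M + (S - + 5 * M)))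
  lin-eq = solve-∀
  h-eq : ∀ S M → - (S * (S * (S * 1ℤ)) + - + 33 * (S * M * (S + M)) + M * (M * (M * 1ℤ)))
    ≡ S * S * S + (S * S * (+ 21 * M + + 2 * (+ 6 * M - S)) + M * M * (+ 164 * M + + 33 * (S - + 5 * M)))
  h-eq = solve-∀
  κ-eq : ∀ S M → - (+ 81 * ((S + - M) * ((S + - M) * ((S + - M) * ((S + - M) * 1ℤ)))) + - + 80 * ((S + M) * ((S + M) * ((S + M) * ((S + M) * 1ℤ)))))
    ≡ + 82944 * M * M * M * M + + 48384 * M * M * M * (S - + 5 * M) + + 9504 * M * M * (S - + 5 * M) * (S - + 5 * M)
      + + 623 * M * (S - + 5 * M) * (S - + 5 * M) * (S - + 5 * M) + (S - + 5 * M) * (S - + 5 * M) * (S - + 5 * M) * (+ 6 * M - S)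
  κ-eq = solve-∀
  quartic : ∀ S c → (S + c) * (S + c) * ((S + c) * (S + c)) ≡ S * S * S * S + c * (+ 4 * S * S * S + + 6 * S * S * c + + 4 * S * c * c + c * c * c)
  quartic = solve-∀
  arith₄ : ∀ t f S M Δ → t * (f * f * f * f) * (S * M * (Δ * (Δ * (Δ * (Δ * 1ℤ))))) ≡ S * (t * M) * (f * Δ * (f * Δ) * (f * Δ * (f * Δ)))
  arith₄ = solve-∀
  arith₅ : ∀ S M → + 6 * M ≡ S + (+ 6 * M - S)
  arith₅ = solve-∀
  arith₆ : ∀ S M → + 2 * (S + - M) ≡ S + (S - + 2 * M)
  arith₆ = solve-∀
  arith₇ : ∀ S a x → S * (S + a) * (S * S * S * S + x) ≡ S * S * S * (S * S * S) + (S * a * (S * S * S * S) + S * (S + a) * x)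
  arith₇ = solve-∀
  -- The constant is 96 = 6·2⁴: the factor 6 raises M to 6M ≥ S, and each factor 2 raises S - M to
  -- 2(S - M) ≥ S. Hence 96g ≥ S⁶.
  g-eq : + 96 * gZ S M ≡ S⁶ + d₃
  g-eq = begin
    + 96 * gZ S M
      ≡⟨ arith₄ (+ 6) (+ 2) S M (S + - M) ⟩
    S * (+ 6 * M) * (+ 2 * (S + - M) * (+ 2 * (S + - M)) * (+ 2 * (S + - M) * (+ 2 * (S + - M))))
      ≡⟨ cong₂ (λ x y → S * x * (y * y * (y * y))) (arith₅ S M) (arith₆ S M) ⟩
    S * (S + a) * ((S + c) * (S + c) * ((S + c) * (S + c)))
      ≡⟨ cong (S * (S + a) *_) (quartic S c) ⟩
    S * (S + a) * (S * S * S * S + q)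
      ≡⟨ arith₇ S a q ⟩
    S⁶ + d₃ ∎

positive-cancelˡ : ∀ {x y} → 0ℤ ℤ.≤ x → 0ℤ ℤ.< x * y → 0ℤ ℤ.< y
positive-cancelˡ {+ n} {y} _ h = ℤ.*-cancelˡ-<-nonNeg (+ n) (subst (ℤ._< + n * y) (≡.sym (ℤ.*-zeroʳ (+ n))) h)

-- In B⁴ - 5A⁴ the leading terms combine to 4⁴E⁴κ. The cross term from 3y, the share of ε in A,
-- costs 4³E³·480z³y, so the hypothesis yields Eκ > 120z³y. Without that share κ would only be
-- positive, which is not enough to dominate g.
κ-lower : ∀ E S M → 0ℤ ℤ.≤ E → 0ℤ ℤ.≤ M → 0ℤ ℤ.≤ S - + 5 * M →
  (let y = S + - M ; z = S + M ; A = + 8 * E * z + + 3 * y ; B = + 12 * E * y in + 5 * (A * A * (A * A)) ℤ.< B * B * (B * B)) →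
  0ℤ ℤ.≤ S - + 100 * M × + 96 * (S * S * S * S) ℤ.≤ E * κZ S M
κ-lower E S M E≥0 M≥0 b≥0 hyp = S≥100M , 96S⁴≤Eκ
  where
  y = S + - M
  z = S + M
  b = S - + 5 * M
  A = + 8 * E * z + + 3 * y
  B = + 12 * E * y
  p₁ = + 8 * E * z
  p₂ = + 3 * y
  rest = p₂ * p₂ * (+ 6 * (p₁ * p₁) + + 4 * (p₁ * p₂) + p₂ * p₂)
  X = + 4 * (E * κZ S M) - + 480 * (z * z * z * y)
  arithS : ∀ S M → S ≡ + 5 * M + (S - + 5 * M)
  arithS = solve-∀
  arithy : ∀ S M → S + - M ≡ + 4 * M + (S - + 5 * M)
  arithy = solve-∀
  S≥0 : 0ℤ ℤ.≤ S
  S≥0 = subst (0ℤ ℤ.≤_) (≡.sym (arithS S M)) (nn 5 ⊠ M≥0 ⊞ b≥0)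
  y≥0 : 0ℤ ℤ.≤ y
  y≥0 = subst (0ℤ ℤ.≤_) (≡.sym (arithy S M)) (nn 4 ⊠ M≥0 ⊞ b≥0)
  z≥0 : 0ℤ ℤ.≤ z
  z≥0 = S≥0 ⊞ M≥0
  p₁≥0 : 0ℤ ℤ.≤ p₁
  p₁≥0 = nn 8 ⊠ E≥0 ⊠ z≥0
  p₂≥0 : 0ℤ ℤ.≤ p₂
  p₂≥0 = nn 3 ⊠ y≥0
  rest≥0 : 0ℤ ℤ.≤ rest
  rest≥0 = p₂≥0 ⊠ p₂≥0 ⊠ (nn 6 ⊠ (p₁≥0 ⊠ p₁≥0) ⊞ nn 4 ⊠ (p₁≥0 ⊠ p₂≥0) ⊞ p₂≥0 ⊠ p₂≥0)
  binomial : ∀ p q → (p + q) * (p + q) * ((p + q) * (p + q)) ≡ p * p * (p * p) + + 4 * (p * p * p * q) + q * q * (+ 6 * (p * p) + + 4 * (p * q) + q * q)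
  binomial = solve-∀
  -- With k, a, d, f = 4, 3, 2, 5 the numerals of A and B are 8 = k·d and 12 = k·a; the coefficients
  -- of κ then appear as a⁴ = 81 and f·d⁴ = 80.
  collect : ∀ k a d f E y z r → k * a * E * y * (k * a * E * y) * (k * a * E * y * (k * a * E * y))
      - f * (k * d * E * z * (k * d * E * z) * (k * d * E * z * (k * d * E * z)) + + 4 * (k * d * E * z * (k * d * E * z) * (k * d * E * z) * (a * y)) + r)
    ≡ k * E * (k * E) * (k * E) * (k * (E * (a * a * (a * a) * (y * (y * (y * (y * 1ℤ)))) + - (f * (d * d * (d * d))) * (z * (z * (z * (z * 1ℤ)))))) - + 4 * f * (d * d * d) * a * (z * z * z * y)) - f * r
  collect = solve-∀
  12≡ : + 12 ≡ + 4 * + 3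
  12≡ = refl
  8≡ : + 8 ≡ + 4 * + 2
  8≡ = refl
  81≡ : + 3 * + 3 * (+ 3 * + 3) ≡ + 81
  81≡ = refl
  -80≡ : - (+ 5 * (+ 2 * + 2 * (+ 2 * + 2))) ≡ - + 80
  -80≡ = refl
  480≡ : + 4 * + 5 * (+ 2 * + 2 * + 2) * + 3 ≡ + 480
  480≡ = refl
  y⁴ = y * (y * (y * (y * 1ℤ)))
  z⁴ = z * (z * (z * (z * 1ℤ)))
  K³ = + 4 * E * (+ 4 * E) * (+ 4 * E)
  identity : K³ * X ≡ B * B * (B * B) - + 5 * (A * A * (A * A)) + + 5 * rest
  identity = ≡.sym (begin
    B * B * (B * B) - + 5 * (A * A * (A * A)) + + 5 * rest
      ≡⟨ cong (λ t → B * B * (B * B) - + 5 * t + + 5 * rest) (binomial p₁ p₂) ⟩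
    B * B * (B * B) - + 5 * (p₁ * p₁ * (p₁ * p₁) + + 4 * (p₁ * p₁ * p₁ * p₂) + rest) + + 5 * rest
      ≡⟨ cong₂ (λ c d → c * E * y * (c * E * y) * (c * E * y * (c * E * y))
           - + 5 * (d * E * z * (d * E * z) * (d * E * z * (d * E * z)) + + 4 * (d * E * z * (d * E * z) * (d * E * z) * (+ 3 * y)) + rest) + + 5 * rest) {x = + 12} {y = + 4 * + 3} {u = + 8} {v = + 4 * + 2} 12≡ 8≡ ⟩
    _
      ≡⟨ +-left (+ 5 * rest) (collect (+ 4) (+ 3) (+ 2) (+ 5) E y z rest) ⟩
    _
      ≡⟨ cong₂ (λ c d → K³ * (+ 4 * (E * (c * y⁴ + - (+ 5 * (+ 2 * + 2 * (+ 2 * + 2))) * z⁴)) - d * (z * z * z * y)) - + 5 * rest + + 5 * rest)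
           {x = + 3 * + 3 * (+ 3 * + 3)} {y = + 81} {u = + 4 * + 5 * (+ 2 * + 2 * + 2) * + 3} {v = + 480} 81≡ 480≡ ⟩
    K³ * (+ 4 * (E * (+ 81 * y⁴ + - (+ 5 * (+ 2 * + 2 * (+ 2 * + 2))) * z⁴)) - + 480 * (z * z * z * y)) - + 5 * rest + + 5 * rest
      ≡⟨ cong (λ c → K³ * (+ 4 * (E * (+ 81 * y⁴ + c * z⁴)) - + 480 * (z * z * z * y)) - + 5 * rest + + 5 * rest) {x = - (+ 5 * (+ 2 * + 2 * (+ 2 * + 2)))} {y = - + 80} -80≡ ⟩
    K³ * X - + 5 * rest + + 5 * rest
      ≡⟨ cancel (K³ * X) (+ 5 * rest) ⟩
    K³ * X ∎)
    where
    open ≡-Reasoning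
    cancel : ∀ x r → x - r + r ≡ x
    cancel = solve-∀
  X>0 : 0ℤ ℤ.< X
  X>0 = positive-cancelˡ (nn 4 ⊠ E≥0 ⊠ (nn 4 ⊠ E≥0) ⊠ (nn 4 ⊠ E≥0)) (subst (0ℤ ℤ.<_) (≡.sym identity)
    (ℤ.+-mono-<-≤ (subst (ℤ._< B * B * (B * B) - + 5 * (A * A * (A * A))) (ℤ.+-inverseʳ (+ 5 * (A * A * (A * A)))) (ℤ.+-monoˡ-< (- (+ 5 * (A * A * (A * A)))) hyp)) (nn 5 ⊠ rest≥0)))
  -- 120 z³ y ≥ 96 S⁴ because z ≥ S and 5y ≥ 4S.
  split : ∀ S M κ → κ ≡ + 96 * (S * S * S * S) + ((κ - + 120 * ((S + M) * (S + M) * (S + M) * (S + - M)))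
    + + 24 * ((S + M) * (S + M) * (S + M) * (S - + 5 * M) + + 4 * S * M * (+ 3 * S * S + + 3 * S * M + M * M)))
  split = solve-∀
  quarter : ∀ x y → + 4 * x - + 480 * y ≡ + 4 * (x - + 120 * y)
  quarter = solve-∀
  Eκ>120z³y : 0ℤ ℤ.< E * κZ S M - + 120 * (z * z * z * y)
  Eκ>120z³y = positive-cancelˡ (nn 4) (subst (0ℤ ℤ.<_) (quarter (E * κZ S M) (z * z * z * y)) X>0)
  96S⁴≤Eκ : + 96 * (S * S * S * S) ℤ.≤ E * κZ S M
  96S⁴≤Eκ = ≤-by _ (ℤ.<⇒≤ Eκ>120z³y ⊞ nn 24 ⊠ (z≥0 ⊠ z≥0 ⊠ z≥0 ⊠ b≥0 ⊞ nn 4 ⊠ S≥0 ⊠ M≥0 ⊠ (nn 3 ⊠ S≥0 ⊠ S≥0 ⊞ nn 3 ⊠ S≥0 ⊠ M≥0 ⊞ M≥0 ⊠ M≥0))) (split S M (E * κZ S M))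
  κ>0 : 0ℤ ℤ.< κZ S M
  κ>0 = positive-cancelˡ E≥0 (subst (0ℤ ℤ.<_) (cancel (E * κZ S M) (+ 120 * (z * z * z * y))) (ℤ.+-mono-<-≤ Eκ>120z³y (nn 120 ⊠ (z≥0 ⊠ z≥0 ⊠ z≥0 ⊠ y≥0))))
    where
    cancel : ∀ x r → x - r + r ≡ x
    cancel = solve-∀
  -- Used with f = 80 and z = y + 2M: from κ > 0 follows y⁴ > 80(z⁴ - y⁴) ≥ 640My³, hence y > 640M,
  -- more than `small-Y` asks for.
  κ-upper : ∀ f y M → (f + 1ℤ) * (y * (y * (y * (y * 1ℤ)))) + - f * ((y + + 2 * M) * ((y + + 2 * M) * ((y + + 2 * M) * ((y + + 2 * M) * 1ℤ))))
      + f * (M * M * (+ 24 * y * y + + 32 * M * y + + 16 * M * M)) ≡ y * y * y * (y - + 8 * f * M)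
  κ-upper = solve-∀
  z≡ : ∀ S M → S + - M + + 2 * M ≡ S + M
  z≡ = solve-∀
  S≥100M : 0ℤ ℤ.≤ S - + 100 * M
  S≥100M = subst (0ℤ ℤ.≤_) (arith S M) (ℤ.<⇒≤ y>640M ⊞ nn 541 ⊠ M≥0)
    where
    arith : ∀ S M → S + - M - + 640 * M + + 541 * M ≡ S - + 100 * M
    arith = solve-∀
    81≡′ : + 81 ≡ + 80 + 1ℤ
    81≡′ = refl
    640≡ : + 8 * + 80 ≡ + 640
    640≡ = refl
    rest′ = + 80 * (M * M * (+ 24 * y * y + + 32 * M * y + + 16 * M * M))
    z′ = y + + 2 * M
    upper : + 81 * y⁴ + - + 80 * (z′ * (z′ * (z′ * (z′ * 1ℤ)))) + rest′ ≡ y * y * y * (y - + 640 * M)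
    upper = ≡.trans (cong (λ c → c * y⁴ + - + 80 * (z′ * (z′ * (z′ * (z′ * 1ℤ)))) + rest′) {x = + 81} {y = + 80 + 1ℤ} 81≡′)
      (≡.trans (κ-upper (+ 80) y M) (cong (λ c → y * y * y * (y - c * M)) {x = + 8 * + 80} {y = + 640} 640≡))
    y>640M : 0ℤ ℤ.< y - + 640 * M
    y>640M = positive-cancelˡ (y≥0 ⊠ y≥0 ⊠ y≥0) (subst (0ℤ ℤ.<_) upper
      (ℤ.+-mono-<-≤ (subst (λ t → 0ℤ ℤ.< + 81 * (y * (y * (y * (y * 1ℤ)))) + - + 80 * (t * (t * (t * (t * 1ℤ))))) (≡.sym (z≡ S M)) κ>0)
        (nn 80 ⊠ (M≥0 ⊠ M≥0 ⊠ (nn 24 ⊠ y≥0 ⊠ y≥0 ⊞ nn 32 ⊠ M≥0 ⊠ y≥0 ⊞ nn 16 ⊠ M≥0 ⊠ M≥0)))))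

-- If h is at least n⁹/96, the main term n²h has order n¹¹ against an error of K·n¹⁰, so n > 96K
-- decides the comparison.
ninth-power : ∀ K n h → 96 ℕ.* K ℕ.< n → + n * + n * + n * (+ n * + n * + n) * (+ n * + n * + n) ℤ.≤ + 96 * h →
  + (K ℕ.* n ℕ.^ 10) ℤ.< + n * (+ n * h)
ninth-power K n h K<n n⁹≤ = ℤ.*-cancelˡ-<-nonNeg (+ 96) (begin-strict
  + 96 * + (K ℕ.* n ℕ.^ 10)
    ≡⟨ ℤ.pos-* 96 (K ℕ.* n ℕ.^ 10) ⟨
  + (96 ℕ.* (K ℕ.* n ℕ.^ 10))
    ≡⟨ cong +_ (ℕ.*-assoc 96 K (n ℕ.^ 10)) ⟨
  + (96 ℕ.* K ℕ.* n ℕ.^ 10)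
    <⟨ +<+ (ℕ.*-monoˡ-< (n ℕ.^ 10) {{ℕ.m^n≢0 n 10 {{ℕ.>-nonZero (ℕ.≤-trans (s≤s z≤n) K<n)}}}} K<n) ⟩
  + (n ℕ.^ 11)
    ≡⟨ const-^ n 11 ⟨
  (const (+ n) ^ 11) 0
    ≡⟨ powers (+ n) ⟩
  + n * (+ n * (+ n * + n * + n * (+ n * + n * + n) * (+ n * + n * + n)))
    ≤⟨ ℤ.*-monoˡ-≤-nonNeg (+ n) (ℤ.*-monoˡ-≤-nonNeg (+ n) n⁹≤) ⟩
  + n * (+ n * (+ 96 * h))
    ≡⟨ swap (+ n) h ⟩
  + 96 * (+ n * (+ n * h)) ∎)
  where
  open ℤ.≤-Reasoning
  powers : ∀ S → S * (S * (S * (S * (S * (S * (S * (S * (S * (S * (S * 1ℤ)))))))))) ≡ S * (S * (S * S * S * (S * S * S) * (S * S * S)))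
  powers = solve-∀
  swap : ∀ S h → S * (S * (+ 96 * h)) ≡ + 96 * (S * (S * h))
  swap = solve-∀

module _ (l H i M : ℕ) (eq : l ≡ i ℕ.+ M) (large : 96 ℕ.* massBound H ℕ.< l ℕ.* 4) where
  open Gamma l
  open Deviation l i M eq

  private
    S = + s′

  positive-of-ninth-power : S * S * S * (S * S * S) * (S * S * S) ℤ.≤ + 96 * hv (p (+ H)) S (+ M) → 0ℤ ℤ.< comb (p (+ H)) γ i
  positive-of-ninth-power h = comb-positive (p (+ H)) (ninth-power (mass (p (+ H)) 0) s′ (hv (p (+ H)) S (+ M))
    (ℕ.≤-<-trans (ℕ.*-monoʳ-≤ 96 (mass-p H)) (ℕ.<-≤-trans large (ℕ.m≤n+m m M))) h)

  private
    lℤ : + l ≡ + i + + M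
    lℤ = ≡.trans (cong +_ eq) (ℤ.pos-+ i M)

    S≡ : S ≡ + M + (+ i + + M) * + 4
    S≡ = ≡.trans (ℤ.pos-+ M m) (+-right (+ M) (≡.trans (ℤ.pos-* l 4) (cong (_* + 4) lℤ)))

    b≡ : S - + 5 * + M ≡ + 4 * + i
    b≡ = ≡.trans (cong (_- + 5 * + M) S≡) (arith (+ i) (+ M))
      where
      arith : ∀ i M → M + (i + M) * + 4 - + 5 * M ≡ + 4 * i
      arith = solve-∀

    b≥0 : 0ℤ ℤ.≤ S - + 5 * + M
    b≥0 = subst (0ℤ ℤ.≤_) (≡.sym b≡) (nn 4 ⊠ nn i)

  -- Since S = 5M + 4i, the condition 4i ≤ M says Y ≥ 1/6, while Y ≤ 1/5 is automatic.
  comb-positive-large : 4 ℕ.* i ℕ.≤ M → 0ℤ ℤ.< comb (p (+ H)) γ i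
  comb-positive-large 4i≤M = positive-of-ninth-power (large-Y (+ H) S (+ M) (nn H) (nn M)
    (subst (0ℤ ℤ.≤_) (≡.sym (≡.trans (cong (λ z → + 6 * + M - z) S≡) (arith (+ i) (+ M)))) (≤-diff (subst (ℤ._≤ + M) (ℤ.pos-* 4 i) (+≤+ 4i≤M)))) b≥0)
    where
    arith : ∀ i M → + 6 * M - (M + (i + M) * + 4) ≡ M - + 4 * i
    arith = solve-∀

  comb-positive-small :
    (let y = l ℕ.* 4 ; z = 2 ℕ.* M ℕ.+ l ℕ.* 4 ; A = 8 ℕ.* H ℕ.* z ℕ.+ 3 ℕ.* y ; B = 12 ℕ.* H ℕ.* y in 5 ℕ.* (A ℕ.* A ℕ.* (A ℕ.* A)) ℕ.< B ℕ.* B ℕ.* (B ℕ.* B)) →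
    0ℤ ℤ.< comb (p (+ H)) γ i
  comb-positive-small hyp = positive-of-ninth-power (small-Y (+ H) S (+ M) (nn H) (nn M) (proj₁ bounds) (proj₂ bounds))
    where
    y z A B : ℕ
    y = l ℕ.* 4
    z = 2 ℕ.* M ℕ.+ l ℕ.* 4
    A = 8 ℕ.* H ℕ.* z ℕ.+ 3 ℕ.* y
    B = 12 ℕ.* H ℕ.* y
    y≡ : + y ≡ S + - + M
    y≡ = ≡.sym (≡.trans (cong (_- + M) (ℤ.pos-+ M m)) (arith (+ M) (+ m)))
      where
      arith : ∀ x y → x + y - x ≡ y
      arith = solve-∀
    z≡ : + z ≡ S + + M
    z≡ = ≡.trans (≡.trans (ℤ.pos-+ (2 ℕ.* M) m) (+-left (+ m) (ℤ.pos-* 2 M))) (≡.sym (≡.trans (+-left (+ M) (ℤ.pos-+ M m)) (arith (+ M) (+ m))))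
      where
      arith : ∀ x y → x + y + x ≡ + 2 * x + y
      arith = solve-∀
    A≡ : + A ≡ + 8 * + H * (S + + M) + + 3 * (S + - + M)
    A≡ = ≡.trans (ℤ.pos-+ (8 ℕ.* H ℕ.* z) (3 ℕ.* y)) (cong₂ _+_
      (≡.trans (ℤ.pos-* (8 ℕ.* H) z) (cong₂ _*_ (ℤ.pos-* 8 H) z≡)) (≡.trans (ℤ.pos-* 3 y) (cong (+ 3 *_) y≡)))
    B≡ : + B ≡ + 12 * + H * (S + - + M)
    B≡ = ≡.trans (ℤ.pos-* (12 ℕ.* H) y) (cong₂ _*_ (ℤ.pos-* 12 H) y≡)
    q≡ : ∀ a → + (a ℕ.* a ℕ.* (a ℕ.* a)) ≡ + a * + a * (+ a * + a)
    q≡ a = ≡.trans (ℤ.pos-* (a ℕ.* a) (a ℕ.* a)) (cong₂ _*_ (ℤ.pos-* a a) (ℤ.pos-* a a))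
    bounds : 0ℤ ℤ.≤ S - + 100 * + M × + 96 * (S * S * S * S) ℤ.≤ + H * κZ S (+ M)
    bounds = κ-lower (+ H) S (+ M) (nn H) (nn M) b≥0
      (≡.subst₂ ℤ._<_ (≡.trans (ℤ.pos-* 5 (A ℕ.* A ℕ.* (A ℕ.* A))) (cong (+ 5 *_) (≡.trans (q≡ A) (cong (λ a → a * a * (a * a)) A≡))))
        (≡.trans (q≡ B) (cong (λ a → a * a * (a * a)) B≡)) (+<+ hyp))

-- Character sums over a self-dual code

∑V : ∀ {k} n → (Vec (Fin k) n → ℤ) → ℤ
∑V zero    f = f []
∑V (suc n) f = ∑ λ a → ∑V n λ x → f (a ∷ x)

∑V-cong : ∀ {k} n {f g : Vec (Fin k) n → ℤ} → (∀ x → f x ≡ g x) → ∑V n f ≡ ∑V n g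
∑V-cong zero    p = p []
∑V-cong (suc n) p = ∑-cong λ a → ∑V-cong n λ x → p (a ∷ x)

*-∑V : ∀ {k} n c (f : Vec (Fin k) n → ℤ) → c * ∑V n f ≡ ∑V n λ x → c * f x
*-∑V zero    c f = refl
*-∑V (suc n) c f = ≡.trans (*-∑ c λ a → ∑V n λ x → f (a ∷ x)) (∑-cong λ a → *-∑V n c λ x → f (a ∷ x))

∑-nonNeg : ∀ k (f : Fin k → ℤ) → (∀ a → 0ℤ ℤ.≤ f a) → 0ℤ ℤ.≤ ∑ f
∑-nonNeg zero    f h = ℤ.≤-refl
∑-nonNeg (suc k) f h = h zero ⊞ ∑-nonNeg k (f ∘ suc) (h ∘ suc)

∑-positive : ∀ k (f : Fin k → ℤ) → (∀ a → 0ℤ ℤ.≤ f a) → ∀ a → 0ℤ ℤ.< f a → 0ℤ ℤ.< ∑ f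
∑-positive (suc k) f h zero    p = ℤ.+-mono-<-≤ p (∑-nonNeg k (f ∘ suc) (h ∘ suc))
∑-positive (suc k) f h (suc a) p = ℤ.+-mono-≤-< (h zero) (∑-positive k (f ∘ suc) (h ∘ suc) a p)

∑V-nonNeg : ∀ {k} n (f : Vec (Fin k) n → ℤ) → (∀ x → 0ℤ ℤ.≤ f x) → 0ℤ ℤ.≤ ∑V n f
∑V-nonNeg zero    f h = h []
∑V-nonNeg (suc n) f h = ∑-nonNeg _ _ λ a → ∑V-nonNeg n _ λ x → h (a ∷ x)

∑V-positive : ∀ {k} n (f : Vec (Fin k) n → ℤ) → (∀ x → 0ℤ ℤ.≤ f x) → ∀ x → 0ℤ ℤ.< f x → 0ℤ ℤ.< ∑V n f
∑V-positive zero    f h []      p = p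
∑V-positive (suc n) f h (a ∷ x) p = ∑-positive _ _ (λ b → ∑V-nonNeg n _ λ y → h (b ∷ y)) a (∑V-positive n _ (λ y → h (a ∷ y)) x p)

∑-∑V-swap : ∀ {j k} n (f : Fin j → Vec (Fin k) n → ℤ) → (∑ λ a → ∑V n (f a)) ≡ ∑V n λ x → ∑ λ a → f a x
∑-∑V-swap zero    f = refl
∑-∑V-swap (suc n) f = ≡.trans (∑-swap λ a b → ∑V n λ x → f a (b ∷ x)) (∑-cong λ b → ∑-∑V-swap n λ a x → f a (b ∷ x))

∑V-swap : ∀ {j k} m n (f : Vec (Fin j) m → Vec (Fin k) n → ℤ) → (∑V m λ x → ∑V n (f x)) ≡ ∑V n λ y → ∑V m λ x → f x y
∑V-swap zero    n f = refl
∑V-swap (suc m) n f = ≡.trans (∑-cong λ a → ∑V-swap m n λ x → f (a ∷ x)) (∑-∑V-swap n λ a y → ∑V m λ x → f (a ∷ x) y)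

∑V-translate : ∀ {n} (f : Vec Z4 n → ℤ) (y : Vec Z4 n) → (∑V n λ x → f (x ⊕ y)) ≡ ∑V n f
∑V-translate {zero}  f []      = refl
∑V-translate {suc n} f (b ∷ y) = ≡.trans (∑-cong λ a → ∑V-translate (λ x → f ((a +₄ b) ∷ x)) y) (rotate (λ a → ∑V n λ x → f (a ∷ x)) b)
  where
  rotate : ∀ (g : Z4 → ℤ) b → (∑ λ a → g (a +₄ b)) ≡ ∑ g
  rotate g zero                   = refl
  rotate g (suc zero)             = arith (g zero) (g (suc zero)) (g (suc (suc zero))) (g (suc (suc (suc zero))))
    where
    arith : ∀ x y z t → y + (z + (t + (x + 0ℤ))) ≡ x + (y + (z + (t + 0ℤ)))
    arith = solve-∀
  rotate g (suc (suc zero))       = arith (g zero) (g (suc zero)) (g (suc (suc zero))) (g (suc (suc (suc zero))))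
    where
    arith : ∀ x y z t → z + (t + (x + (y + 0ℤ))) ≡ x + (y + (z + (t + 0ℤ)))
    arith = solve-∀
  rotate g (suc (suc (suc zero))) = arith (g zero) (g (suc zero)) (g (suc (suc zero))) (g (suc (suc (suc zero))))
    where
    arith : ∀ x y z t → t + (x + (y + (z + 0ℤ))) ≡ x + (y + (z + (t + 0ℤ)))
    arith = solve-∀

-- Binary characters of Z4 vectors

F₂ : Set
F₂ = Fin 2

res : Z4 → F₂
res 0F = 0F
res 1F = 1F
res 2F = 0F
res 3F = 1F

flip : F₂ → F₂
flip 0F = 1F
flip 1F = 0F

dbl : F₂ → Z4
dbl 0F = 0F
dbl 1F = 2F

ones : ∀ {n} → Vec F₂ n → ℕ
ones []       = 0
ones (c ∷ cs) = toℕ c ℕ.+ ones cs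

sgn : F₂ → ℤ
sgn 0F = 1ℤ
sgn 1F = - 1ℤ

χ₁ : F₂ → Z4 → ℤ
χ₁ 0F a = 1ℤ
χ₁ 1F a = sgn (res a)

χ : ∀ {n} → Vec F₂ n → Vec Z4 n → ℤ
χ []       []       = 1ℤ
χ (c ∷ cs) (a ∷ as) = χ₁ c a * χ cs as

χ₁-⊕ : ∀ c a b → χ₁ c (a +₄ b) ≡ χ₁ c a * χ₁ c b
χ₁-⊕ 0F a b = refl
χ₁-⊕ 1F 0F 0F = refl
χ₁-⊕ 1F 0F 1F = refl
χ₁-⊕ 1F 0F 2F = refl
χ₁-⊕ 1F 0F 3F = refl
χ₁-⊕ 1F 1F 0F = refl
χ₁-⊕ 1F 1F 1F = refl
χ₁-⊕ 1F 1F 2F = refl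
χ₁-⊕ 1F 1F 3F = refl
χ₁-⊕ 1F 2F 0F = refl
χ₁-⊕ 1F 2F 1F = refl
χ₁-⊕ 1F 2F 2F = refl
χ₁-⊕ 1F 2F 3F = refl
χ₁-⊕ 1F 3F 0F = refl
χ₁-⊕ 1F 3F 1F = refl
χ₁-⊕ 1F 3F 2F = refl
χ₁-⊕ 1F 3F 3F = refl

χ-⊕ : ∀ {n} (c : Vec F₂ n) a b → χ c (a ⊕ b) ≡ χ c a * χ c b
χ-⊕ []       []       []       = refl
χ-⊕ (c ∷ cs) (a ∷ as) (b ∷ bs) = ≡.trans (cong₂ _*_ (χ₁-⊕ c a b) (χ-⊕ cs as bs)) (arith (χ₁ c a) (χ₁ c b) (χ cs as) (χ cs bs))
  where
  arith : ∀ x y z t → x * y * (z * t) ≡ x * z * (y * t)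
  arith = solve-∀

-- The sum factors into one 1 + w or 1 - w per coordinate. Quantifying over `Ω` lets a coordinate
-- with c = 1 hand its factor w to the induction hypothesis as `w ⊛ Ω`.
fourier : ∀ {n} (Ω : Series) m (x : Vec Z4 n) →
  (∑V n λ c → χ c x * (w ^ ones c ⊛ Ω) m) ≡ (u ^ ones (map res x) ⊛ v ^ ones (map (flip ∘ res) x) ⊛ Ω) m
fourier {zero} Ω m [] = ≡.trans (ℤ.*-identityˡ _) (coeff (solve 1 (λ X → con 1ℤ :* X := con 1ℤ :* con 1ℤ :* X) ≈-refl Ω) m)
fourier {suc n} Ω m (a ∷ x) = begin
  (∑V n λ c → 1ℤ * χ c x * (w ^ ones c ⊛ Ω) m) + ((∑V n λ c → sgn (res a) * χ c x * (w ^ suc (ones c) ⊛ Ω) m) + 0ℤ)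
    ≡⟨ cong₂ (λ y z → y + (z + 0ℤ)) (∑V-cong n λ c → cong (_* (w ^ ones c ⊛ Ω) m) (ℤ.*-identityˡ (χ c x)))
         (≡.trans (∑V-cong n λ c → ≡.trans (ℤ.*-assoc (sgn (res a)) (χ c x) _) (cong (λ z → sgn (res a) * (χ c x * z)) (shift c))) (≡.sym (*-∑V n (sgn (res a)) _))) ⟩
  (∑V n λ c → χ c x * (w ^ ones c ⊛ Ω) m) + (sgn (res a) * (∑V n λ c → χ c x * (w ^ ones c ⊛ (w ⊛ Ω)) m) + 0ℤ)
    ≡⟨ cong₂ (λ y z → y + (sgn (res a) * z + 0ℤ)) (fourier Ω m x) (fourier (w ⊛ Ω) m x) ⟩
  (P ⊛ Ω) m + (sgn (res a) * (P ⊛ (w ⊛ Ω)) m + 0ℤ)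
    ≡⟨ factor a ⟩
  (u ^ ones (map res (a ∷ x)) ⊛ v ^ ones (map (flip ∘ res) (a ∷ x)) ⊛ Ω) m ∎
  where
  open ≡-Reasoning
  P Q R : Series
  Q = u ^ ones (map res x)
  R = v ^ ones (map (flip ∘ res) x)
  P = Q ⊛ R
  shift : ∀ c → (w ^ suc (ones c) ⊛ Ω) m ≡ (w ^ ones c ⊛ (w ⊛ Ω)) m
  shift c = coeff (solve 3 (λ W X O → (W :* X) :* O := X :* (W :* O)) ≈-refl w (w ^ ones c) Ω) m
  even : (P ⊛ Ω) m + (1ℤ * (P ⊛ (w ⊛ Ω)) m + 0ℤ) ≡ (Q ⊛ (v ⊛ R) ⊛ Ω) m
  even = ≡.trans (arith ((P ⊛ Ω) m) ((P ⊛ (w ⊛ Ω)) m))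
    (coeff (solve 4 (λ W Q R O → Q :* R :* O :+ Q :* R :* (W :* O) := Q :* ((con 1ℤ :+ W) :* R) :* O) ≈-refl w Q R Ω) m)
    where
    arith : ∀ x y → x + (1ℤ * y + 0ℤ) ≡ x + y
    arith = solve-∀
  odd : (P ⊛ Ω) m + (- 1ℤ * (P ⊛ (w ⊛ Ω)) m + 0ℤ) ≡ (u ⊛ Q ⊛ R ⊛ Ω) m
  odd = ≡.trans (arith ((P ⊛ Ω) m) ((P ⊛ (w ⊛ Ω)) m))
    (coeff (solve 4 (λ W Q R O → Q :* R :* O :+ :- (Q :* R :* (W :* O)) := (con 1ℤ :+ :- W) :* Q :* R :* O) ≈-refl w Q R Ω) m)
    where
    arith : ∀ x y → x + (- 1ℤ * y + 0ℤ) ≡ x + - y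
    arith = solve-∀
  factor : ∀ a → (P ⊛ Ω) m + (sgn (res a) * (P ⊛ (w ⊛ Ω)) m + 0ℤ) ≡ (u ^ ones (map res (a ∷ x)) ⊛ v ^ ones (map (flip ∘ res) (a ∷ x)) ⊛ Ω) m
  factor 0F = even
  factor 1F = odd
  factor 2F = even
  factor 3F = odd

z4-cong : ∀ a b → a % 4 ≡ b % 4 → z4 a ≡ z4 b
z4-cong a b eq = Fin.toℕ-injective (≡.trans (Fin.toℕ-fromℕ< (m%n<n a 4)) (≡.trans eq (≡.sym (Fin.toℕ-fromℕ< (m%n<n b 4)))))

z4-0 : ∀ a → z4 a ≡ z4 0 → a % 4 ≡ 0
z4-0 a eq = ≡.trans (≡.sym (Fin.toℕ-fromℕ< (m%n<n a 4))) (cong toℕ eq)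

pairing : ∀ {n} → Vec Z4 n → Vec Z4 n → ℕ
pairing x y = sum (toList (zipWith (λ a b → toℕ a ℕ.* toℕ b) x y))

private
  step : ∀ r k {e} → e ≡ r ℕ.+ k ℕ.* 4 → ∀ a s j → a ℕ.+ r ≡ s ℕ.+ j ℕ.* 4 → a ℕ.+ e ≡ s ℕ.+ (j ℕ.+ k) ℕ.* 4
  step r k refl a s j eq = ≡.trans (≡.sym (ℕ.+-assoc a r (k ℕ.* 4))) (≡.trans (cong (ℕ._+ k ℕ.* 4) eq) (arith s j k))
    where
    arith : ∀ s j k → s ℕ.+ j ℕ.* 4 ℕ.+ k ℕ.* 4 ≡ s ℕ.+ (j ℕ.+ k) ℕ.* 4
    arith = solve-ℕ

-- Modulo 4 the pairing with 2c is twice the number of odd entries of x on the support of c, whose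
-- parity is the sign of the character.
pairing-dbl : ∀ {n} (x : Vec Z4 n) (c : Vec F₂ n) →
  (χ c x ≡ 1ℤ × ∃ λ k → pairing x (map dbl c) ≡ 0 ℕ.+ k ℕ.* 4) ⊎ (χ c x ≡ - 1ℤ × ∃ λ k → pairing x (map dbl c) ≡ 2 ℕ.+ k ℕ.* 4)
pairing-dbl [] [] = inj₁ (refl , 0 , refl)
pairing-dbl (a ∷ x) (c ∷ cs) with pairing-dbl x cs
pairing-dbl (0F ∷ x) (0F ∷ cs) | inj₁ (h , k , eq) rewrite h = inj₁ (refl , k , eq)
pairing-dbl (1F ∷ x) (0F ∷ cs) | inj₁ (h , k , eq) rewrite h = inj₁ (refl , k , eq)
pairing-dbl (2F ∷ x) (0F ∷ cs) | inj₁ (h , k , eq) rewrite h = inj₁ (refl , k , eq)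
pairing-dbl (3F ∷ x) (0F ∷ cs) | inj₁ (h , k , eq) rewrite h = inj₁ (refl , k , eq)
pairing-dbl (0F ∷ x) (1F ∷ cs) | inj₁ (h , k , eq) rewrite h = inj₁ (refl , k , eq)
pairing-dbl (1F ∷ x) (1F ∷ cs) | inj₁ (h , k , eq) rewrite h = inj₂ (refl , k , step 0 k eq 2 2 0 refl)
pairing-dbl (2F ∷ x) (1F ∷ cs) | inj₁ (h , k , eq) rewrite h = inj₁ (refl , suc k , step 0 k eq 4 0 1 refl)
pairing-dbl (3F ∷ x) (1F ∷ cs) | inj₁ (h , k , eq) rewrite h = inj₂ (refl , suc k , step 0 k eq 6 2 1 refl)
pairing-dbl (0F ∷ x) (0F ∷ cs) | inj₂ (h , k , eq) rewrite h = inj₂ (refl , k , eq)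
pairing-dbl (1F ∷ x) (0F ∷ cs) | inj₂ (h , k , eq) rewrite h = inj₂ (refl , k , eq)
pairing-dbl (2F ∷ x) (0F ∷ cs) | inj₂ (h , k , eq) rewrite h = inj₂ (refl , k , eq)
pairing-dbl (3F ∷ x) (0F ∷ cs) | inj₂ (h , k , eq) rewrite h = inj₂ (refl , k , eq)
pairing-dbl (0F ∷ x) (1F ∷ cs) | inj₂ (h , k , eq) rewrite h = inj₂ (refl , k , eq)
pairing-dbl (1F ∷ x) (1F ∷ cs) | inj₂ (h , k , eq) rewrite h = inj₁ (refl , suc k , step 2 k eq 2 0 1 refl)
pairing-dbl (2F ∷ x) (1F ∷ cs) | inj₂ (h , k , eq) rewrite h = inj₂ (refl , suc k , step 2 k eq 4 2 1 refl)
pairing-dbl (3F ∷ x) (1F ∷ cs) | inj₂ (h , k , eq) rewrite h = inj₁ (refl , suc (suc k) , step 2 k eq 6 0 2 refl)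

χ-±1 : ∀ {n} (x : Vec Z4 n) (c : Vec F₂ n) → (χ c x ≡ 1ℤ × dot x (map dbl c) ≡ z4 0) ⊎ (χ c x ≡ - 1ℤ × dot x (map dbl c) ≢ z4 0)
χ-±1 x c with pairing-dbl x c
... | inj₁ (h , k , eq) = inj₁ (h , z4-cong (pairing x (map dbl c)) 0 (≡.trans (cong (_% 4) eq) ([m+kn]%n≡m%n 0 k 4)))
... | inj₂ (h , k , eq) = inj₂ (h , λ z → 2≢0 (≡.trans (≡.sym (≡.trans (cong (_% 4) eq) ([m+kn]%n≡m%n 2 k 4))) (z4-0 (pairing x (map dbl c)) z)))
  where
  2≢0 : 2 ≢ 0
  2≢0 ()

-- Squares in Z4 are 1 for odd and 0 for even entries. With self-orthogonality this makes the
-- residue code doubly even.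
pairing-self : ∀ {n} (x : Vec Z4 n) → ∃ λ k → pairing x x ≡ ones (map res x) ℕ.+ k ℕ.* 4
pairing-self []       = 0 , refl
pairing-self (a ∷ x) with pairing-self x
pairing-self (0F ∷ x) | k , eq = k , eq
pairing-self (1F ∷ x) | k , eq = k , step (ones (map res x)) k eq 1 (1 ℕ.+ ones (map res x)) 0 (≡.sym (ℕ.+-identityʳ _))
pairing-self (2F ∷ x) | k , eq = suc k , step (ones (map res x)) k eq 4 (ones (map res x)) 1 (ℕ.+-comm 4 _)
pairing-self (3F ∷ x) | k , eq = suc (suc k) , step (ones (map res x)) k eq 9 (1 ℕ.+ ones (map res x)) 2 (cong suc (ℕ.+-comm 8 _))

scale-2 : ∀ {n} (x : Vec Z4 n) → scale 2F x ≡ map dbl (map res x)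
scale-2 []       = refl
scale-2 (0F ∷ x) = cong (0F ∷_) (scale-2 x)
scale-2 (1F ∷ x) = cong (2F ∷_) (scale-2 x)
scale-2 (2F ∷ x) = cong (0F ∷_) (scale-2 x)
scale-2 (3F ∷ x) = cong (2F ∷_) (scale-2 x)

complement : ∀ {n} (x : Vec Z4 n) → map dbl (replicate n 1F) ⊕ scale 2F x ≡ map dbl (map (flip ∘ res) x)
complement []       = refl
complement (0F ∷ x) = cong (2F ∷_) (complement x)
complement (1F ∷ x) = cong (0F ∷_) (complement x)
complement (2F ∷ x) = cong (2F ∷_) (complement x)
complement (3F ∷ x) = cong (0F ∷_) (complement x)

χ-ones : ∀ {n} (x : Vec Z4 n) → χ (replicate n 1F) x ≡ v̄ (ones (map res x))
χ-ones []       = refl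
χ-ones (0F ∷ x) = ≡.trans (ℤ.*-identityˡ _) (χ-ones x)
χ-ones (1F ∷ x) = ≡.trans (ℤ.-1*i≡-i _) (cong -_ (χ-ones x))
χ-ones (2F ∷ x) = ≡.trans (ℤ.*-identityˡ _) (χ-ones x)
χ-ones (3F ∷ x) = ≡.trans (ℤ.-1*i≡-i _) (cong -_ (χ-ones x))

ones+zeros : ∀ {n} (x : Vec Z4 n) → ones (map res x) ℕ.+ ones (map (flip ∘ res) x) ≡ n
ones+zeros []       = refl
ones+zeros (0F ∷ x) = ≡.trans (ℕ.+-suc _ _) (cong suc (ones+zeros x))
ones+zeros (1F ∷ x) = cong suc (ones+zeros x)
ones+zeros (2F ∷ x) = ≡.trans (ℕ.+-suc _ _) (cong suc (ones+zeros x))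
ones+zeros (3F ∷ x) = cong suc (ones+zeros x)

dbl-zero : ∀ {n} (c : Vec F₂ n) → map dbl c ≡ zeroVec n → ones c ≡ 0
dbl-zero []       _  = refl
dbl-zero (0F ∷ c) eq = dbl-zero c (cong Vec.tail eq)
dbl-zero (1F ∷ c) ()

wtH-dbl : ∀ {n} (c : Vec F₂ n) → wtH (map dbl c) ≡ ones c
wtH-dbl []       = refl
wtH-dbl (0F ∷ c) = wtH-dbl c
wtH-dbl (1F ∷ c) = cong suc (wtH-dbl c)

wtL-dbl : ∀ {n} (c : Vec F₂ n) → wtL (map dbl c) ≡ 2 ℕ.* ones c
wtL-dbl []       = refl
wtL-dbl (0F ∷ c) = wtL-dbl c
wtL-dbl (1F ∷ c) = ≡.trans (cong (2 ℕ.+_) (wtL-dbl c)) (≡.sym (ℕ.*-distribˡ-+ 2 1 (ones c)))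

-- Since 3y = -y, a code containing y is carried onto itself by translation by y.
⊕-scale-3 : ∀ {n} (x y : Vec Z4 n) → (x ⊕ y) ⊕ scale 3F y ≡ x
⊕-scale-3 []      []      = refl
⊕-scale-3 (a ∷ x) (b ∷ y) = cong₂ _∷_ (coordinate a b) (⊕-scale-3 x y)
  where
  coordinate : ∀ a b → (a +₄ b) +₄ (3F *₄ b) ≡ a
  coordinate 0F 0F = refl
  coordinate 0F 1F = refl
  coordinate 0F 2F = refl
  coordinate 0F 3F = refl
  coordinate 1F 0F = refl
  coordinate 1F 1F = refl
  coordinate 1F 2F = refl
  coordinate 1F 3F = refl
  coordinate 2F 0F = refl
  coordinate 2F 1F = refl
  coordinate 2F 2F = refl
  coordinate 2F 3F = refl
  coordinate 3F 0F = refl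
  coordinate 3F 1F = refl
  coordinate 3F 2F = refl
  coordinate 3F 3F = refl

indicator : ∀ {P : Set} → Dec P → ℤ
indicator (yes _) = 1ℤ
indicator (no _)  = 0ℤ

indicator-cong : ∀ {P Q : Set} (p : Dec P) (q : Dec Q) → (P → Q) → (Q → P) → indicator p ≡ indicator q
indicator-cong (yes p) (yes q) f g = refl
indicator-cong (yes p) (no ¬q) f g = ⊥-elim (¬q (f p))
indicator-cong (no ¬p) (yes q) f g = ⊥-elim (¬p (g q))
indicator-cong (no ¬p) (no ¬q) f g = refl

-- Poisson summation over a self-dual code

module SelfDualCode {n} (C : Vec Z4 n → Set) (isCode : IsCode C) (selfDual : IsSelfDual C) (C? : ∀ x → Dec (C x)) where
  open IsCode isCode

  1C : Vec Z4 n → ℤ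
  1C x = indicator (C? x)

  size : ℤ
  size = ∑V n 1C

  1C-nonNeg : ∀ x → 0ℤ ℤ.≤ 1C x
  1C-nonNeg x with C? x
  ... | yes _ = nn 1
  ... | no _  = nn 0

  size-positive : 0ℤ ℤ.< size
  size-positive = ∑V-positive n 1C 1C-nonNeg (zeroVec n) positive
    where
    positive : 0ℤ ℤ.< 1C (zeroVec n)
    positive with C? (zeroVec n)
    ... | yes _ = +<+ (s≤s z≤n)
    ... | no ¬z = ⊥-elim (¬z has-zero)

  charSum : Vec F₂ n → ℤ
  charSum c = ∑V n λ x → 1C x * χ c x

  charSum-dual : ∀ c → C (map dbl c) → charSum c ≡ size
  charSum-dual c Cc = ∑V-cong n term
    where
    term : ∀ x → 1C x * χ c x ≡ 1C x
    term x with C? x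
    ... | no _  = ℤ.*-zeroˡ (χ c x)
    ... | yes Cx with χ-±1 x c
    ...   | inj₁ (χ≡1 , _) = cong (1ℤ *_) χ≡1
    ...   | inj₂ (_ , ≢0)  = ⊥-elim (≢0 (proj₁ (selfDual (map dbl c)) Cc x Cx))

  private
    translate : ∀ c y → C y → χ c y ≡ - 1ℤ → charSum c ≡ - charSum c
    translate c y Cy χ≡-1 = begin
      charSum c
        ≡⟨ ∑V-translate (λ x → 1C x * χ c x) y ⟨
      (∑V n λ x → 1C (x ⊕ y) * χ c (x ⊕ y))
        ≡⟨ ∑V-cong n (λ x → ≡.trans (cong₂ _*_ (indicator-cong (C? (x ⊕ y)) (C? x)
              (λ Cxy → subst C (⊕-scale-3 x y) (add-closed (x ⊕ y) (scale 3F y) Cxy (scale-closed 3F y Cy))) (λ Cx → add-closed x y Cx Cy))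
              (≡.trans (χ-⊕ c x y) (cong (χ c x *_) χ≡-1))) (arith (1C x) (χ c x))) ⟩
      (∑V n λ x → - 1ℤ * (1C x * χ c x))
        ≡⟨ *-∑V n (- 1ℤ) (λ x → 1C x * χ c x) ⟨
      - 1ℤ * charSum c
        ≡⟨ ℤ.-1*i≡-i (charSum c) ⟩
      - charSum c ∎
      where
      open ≡-Reasoning
      arith : ∀ x y → x * (y * - 1ℤ) ≡ - 1ℤ * (x * y)
      arith = solve-∀

    self-negative : ∀ z → z ≡ - z → z ≡ 0ℤ
    self-negative (+ zero) _ = refl

  -- The contrapositive is proved: any x in C with character -1 would make the sum equal to its own
  -- negative. Deciding whether the integer `charSum c` vanishes spares the search for such an x.
  charSum-nondual : ∀ c → ¬ C (map dbl c) → charSum c ≡ 0ℤ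
  charSum-nondual c ¬Cc with charSum c ℤ.≟ 0ℤ
  ... | yes eq = eq
  ... | no ≢0  = ⊥-elim (¬Cc (proj₂ (selfDual (map dbl c)) orthogonal))
    where
    orthogonal : ∀ x → C x → dot x (map dbl c) ≡ z4 0
    orthogonal x Cx with χ-±1 x c
    ... | inj₁ (_ , ≡0)    = ≡0
    ... | inj₂ (χ≡-1 , _) = ⊥-elim (≢0 (self-negative (charSum c) (translate c x Cx χ≡-1)))

  charSum-value : ∀ c → charSum c ≡ indicator (C? (map dbl c)) * size
  charSum-value c with C? (map dbl c)
  ... | yes Cc = ≡.trans (charSum-dual c Cc) (≡.sym (ℤ.*-identityˡ size))
  ... | no ¬Cc = charSum-nondual c ¬Cc

  -- The MacWilliams identity for R and T, with `Ω` read through one coefficient. Summing over C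
  -- rather than R counts every residue word with the same multiplicity, absorbed in `size`.
  poisson : ∀ Ω m →
    (∑V n λ x → 1C x * (u ^ ones (map res x) ⊛ v ^ ones (map (flip ∘ res) x) ⊛ Ω) m)
      ≡ size * (∑V n λ c → indicator (C? (map dbl c)) * (w ^ ones c ⊛ Ω) m)
  poisson Ω m = begin
    (∑V n λ x → 1C x * (u ^ ones (map res x) ⊛ v ^ ones (map (flip ∘ res) x) ⊛ Ω) m)
      ≡⟨ ∑V-cong n (λ x → ≡.trans (cong (1C x *_) (≡.sym (fourier Ω m x))) (*-∑V n (1C x) _)) ⟩
    (∑V n λ x → ∑V n λ c → 1C x * (χ c x * φ c))
      ≡⟨ ∑V-swap n n (λ x c → 1C x * (χ c x * φ c)) ⟩
    (∑V n λ c → ∑V n λ x → 1C x * (χ c x * φ c))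
      ≡⟨ ∑V-cong n (λ c → ≡.trans (∑V-cong n λ x → arith (1C x) (χ c x) (φ c)) (≡.trans (≡.sym (*-∑V n (φ c) λ x → 1C x * χ c x)) (cong (φ c *_) (charSum-value c)))) ⟩
    (∑V n λ c → φ c * (indicator (C? (map dbl c)) * size))
      ≡⟨ ∑V-cong n (λ c → arith₂ (φ c) (indicator (C? (map dbl c))) size) ⟩
    (∑V n λ c → size * (indicator (C? (map dbl c)) * φ c))
      ≡⟨ *-∑V n size (λ c → indicator (C? (map dbl c)) * φ c) ⟨
    size * (∑V n λ c → indicator (C? (map dbl c)) * φ c) ∎
    where
    open ≡-Reasoning
    φ : Vec F₂ n → ℤ
    φ c = (w ^ ones c ⊛ Ω) m
    arith : ∀ x y z → x * (y * z) ≡ z * (x * y)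
    arith = solve-∀
    arith₂ : ∀ x y z → x * (y * z) ≡ z * (y * x)
    arith₂ = solve-∀

  residue-doublyEven : ∀ x → C x → ∃ λ σ → ones (map res x) ≡ σ ℕ.* 4
  residue-doublyEven x Cx with pairing-self x
  ... | k , eq = ones (map res x) ℕ./ 4 , ≡.trans (m≡m%n+[m/n]*n (ones (map res x)) 4) (cong (ℕ._+ ones (map res x) ℕ./ 4 ℕ.* 4)
      (≡.trans (≡.sym ([m+kn]%n≡m%n (ones (map res x)) k 4)) (≡.trans (cong (_% 4) (≡.sym eq)) (z4-0 (pairing x x) (proj₁ (selfDual x) Cx x Cx)))))

  residue-dual : ∀ x → C x → C (map dbl (map res x))
  residue-dual x Cx = subst C (scale-2 x) (scale-closed 2F x Cx)

  ones-dual : C (map dbl (replicate n 1F))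
  ones-dual = proj₂ (selfDual (map dbl (replicate n 1F))) orthogonal
    where
    orthogonal : ∀ x → C x → dot x (map dbl (replicate n 1F)) ≡ z4 0
    orthogonal x Cx with χ-±1 x (replicate n 1F)
    ... | inj₁ (_ , ≡0)   = ≡0
    ... | inj₂ (χ≡-1 , _) with residue-doublyEven x Cx
    ...   | σ , eq = ⊥-elim (1≢-1 (≡.trans (≡.sym (≡.trans (χ-ones x) (≡.trans (cong v̄ eq) (v̄-4* σ)))) χ≡-1))
      where
      1≢-1 : 1ℤ ≢ - 1ℤ
      1≢-1 ()

  complement-dual : ∀ x → C x → C (map dbl (map (flip ∘ res) x))
  complement-dual x Cx = subst C (complement x) (add-closed _ _ ones-dual (scale-closed 2F x Cx))

-- The 32 balances degrees: n + t from the padded weight enumerator and 36 from p must add up to 6m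
-- + 4 = 24l + 4. Divisibility of the number of zeros by 4, after padding, follows from that of the
-- number of ones.
cofactor-exists : ∀ n t l j k σ → n ℕ.+ t ℕ.+ 32 ≡ l ℕ.* 24 → j ℕ.+ k ≡ n → j ≡ σ ℕ.* 4 →
  ∃ λ τ → k ℕ.+ t ≡ τ ℕ.* 4 × σ ℕ.+ τ ℕ.+ 8 ≡ 6 ℕ.* l
cofactor-exists n t l j k σ n-eq jk refl = τ , ℕ.+-cancelˡ-≡ (a ℕ.* 4) (k ℕ.+ t) (τ ℕ.* 4) (begin
    a ℕ.* 4 ℕ.+ (k ℕ.+ t)     ≡⟨ total ⟩
    l ℕ.* 6 ℕ.* 4             ≡⟨ cong (ℕ._* 4) (proj₂ τ∃) ⟩
    (a ℕ.+ τ) ℕ.* 4           ≡⟨ ℕ.*-distribʳ-+ 4 a τ ⟩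
    a ℕ.* 4 ℕ.+ τ ℕ.* 4 ∎)
  , ≡.trans (arith₂ σ τ) (≡.trans (≡.sym (proj₂ τ∃)) (ℕ.*-comm l 6))
  where
  open ≡-Reasoning
  a = σ ℕ.+ 8
  arith : ∀ σ k t → (σ ℕ.+ 8) ℕ.* 4 ℕ.+ (k ℕ.+ t) ≡ σ ℕ.* 4 ℕ.+ k ℕ.+ t ℕ.+ 32
  arith = solve-ℕ
  arith₂ : ∀ σ τ → σ ℕ.+ τ ℕ.+ 8 ≡ σ ℕ.+ 8 ℕ.+ τ
  arith₂ = solve-ℕ
  total : a ℕ.* 4 ℕ.+ (k ℕ.+ t) ≡ l ℕ.* 6 ℕ.* 4
  total = ≡.trans (arith σ k t) (≡.trans (cong (λ z → z ℕ.+ t ℕ.+ 32) jk) (≡.trans n-eq (≡.sym (ℕ.*-assoc l 6 4))))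
  τ∃ : ∃ λ τ → l ℕ.* 6 ≡ a ℕ.+ τ
  τ∃ = ∃-diff (ℕ.*-cancelʳ-≤ a (l ℕ.* 6) 4 (subst (a ℕ.* 4 ℕ.≤_) total (ℕ.m≤m+n (a ℕ.* 4) (k ℕ.+ t))))
  τ = proj₁ τ∃

-- The linear programming contradiction

indicator-nonNeg : ∀ {P : Set} (P? : Dec P) z → (P → 0ℤ ℤ.≤ z) → 0ℤ ℤ.≤ indicator P? * z
indicator-nonNeg (yes p) z h = nn 1 ⊠ h p
indicator-nonNeg (no _)  z h = ℤ.≤-reflexive (≡.sym (ℤ.*-zeroˡ z))

indicator-positive : ∀ {P : Set} (P? : Dec P) z → P → 0ℤ ℤ.< z → 0ℤ ℤ.< indicator P? * z
indicator-positive (yes _) z p h = subst (0ℤ ℤ.<_) (≡.sym (ℤ.*-identityˡ z)) h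
indicator-positive (no ¬p) z p h = ⊥-elim (¬p p)

module _ {n} (C : Vec Z4 n → Set) (isCode : IsCode C) (selfDual : IsSelfDual C) (C? : ∀ x → Dec (C x))
         (l t H D : ℕ) (length-eq : n ℕ.+ t ℕ.+ 32 ≡ l ℕ.* 24) (t<24 : t ℕ.< 24)
         (weights : ∀ c → C (map dbl c) → ones c ≡ 0 ⊎ D ℕ.≤ 2 ℕ.* ones c) where

  open Gamma l
  open Functional l
  open SelfDualCode C isCode selfDual C?

  private
    8q : ∀ {k} q → D ℕ.≤ 2 ℕ.* k → k ℕ.≤ q ℕ.* 4 → D ℕ.≤ q ℕ.* 8
    8q q D≤ k≤ = ℕ.≤-trans D≤ (ℕ.≤-trans (ℕ.*-monoʳ-≤ 2 k≤) (ℕ.≤-reflexive (arith q)))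
      where
      arith : ∀ q → 2 ℕ.* (q ℕ.* 4) ≡ q ℕ.* 8
      arith = solve-ℕ

    q≤5 : ∀ {q} → q ℕ.* 4 ℕ.≤ t → q ℕ.≤ 5
    q≤5 {q} h = ℕ.s≤s⁻¹ (ℕ.*-cancelʳ-< 4 q 6 (ℕ.≤-<-trans h t<24))

    σ-good : ∀ x → C x → ∀ σ → ones (map res x) ≡ σ ℕ.* 4 → σ ℕ.≤ 5 ⊎ D ℕ.≤ σ ℕ.* 8
    σ-good x Cx σ σ-eq with weights (map res x) (residue-dual x Cx)
    ... | inj₁ z  = inj₁ (q≤5 (ℕ.≤-trans (ℕ.≤-reflexive (≡.trans (≡.sym σ-eq) z)) z≤n))
    ... | inj₂ D≤ = inj₂ (8q σ D≤ (ℕ.≤-reflexive σ-eq))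

    τ-good : ∀ x → C x → ∀ τ → ones (map (flip ∘ res) x) ℕ.+ t ≡ τ ℕ.* 4 → τ ℕ.≤ 5 ⊎ D ℕ.≤ τ ℕ.* 8
    τ-good x Cx τ τ-eq with weights (map (flip ∘ res) x) (complement-dual x Cx)
    ... | inj₁ z  = inj₁ (q≤5 (ℕ.≤-reflexive (≡.trans (≡.sym τ-eq) (cong (ℕ._+ t) z))))
    ... | inj₂ D≤ = inj₂ (8q τ D≤ (ℕ.≤-trans (ℕ.m≤m+n _ t) (ℕ.≤-reflexive τ-eq)))

    -- Padding spreads a word of T over the weights up to t higher. For the zero word this reaches
    -- only 4q ≤ t < 24, which is the origin of q ≤ 5; every other word keeps D ≤ 8q.
    dual-good : ∀ c → C (map dbl c) → ∀ q → ones c ℕ.≤ q ℕ.* 4 → q ℕ.* 4 ℕ.≤ ones c ℕ.+ t → q ℕ.≤ 5 ⊎ D ℕ.≤ q ℕ.* 8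
    dual-good c Cc q lo hi with weights c Cc
    ... | inj₁ z  = inj₁ (q≤5 (ℕ.≤-trans hi (ℕ.≤-reflexive (cong (ℕ._+ t) z))))
    ... | inj₂ D≤ = inj₂ (8q q D≤ lo)

  -- The sum over R is non-negative term by term. The sum over T is -262144 times a sum of
  -- non-negative terms, and the zero word contributes strictly, so the Poisson identity cannot
  -- hold.
  lp-contradiction : 0ℤ ℤ.< comb (p (+ H)) γ 0 → (∀ q → q ℕ.≤ 5 ⊎ D ℕ.≤ q ℕ.* 8 → 0ℤ ℤ.≤ comb (p (+ H)) γ q) → ⊥
  lp-contradiction positive nonNeg = ℤ.<⇒≱ dual<0 (subst (0ℤ ℤ.≤_) (poisson (Ω (+ H) t) m) primal≥0)
    where
    K : Vec Z4 n → ℤ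
    K x = (u ^ ones (map res x) ⊛ v ^ ones (map (flip ∘ res) x) ⊛ Ω (+ H) t) m

    K-nonNeg : ∀ x → C x → 0ℤ ℤ.≤ K x
    K-nonNeg x Cx = subst (0ℤ ℤ.≤_) (≡.sym (Ω-uv (+ H) t (ones (map res x)) (ones (map (flip ∘ res) x)) σ τ (proj₂ σ∃) (proj₁ (proj₂ τ∃)) (proj₂ (proj₂ τ∃))))
      (nn (8 ℕ.^ m) ⊠ (nonNeg σ (σ-good x Cx σ (proj₂ σ∃)) ⊞ nonNeg τ (τ-good x Cx τ (proj₁ (proj₂ τ∃)))))
      where
      σ∃ = residue-doublyEven x Cx
      σ = proj₁ σ∃
      τ∃ = cofactor-exists n t l (ones (map res x)) (ones (map (flip ∘ res) x)) σ length-eq (ones+zeros x) (proj₂ σ∃)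
      τ = proj₁ τ∃

    primal≥0 : 0ℤ ℤ.≤ ∑V n λ x → 1C x * K x
    primal≥0 = ∑V-nonNeg n (λ x → 1C x * K x) λ x → indicator-nonNeg (C? x) (K x) (K-nonNeg x)

    1T : Vec F₂ n → ℤ
    1T c = indicator (C? (map dbl c))

    ω-term : ∀ c → 0ℤ ℤ.≤ 1T c * ω (p (+ H)) t (ones c)
    ω-term c = indicator-nonNeg (C? (map dbl c)) (ω (p (+ H)) t (ones c)) λ Cc → ω-nonNeg (p (+ H)) t (ones c) λ q lo hi → nonNeg q (dual-good c Cc q lo hi)

    dbl-replicate : ∀ n → map dbl (replicate n 0F) ≡ zeroVec n
    dbl-replicate zero    = refl
    dbl-replicate (suc n) = cong (0F ∷_) (dbl-replicate n)

    ones-replicate : ∀ n → ones (replicate n 0F) ≡ 0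
    ones-replicate zero    = refl
    ones-replicate (suc n) = ones-replicate n

    ω-zero : 0ℤ ℤ.< 1T (replicate n 0F) * ω (p (+ H)) t (ones (replicate n 0F))
    ω-zero = indicator-positive (C? (map dbl (replicate n 0F))) (ω (p (+ H)) t (ones (replicate n 0F))) (subst C (≡.sym (dbl-replicate n)) (IsCode.has-zero isCode))
      (subst (λ i → 0ℤ ℤ.< ω (p (+ H)) t i) (≡.sym (ones-replicate n)) (ω-positive (p (+ H)) t positive λ q q≤ → nonNeg q (inj₁ (q≤5 q≤))))

    dual : ℤ
    dual = ∑V n λ c → 1T c * (w ^ ones c ⊛ Ω (+ H) t) m

    dual-negative : ∀ k → k ℤ.< 0ℤ → (∀ i → (w ^ i ⊛ Ω (+ H) t) m ≡ k * ω (p (+ H)) t i) → size * dual ℤ.< 0ℤ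
    dual-negative k k<0 Ω-w = subst (size * dual ℤ.<_) (ℤ.*-zeroʳ size) (ℤ.*-monoˡ-<-pos size {{ℤ.positive size-positive}}
      (subst (ℤ._< 0ℤ) (≡.sym dual≡) (subst (k * ωs ℤ.<_) (ℤ.*-zeroʳ k)
        (ℤ.*-monoˡ-<-neg k {{ℤ.negative k<0}} (∑V-positive n (λ c → 1T c * ω (p (+ H)) t (ones c)) ω-term (replicate n 0F) ω-zero)))))
      where
      ωs : ℤ
      ωs = ∑V n λ c → 1T c * ω (p (+ H)) t (ones c)
      arith : ∀ x k y → x * (k * y) ≡ k * (x * y)
      arith = solve-∀
      dual≡ : dual ≡ k * ωs
      dual≡ = ≡.trans (∑V-cong n λ c → ≡.trans (cong (1T c *_) (Ω-w (ones c))) (arith (1T c) k (ω (p (+ H)) t (ones c))))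
        (≡.sym (*-∑V n k λ c → 1T c * ω (p (+ H)) t (ones c)))

    dual<0 : size * dual ℤ.< 0ℤ
    dual<0 = dual-negative (- + 262144) ℤ.-<+ (Ω-w (+ H) t)

comb-high : ∀ l {k} (ps : Vec ℤ k) q → l ℕ.< q → comb ps (Gamma.γ l) q ≡ 0ℤ
comb-high l []       q l<q = refl
comb-high l (c ∷ cs) q l<q = cong₂ _+_ (≡.trans (cong (c *_) (Gamma.γ-high l q l<q)) (ℤ.*-zeroʳ c)) (comb-high l cs (suc q) (ℕ.m<n⇒m<1+n l<q))

¬¬-Fin : ∀ k {P : Fin k → Set} → (∀ a → ¬ ¬ P a) → ¬ ¬ (∀ a → P a)
¬¬-Fin zero    h k = k λ ()
¬¬-Fin (suc n) h k = h zero λ p₀ → ¬¬-Fin n (h ∘ suc) λ ps → k λ { zero → p₀ ; (suc a) → ps a }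

-- Double negation commutes with quantification over a finite set, so membership in an arbitrary
-- code may be treated as decidable while refuting.
¬¬-Vec : ∀ k n {P : Vec (Fin k) n → Set} → (∀ x → ¬ ¬ P x) → ¬ ¬ (∀ x → P x)
¬¬-Vec k zero    h r = h [] λ p → r λ { [] → p }
¬¬-Vec k (suc n) h r = ¬¬-Fin k (λ a → ¬¬-Vec k n λ x → h (a ∷ x)) λ ps → r λ { (a ∷ x) → ps a x }

¬¬-dec : ∀ {P : Set} → ¬ ¬ Dec P
¬¬-dec k = k (no λ p → k (yes p))

-- Here 55 = 32 + 23, and t is the complement to 23 of the remainder, the least padding that gives
-- the required length.
length-decomposition : ∀ n → ∃ λ l → ∃ λ t → n ℕ.+ t ℕ.+ 32 ≡ l ℕ.* 24 × t ℕ.< 24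
length-decomposition n with (n ℕ.+ 55) divMod 24
... | result l r eq with ∃-diff (ℕ.s≤s⁻¹ (Fin.toℕ<n r))
... | t , eq₂ = l , t , ℕ.+-cancelˡ-≡ (toℕ r) _ _ (begin
    toℕ r ℕ.+ (n ℕ.+ t ℕ.+ 32)  ≡⟨ arith (toℕ r) n t ⟩
    n ℕ.+ 32 ℕ.+ (toℕ r ℕ.+ t)  ≡⟨ cong (n ℕ.+ 32 ℕ.+_) eq₂ ⟨
    n ℕ.+ 32 ℕ.+ 23             ≡⟨ ℕ.+-assoc n 32 23 ⟩
    n ℕ.+ 55                    ≡⟨ eq ⟩
    toℕ r ℕ.+ l ℕ.* 24 ∎) , s≤s (ℕ.≤-trans (ℕ.m≤n+m t (toℕ r)) (ℕ.≤-reflexive (≡.sym eq₂)))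
  where
  open ≡-Reasoning
  arith : ∀ r n t → r ℕ.+ (n ℕ.+ t ℕ.+ 32) ≡ n ℕ.+ 32 ℕ.+ (r ℕ.+ t)
  arith = solve-ℕ

-- The asymptotic bound

⁴-mono : ∀ {a b} → a ℕ.≤ b → a ⁴ ℕ.≤ b ⁴
⁴-mono h = ℕ.*-mono-≤ (ℕ.*-mono-≤ h h) (ℕ.*-mono-≤ h h)

-- The saddle point attached to q ≥ D/8 satisfies the inequality that 1 − D/n + 1/e fails, up to a factor 2.
saddle-bound : ∀ n t l e q M D Q → n ℕ.+ t ℕ.+ 32 ≡ l ℕ.* 24 → t ℕ.< 24 → l ≡ q ℕ.+ M → 110 ℕ.* e ℕ.+ 28 ℕ.≤ n → D ℕ.≤ q ℕ.* 8 →
  Q ℕ.+ D ℕ.* e ≡ n ℕ.* e ℕ.+ n → 8 ℕ.* e ℕ.* (2 ℕ.* M ℕ.+ l ℕ.* 4) ℕ.+ 3 ℕ.* (l ℕ.* 4) ℕ.≤ 2 ℕ.* Q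
saddle-bound n t l e q M D Q n-eq t<24 refl n≥ D≤ Q-eq = ℕ.+-cancelʳ-≤ (2 ℕ.* (D ℕ.* e)) A (2 ℕ.* Q) (ℕ.*-cancelˡ-≤ 2 (begin
  2 ℕ.* (A ℕ.+ 2 ℕ.* (D ℕ.* e))
    ≤⟨ ℕ.*-monoʳ-≤ 2 (ℕ.+-monoʳ-≤ A (ℕ.*-monoʳ-≤ 2 (ℕ.*-monoˡ-≤ e D≤))) ⟩
  2 ℕ.* (A ℕ.+ 2 ℕ.* (q ℕ.* 8 ℕ.* e))
    ≡⟨ arith₁ e q M ⟩
  4 ℕ.* e ℕ.* (l ℕ.* 24) ℕ.+ l ℕ.* 24
    ≡⟨ cong (λ z → 4 ℕ.* e ℕ.* z ℕ.+ z) (≡.trans (≡.sym n-eq) (ℕ.+-assoc n t 32)) ⟩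
  4 ℕ.* e ℕ.* (n ℕ.+ (t ℕ.+ 32)) ℕ.+ (n ℕ.+ (t ℕ.+ 32))
    ≤⟨ ℕ.+-mono-≤ (ℕ.*-monoʳ-≤ (4 ℕ.* e) (ℕ.+-monoʳ-≤ n t+32≤55)) (ℕ.+-monoʳ-≤ n t+32≤55) ⟩
  4 ℕ.* e ℕ.* (n ℕ.+ 55) ℕ.+ (n ℕ.+ 55)
    -- Adding 1 makes the constant even: 220e + 56 = 2(110e + 28), the slack provided by the lower
    -- bound on n.
    ≤⟨ ℕ.m≤m+n _ 1 ⟩
  4 ℕ.* e ℕ.* (n ℕ.+ 55) ℕ.+ (n ℕ.+ 55) ℕ.+ 1
    ≡⟨ arith₂ e n ⟩
  4 ℕ.* (n ℕ.* e) ℕ.+ n ℕ.+ 2 ℕ.* (110 ℕ.* e ℕ.+ 28)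
    ≤⟨ ℕ.+-monoʳ-≤ (4 ℕ.* (n ℕ.* e) ℕ.+ n) (ℕ.*-monoʳ-≤ 2 n≥) ⟩
  4 ℕ.* (n ℕ.* e) ℕ.+ n ℕ.+ 2 ℕ.* n
    ≤⟨ ℕ.m≤m+n _ n ⟩
  4 ℕ.* (n ℕ.* e) ℕ.+ n ℕ.+ 2 ℕ.* n ℕ.+ n
    ≡⟨ arith₃ (n ℕ.* e) n ⟩
  2 ℕ.* (2 ℕ.* (n ℕ.* e ℕ.+ n))
    ≡⟨ cong (λ z → 2 ℕ.* (2 ℕ.* z)) Q-eq ⟨
  2 ℕ.* (2 ℕ.* (Q ℕ.+ D ℕ.* e))
    ≡⟨ cong (2 ℕ.*_) (ℕ.*-distribˡ-+ 2 Q (D ℕ.* e)) ⟩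
  2 ℕ.* (2 ℕ.* Q ℕ.+ 2 ℕ.* (D ℕ.* e)) ∎))
  where
  open ℕ.≤-Reasoning
  A = 8 ℕ.* e ℕ.* (2 ℕ.* M ℕ.+ l ℕ.* 4) ℕ.+ 3 ℕ.* (l ℕ.* 4)
  t+32≤55 : t ℕ.+ 32 ℕ.≤ 55
  t+32≤55 = ℕ.+-monoˡ-≤ 32 (ℕ.s≤s⁻¹ t<24)
  arith₁ : ∀ e q M → 2 ℕ.* (8 ℕ.* e ℕ.* (2 ℕ.* M ℕ.+ (q ℕ.+ M) ℕ.* 4) ℕ.+ 3 ℕ.* ((q ℕ.+ M) ℕ.* 4) ℕ.+ 2 ℕ.* (q ℕ.* 8 ℕ.* e))
    ≡ 4 ℕ.* e ℕ.* ((q ℕ.+ M) ℕ.* 24) ℕ.+ (q ℕ.+ M) ℕ.* 24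
  arith₁ = solve-ℕ
  arith₂ : ∀ e n → 4 ℕ.* e ℕ.* (n ℕ.+ 55) ℕ.+ (n ℕ.+ 55) ℕ.+ 1 ≡ 4 ℕ.* (n ℕ.* e) ℕ.+ n ℕ.+ 2 ℕ.* (110 ℕ.* e ℕ.+ 28)
  arith₂ = solve-ℕ
  arith₃ : ∀ x n → 4 ℕ.* x ℕ.+ n ℕ.+ 2 ℕ.* n ℕ.+ n ≡ 2 ℕ.* (2 ℕ.* (x ℕ.+ n))
  arith₃ = solve-ℕ

-- The failure of the bound at `Q` is doubled to match A ≤ 2Q, and 2ne ≤ 48le because n ≤ 24l.
saddle-inequality : ∀ n t l e A Q → n ℕ.+ t ℕ.+ 32 ≡ l ℕ.* 24 → A ℕ.≤ 2 ℕ.* Q → 5 ℕ.* Q ⁴ ℕ.< (n ℕ.* e) ⁴ →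
  5 ℕ.* A ⁴ ℕ.< (12 ℕ.* e ℕ.* (l ℕ.* 4)) ⁴
saddle-inequality n t l e A Q n-eq A≤ Q< = begin-strict
  5 ℕ.* A ⁴                       ≤⟨ ℕ.*-monoʳ-≤ 5 (⁴-mono A≤) ⟩
  5 ℕ.* (2 ℕ.* Q) ⁴               ≡⟨ arith₁ 5 2 Q ⟩
  2 ⁴ ℕ.* (5 ℕ.* Q ⁴)             <⟨ ℕ.*-monoʳ-< (2 ⁴) Q< ⟩
  2 ⁴ ℕ.* (n ℕ.* e) ⁴             ≡⟨ arith₂ 2 (n ℕ.* e) ⟩
  (2 ℕ.* (n ℕ.* e)) ⁴             ≤⟨ ⁴-mono (begin
    2 ℕ.* (n ℕ.* e)                 ≤⟨ ℕ.*-monoʳ-≤ 2 (ℕ.*-monoˡ-≤ e (ℕ.≤-trans (ℕ.≤-trans (ℕ.m≤m+n n t) (ℕ.m≤m+n (n ℕ.+ t) 32)) (ℕ.≤-reflexive n-eq))) ⟩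
    2 ℕ.* (l ℕ.* 24 ℕ.* e)          ≡⟨ arith₃ l e ⟩
    12 ℕ.* e ℕ.* (l ℕ.* 4) ∎) ⟩
  (12 ℕ.* e ℕ.* (l ℕ.* 4)) ⁴ ∎
  where
  open ℕ.≤-Reasoning
  arith₁ : ∀ f d Q → f ℕ.* (d ℕ.* Q ℕ.* (d ℕ.* Q) ℕ.* (d ℕ.* Q ℕ.* (d ℕ.* Q))) ≡ d ℕ.* d ℕ.* (d ℕ.* d) ℕ.* (f ℕ.* (Q ℕ.* Q ℕ.* (Q ℕ.* Q)))
  arith₁ = solve-ℕ
  arith₂ : ∀ d x → d ℕ.* d ℕ.* (d ℕ.* d) ℕ.* (x ℕ.* x ℕ.* (x ℕ.* x)) ≡ d ℕ.* x ℕ.* (d ℕ.* x) ℕ.* (d ℕ.* x ℕ.* (d ℕ.* x))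
  arith₂ = solve-ℕ
  arith₃ : ∀ l e → 2 ℕ.* (l ℕ.* 24 ℕ.* e) ≡ 12 ℕ.* e ℕ.* (l ℕ.* 4)
  arith₃ = solve-ℕ

-- The first part forces 4l > 96·`massBound e`, as n ≤ 24l and 576 = 96·6; the second absorbs
-- padding and degree shift in `saddle-bound`.
threshold : ℕ → ℕ
threshold e = 1 ℕ.+ massBound e ℕ.* 576 ℕ.+ (110 ℕ.* e ℕ.+ 28)

module _ (n t l e D : ℕ) (n-eq : n ℕ.+ t ℕ.+ 32 ≡ l ℕ.* 24) (t<24 : t ℕ.< 24) (n-large : threshold e ℕ.≤ n) where
  open Gamma l using (γ)

  private
    l-large : 96 ℕ.* massBound e ℕ.< l ℕ.* 4
    l-large = ℕ.*-cancelʳ-< 6 (96 ℕ.* massBound e) (l ℕ.* 4) (begin-strict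
      96 ℕ.* massBound e ℕ.* 6   ≡⟨ arith (massBound e) ⟩
      massBound e ℕ.* 576        <⟨ ℕ.≤-trans (ℕ.m≤m+n _ (110 ℕ.* e ℕ.+ 28)) n-large ⟩
      n                          ≤⟨ ℕ.≤-trans (ℕ.m≤m+n n t) (ℕ.m≤m+n (n ℕ.+ t) 32) ⟩
      n ℕ.+ t ℕ.+ 32             ≡⟨ n-eq ⟩
      l ℕ.* 24                   ≡⟨ ℕ.*-assoc l 4 6 ⟨
      l ℕ.* 4 ℕ.* 6 ∎)
      where
      open ℕ.≤-Reasoning
      arith : ∀ x → 96 ℕ.* x ℕ.* 6 ≡ x ℕ.* 576
      arith = solve-ℕ

    -- This gives 5q ≤ l for q ≤ 5, hence 4q ≤ l - q, the hypothesis of `comb-positive-large`.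
    25≤l : 25 ℕ.≤ l
    25≤l = ℕ.<⇒≤ (ℕ.*-cancelʳ-< 4 25 l (ℕ.≤-<-trans (ℕ.≤-trans (ℕ.m≤m+n 100 92) (ℕ.*-monoʳ-≤ 96 (massBound≥2 e))) l-large))

    n≥ : 110 ℕ.* e ℕ.+ 28 ℕ.≤ n
    n≥ = ℕ.≤-trans (ℕ.m≤n+m _ (1 ℕ.+ massBound e ℕ.* 576)) n-large

  comb-low : ∀ q → q ℕ.≤ 5 → 0ℤ ℤ.< comb (p (+ e)) γ q
  comb-low q q≤5 = comb-positive-large l e q (l ℕ.∸ q) l≡ l-large (ℕ.+-cancelˡ-≤ q (4 ℕ.* q) (l ℕ.∸ q)
      (ℕ.≤-trans (ℕ.≤-trans (ℕ.*-monoʳ-≤ 5 q≤5) 25≤l) (ℕ.≤-reflexive l≡)))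
    where
    l≡ : l ≡ q ℕ.+ (l ℕ.∸ q)
    l≡ = ≡.sym (ℕ.m+[n∸m]≡n (ℕ.≤-trans q≤5 (ℕ.≤-trans (ℕ.m≤m+n 5 20) 25≤l)))

  comb-weight : (∀ Q → Q ℕ.+ D ℕ.* e ≡ n ℕ.* e ℕ.+ n → 5 ℕ.* Q ⁴ ℕ.< (n ℕ.* e) ⁴) → ∀ q → D ℕ.≤ q ℕ.* 8 → D ℕ.* e ℕ.≤ n ℕ.* e ℕ.+ n →
    q ℕ.≤ l → 0ℤ ℤ.< comb (p (+ e)) γ q
  comb-weight violates q D≤ De≤ q≤l = comb-positive-small l e q M l≡ l-large
      (saddle-inequality n t l e _ Q n-eq (saddle-bound n t l e q M D Q n-eq t<24 l≡ n≥ D≤ Q-eq) (violates Q Q-eq))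
    where
    M = l ℕ.∸ q
    l≡ : l ≡ q ℕ.+ M
    l≡ = ≡.sym (ℕ.m+[n∸m]≡n q≤l)
    Q = n ℕ.* e ℕ.+ n ℕ.∸ D ℕ.* e
    Q-eq : Q ℕ.+ D ℕ.* e ≡ n ℕ.* e ℕ.+ n
    Q-eq = ℕ.m∸n+n≡m De≤

module _ (e : ℕ) {n} (C : Vec Z4 n → Set) (isCode : IsCode C) (selfDual : IsSelfDual C) (D : ℕ) (n-large : threshold e ℕ.≤ n)
         (weights : ∀ c → C (map dbl c) → ones c ≡ 0 ⊎ D ℕ.≤ 2 ℕ.* ones c) where

  private
    l t : ℕ
    l = proj₁ (length-decomposition n)
    t = proj₁ (proj₂ (length-decomposition n))

    n-eq : n ℕ.+ t ℕ.+ 32 ≡ l ℕ.* 24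
    n-eq = proj₁ (proj₂ (proj₂ (length-decomposition n)))

    t<24 : t ℕ.< 24
    t<24 = proj₂ (proj₂ (proj₂ (length-decomposition n)))

    -- If D ≤ 8q with q ≤ l, then D ≤ n, so the subtraction that defines `Q` is exact. For q > l the
    -- combination is zero and no `Q` is needed.
    8l≤n : l ℕ.* 8 ℕ.≤ n
    8l≤n = ℕ.*-cancelʳ-≤ (l ℕ.* 8) n 3 (begin
      l ℕ.* 8 ℕ.* 3     ≡⟨ ℕ.*-assoc l 8 3 ⟩
      l ℕ.* 24          ≡⟨ n-eq ⟨
      n ℕ.+ t ℕ.+ 32    ≡⟨ ℕ.+-assoc n t 32 ⟩
      n ℕ.+ (t ℕ.+ 32)  ≤⟨ ℕ.+-monoʳ-≤ n (ℕ.+-monoˡ-≤ 32 (ℕ.s≤s⁻¹ t<24)) ⟩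
      n ℕ.+ 55          ≤⟨ ℕ.+-monoʳ-≤ n (ℕ.≤-trans (ℕ.n≤1+n 55) (ℕ.+-mono-≤ n≥28 n≥28)) ⟩
      n ℕ.+ (n ℕ.+ n)   ≡⟨ arith n ⟩
      n ℕ.* 3 ∎)
      where
      open ℕ.≤-Reasoning
      arith : ∀ n → n ℕ.+ (n ℕ.+ n) ≡ n ℕ.* 3
      arith = solve-ℕ
      n≥28 : 28 ℕ.≤ n
      n≥28 = ℕ.≤-trans (ℕ.m≤n+m 28 (110 ℕ.* e)) (ℕ.≤-trans (ℕ.m≤n+m (110 ℕ.* e ℕ.+ 28) (1 ℕ.+ massBound e ℕ.* 576)) n-large)

    -- The assumption is that every admissible `Q` violates the bound. The goal is a negation, so
    -- the double negation around decidability of `C` can be removed.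
    contradiction : ¬ (∀ Q → Q ℕ.+ D ℕ.* e ≡ n ℕ.* e ℕ.+ n → 5 ℕ.* Q ⁴ ℕ.< (n ℕ.* e) ⁴)
    contradiction violates = ¬¬-Vec 4 n (λ x → ¬¬-dec) λ C? →
      lp-contradiction C isCode selfDual C? l t e D n-eq t<24 weights (comb-low n t l e D n-eq t<24 n-large 0 z≤n) nonNeg
      where
      low : ∀ q → D ℕ.≤ q ℕ.* 8 → Dec (q ℕ.≤ l) → 0ℤ ℤ.≤ comb (p (+ e)) (Gamma.γ l) q
      low q D≤ (yes q≤l) = ℤ.<⇒≤ (comb-weight n t l e D n-eq t<24 n-large violates q D≤
        (ℕ.≤-trans (ℕ.*-monoˡ-≤ e (ℕ.≤-trans D≤ (ℕ.≤-trans (ℕ.*-monoˡ-≤ 8 q≤l) 8l≤n))) (ℕ.m≤m+n _ n)) q≤l)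
      low q D≤ (no q≰l) = ℤ.≤-reflexive (≡.sym (comb-high l (p (+ e)) q (ℕ.≰⇒> q≰l)))
      nonNeg : ∀ q → q ℕ.≤ 5 ⊎ D ℕ.≤ q ℕ.* 8 → 0ℤ ℤ.≤ comb (p (+ e)) (Gamma.γ l) q
      nonNeg q (inj₁ q≤5) = ℤ.<⇒≤ (comb-low n t l e D n-eq t<24 n-large q q≤5)
      nonNeg q (inj₂ D≤)  = low q D≤ (q ℕ.≤? l)

    decide : Dec (D ℕ.* e ℕ.≤ n ℕ.* e ℕ.+ n) → (∀ Q → Dec ((n ℕ.* e) ⁴ ℕ.≤ 5 ℕ.* Q ⁴)) →
      ∃ λ Q → Q ℕ.+ D ℕ.* e ≡ n ℕ.* e ℕ.+ n × (n ℕ.* e) ⁴ ℕ.≤ 5 ℕ.* Q ⁴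
    -- Here no `Q` solves the equation, so the assumption refuted by `contradiction` holds
    -- vacuously.
    decide (no ≰) _ = ⊥-elim (contradiction λ Q eq → ⊥-elim (≰ (subst (D ℕ.* e ℕ.≤_) eq (ℕ.m≤n+m (D ℕ.* e) Q))))
    decide (yes ≤) Q? = finish (Q? Q₀)
      where
      Q₀ = n ℕ.* e ℕ.+ n ℕ.∸ D ℕ.* e
      Q₀-eq : Q₀ ℕ.+ D ℕ.* e ≡ n ℕ.* e ℕ.+ n
      Q₀-eq = ℕ.m∸n+n≡m ≤
      finish : Dec ((n ℕ.* e) ⁴ ℕ.≤ 5 ℕ.* Q₀ ⁴) → ∃ λ Q → Q ℕ.+ D ℕ.* e ≡ n ℕ.* e ℕ.+ n × (n ℕ.* e) ⁴ ℕ.≤ 5 ℕ.* Q ⁴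
      finish (yes h) = Q₀ , Q₀-eq , h
      finish (no ¬h) = ⊥-elim (contradiction λ Q eq → subst (λ z → 5 ℕ.* z ⁴ ℕ.< (n ℕ.* e) ⁴)
        (ℕ.+-cancelʳ-≡ (D ℕ.* e) Q₀ Q (≡.trans Q₀-eq (≡.sym eq))) (ℕ.≰⇒> ¬h))

  weight-bound : ∃ λ Q → Q ℕ.+ D ℕ.* e ≡ n ℕ.* e ℕ.+ n × (n ℕ.* e) ⁴ ℕ.≤ 5 ℕ.* Q ⁴
  weight-bound = decide (D ℕ.* e ℕ.≤? n ℕ.* e ℕ.+ n) λ Q → (n ℕ.* e) ⁴ ℕ.≤? 5 ℕ.* Q ⁴

code-bound : ∀ {n} (C : Vec Z4 n → Set) → IsCode C → IsSelfDual C → ∀ c d ε k → 1 ℕ.≤ c → 1ℚ ℚ.≤ ε ℚ.* ι (suc k) →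
  threshold (suc k) ℕ.≤ n → (∀ a → C (map dbl a) → ones a ≡ 0 ⊎ c ℕ.* d ℕ.≤ 2 ℕ.* ones a) → LeOneMinusFifthRoot (ι c ℚ.* (ratio d n ℚ.- ε))
code-bound {suc n} C isCode selfDual c d ε k c≥1 εe≥1 n-large weights =
  rational-bound n k c d ε (proj₁ Q) c≥1 εe≥1 (proj₁ (proj₂ Q)) (proj₂ (proj₂ Q))
  where
  Q = weight-bound (suc k) C isCode selfDual (c ℕ.* d) n-large weights

minWeight-dbl : ∀ {n} (C : Vec Z4 n → Set) (wt : Vec Z4 n → ℕ) d → IsMinWeight wt C d → ∀ a → C (map dbl a) → ones a ≡ 0 ⊎ d ℕ.≤ wt (map dbl a)
minWeight-dbl C wt d (_ , minimal) a Ca with ones a ℕ.≟ 0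
... | yes z = inj₁ z
... | no ¬z = inj₂ (minimal (map dbl a) Ca λ eq → ¬z (dbl-zero a eq))

theorem4 : (n : ℕ → ℕ) (C : (i : ℕ) → Vec Z4 (n i) → Set)
    → (∀ i → IsCode (C i)) → (∀ i → IsSelfDual (C i))
    → TendsToInfinity n
    → (dH dL : ℕ → ℕ)
    → (∀ i → 1 ≤ n i → IsMinWeight wtH (C i) (dH i))
    → (∀ i → 1 ≤ n i → IsMinWeight wtL (C i) (dL i))
    → LimsupLe (λ i → ratio (dH i) (n i)) LeHalfOneMinusFifthRoot
    × LimsupLe (λ i → ratio (dL i) (n i)) LeOneMinusFifthRoot
theorem4 n C isCode selfDual n→∞ dH dL minH minL = hamming , lee
  where
  positive-length : ∀ {k i} → threshold k ℕ.≤ n i → 1 ℕ.≤ n i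
  positive-length = ℕ.≤-trans (s≤s z≤n)

  hamming : LimsupLe (λ i → ratio (dH i) (n i)) LeHalfOneMinusFifthRoot
  hamming ε ε>0 with reciprocal ε ε>0
  ... | k , εe≥1 with n→∞ (threshold (suc k))
  ... | N , large = N , λ i N≤i → code-bound (C i) (isCode i) (selfDual i) 2 (dH i) ε k (s≤s z≤n) εe≥1 (large i N≤i)
    λ a Ca → double a (minWeight-dbl (C i) wtH (dH i) (minH i (positive-length (large i N≤i))) a Ca)
    where
    double : ∀ {m} (a : Vec F₂ m) {d} → ones a ≡ 0 ⊎ d ℕ.≤ wtH (map dbl a) → ones a ≡ 0 ⊎ 2 ℕ.* d ℕ.≤ 2 ℕ.* ones a
    double a (inj₁ z) = inj₁ z
    double a (inj₂ h) = inj₂ (ℕ.*-monoʳ-≤ 2 (ℕ.≤-trans h (ℕ.≤-reflexive (wtH-dbl a))))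

  lee : LimsupLe (λ i → ratio (dL i) (n i)) LeOneMinusFifthRoot
  lee ε ε>0 with reciprocal ε ε>0
  ... | k , εe≥1 with n→∞ (threshold (suc k))
  ... | N , large = N , λ i N≤i → subst LeOneMinusFifthRoot (ℚ.*-identityˡ (ratio (dL i) (n i) ℚ.- ε))
    (code-bound (C i) (isCode i) (selfDual i) 1 (dL i) ε k (s≤s z≤n) εe≥1 (large i N≤i)
      λ a Ca → single a (minWeight-dbl (C i) wtL (dL i) (minL i (positive-length (large i N≤i))) a Ca))
    where
    single : ∀ {m} (a : Vec F₂ m) {d} → ones a ≡ 0 ⊎ d ℕ.≤ wtL (map dbl a) → ones a ≡ 0 ⊎ 1 ℕ.* d ℕ.≤ 2 ℕ.* ones a
    single a (inj₁ z) = inj₁ z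
    single a {d} (inj₂ h) = inj₂ (ℕ.≤-trans (ℕ.≤-reflexive (ℕ.*-identityˡ d)) (ℕ.≤-trans h (ℕ.≤-reflexive (wtL-dbl a))))
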